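{- Let $P\subset\mathbb R^3$ be an empty lattice polytope with $|P|=5$ and $L(P)=1$. Let $Q\subset\mathbb R^3$ be a lattice polytope with $|Q|=4$, $L(Q)=1$, and $L(P+Q)=2$. Then the pair $(P,Q)$ is equivalent to $(E,S_2)$.
   Context: $|P|$ is the number of lattice points of $P$; $P$ is empty if its only lattice points are its vertices. The Minkowski length $L(P)$ is the largest $L$ such that $P$ contains a Minkowski sum of $L$ lattice polytopes each of positive dimension. Pairs $(P,Q)$, $(P',Q')$ are equivalent if there is an affine unimodular map $\varphi$ (i.e. $x\mapsto Ux+b$, $U\in\mathrm{GL}(3,\mathbb Z)$, $b\in\mathbb Z^3$) and lattice vectors $v,w$ with $P'=\varphi(P)+v$, $Q'=\varphi(Q)+w$. $E=\operatorname{conv}\{0,e_1,e_2,e_3,e_1+e_2+e_3\}$, $S_2=\operatorname{conv}\{e_1,e_2,e_3,e_1+e_2+e_3\}$. -}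

module Defs where

open import Data.Nat using (ℕ; zero; suc)
import Data.Nat as ℕ
open import Data.Integer using (ℤ; +_)
import Data.Integer as ℤ
open import Data.Rational using (ℚ; 0ℚ; 1ℚ; _+_; _*_; _≤_; _/_)
open import Data.Fin using (Fin; zero; suc)
open import Data.List using (List; []; _∷_; length; lookup)
open import Data.List.Relation.Unary.All using (All)
open import Data.List.Relation.Unary.Any using (Any)
open import Data.List.Relation.Unary.AllPairs using (AllPairs)
open import Data.Product using (Σ; ∃; ∃-syntax; _×_; _,_)
open import Relation.Binary.PropositionalEquality using (_≡_)
open import Relation.Nullary using (¬_)
open import Function.Bundles using (_⇔_)

Pt : Set
Pt = Fin 3 → ℤ

QPt : Set
QPt = Fin 3 → ℚ

-- pointwise equality (avoids function extensionality)
_≈ᶻ_ : Pt → Pt → Set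
a ≈ᶻ b = ∀ i → a i ≡ b i

_≈_ : QPt → QPt → Set
x ≈ y = ∀ i → x i ≡ y i

embed : Pt → QPt
embed z i = z i / 1

_⊕ᵖ_ : QPt → QPt → QPt
(x ⊕ᵖ y) i = x i + y i

_·ᵖ_ : ℚ → QPt → QPt
(c ·ᵖ x) i = c * x i

zeroᵖ : QPt
zeroᵖ _ = 0ℚ

_∈ᵖ_ : Pt → List Pt → Set
z ∈ᵖ G = Any (λ g → g ≈ᶻ z) G

sumF : ∀ {n} → (Fin n → ℚ) → ℚ
sumF {zero}  w = 0ℚ
sumF {suc n} w = w zero + sumF (λ i → w (suc i))

comb : (G : List Pt) → (Fin (length G) → ℚ) → QPt
comb []      w = zeroᵖ
comb (g ∷ G) w = (w zero ·ᵖ embed g) ⊕ᵖ comb G (λ i → w (suc i))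

IsConvexWeight : (G : List Pt) → (Fin (length G) → ℚ) → Set
IsConvexWeight G w = (∀ i → 0ℚ ≤ w i) × sumF w ≡ 1ℚ

Region : Set₁
Region = QPt → Set

conv : List Pt → Region
conv G x = ∃[ w ] (IsConvexWeight G w × comb G w ≈ x)

IsVertex : List Pt → Pt → Set
IsVertex G v =
  v ∈ᵖ G ×
  ¬ (∃[ w ] (IsConvexWeight G w
             × (∀ i → lookup G i ≈ᶻ v → w i ≡ 0ℚ)
             × comb G w ≈ embed v))

EmptyPolytope : List Pt → Set
EmptyPolytope G = ∀ z → conv G (embed z) → IsVertex G z

LatticeCount : Region → ℕ → Set
LatticeCount S n =
  ∃[ zs ] (AllPairs (λ a b → ¬ (a ≈ᶻ b)) zs
           × (∀ z → S (embed z) ⇔ z ∈ᵖ zs)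
           × length zs ≡ n)

_⊕_ : Region → Region → Region
(S ⊕ T) x = ∃[ y ] ∃[ z ] (S y × T z × x ≈ (y ⊕ᵖ z))

MinkSum : List (List Pt) → Region
MinkSum []       x = x ≈ zeroᵖ
MinkSum (G ∷ Gs) = conv G ⊕ MinkSum Gs

PositiveDim : List Pt → Set
PositiveDim G = ∃[ a ] ∃[ b ] (a ∈ᵖ G × b ∈ᵖ G × ¬ (a ≈ᶻ b))

ContainsSumOf : Region → ℕ → Set
ContainsSumOf S L =
  ∃[ Gs ] (length Gs ≡ L × All PositiveDim Gs × (∀ x → MinkSum Gs x → S x))

MinkowskiLength : Region → ℕ → Set
MinkowskiLength S L = ContainsSumOf S L × (∀ M → ContainsSumOf S M → M ℕ.≤ L)

Mat : Set
Mat = Fin 3 → Fin 3 → ℤ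

_·ᴹ_ : Mat → Mat → Mat
(U ·ᴹ V) i j = U i zero ℤ.* V zero j ℤ.+ (U i (suc zero) ℤ.* V (suc zero) j
               ℤ.+ U i (suc (suc zero)) ℤ.* V (suc (suc zero)) j)

δ : Fin 3 → Fin 3 → ℤ
δ zero zero = + 1
δ (suc i) (suc j) = δ' i j
  where
  δ' : Fin 2 → Fin 2 → ℤ
  δ' zero zero = + 1
  δ' (suc zero) (suc zero) = + 1
  δ' _ _ = + 0
δ _ _ = + 0

IsUnimodular : Mat → Set
IsUnimodular U = ∃[ V ] ((∀ i j → (U ·ᴹ V) i j ≡ δ i j) × (∀ i j → (V ·ᴹ U) i j ≡ δ i j))

affApply : Mat → Pt → QPt → QPt
affApply U b y i =
  ((U i zero / 1) * y zero + ((U i (suc zero) / 1) * y (suc zero)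
     + (U i (suc (suc zero)) / 1) * y (suc (suc zero)))) + b i / 1

ImageTrans : Mat → Pt → Pt → Region → Region
ImageTrans U b v S x = ∃[ y ] (S y × x ≈ (affApply U b y ⊕ᵖ embed v))

EquivalentPairs : Region → Region → Region → Region → Set
EquivalentPairs P Q P' Q' =
  ∃[ U ] (IsUnimodular U × ∃[ b ] ∃[ v ] ∃[ w ]
    ((∀ x → P' x ⇔ ImageTrans U b v P x) × (∀ x → Q' x ⇔ ImageTrans U b w Q x)))

e₀ e₁ e₂ e₃ e₁₂₃ : Pt
e₀ _ = + 0
e₁ zero = + 1
e₁ _    = + 0
e₂ (suc zero) = + 1
e₂ _          = + 0
e₃ (suc (suc zero)) = + 1
e₃ _                = + 0
e₁₂₃ _ = + 1

E : Region
E = conv (e₀ ∷ e₁ ∷ e₂ ∷ e₃ ∷ e₁₂₃ ∷ [])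

S₂ : Region
S₂ = conv (e₁ ∷ e₂ ∷ e₃ ∷ e₁₂₃ ∷ [])

{-# OPTIONS --safe #-}
-- Let S be the set of lattice points of P + Q. Because L(P + Q) = 2, distinct points of S are never congruent
-- modulo 3, and no two different parallel segments in S have the same even difference vector. Hence the residues of the
-- points of P and Q modulo 3 and modulo 2 are very restricted, and finitely many cases over F₃ and F₂ show that P
-- and Q have a common edge and then that Q is a translate of the hull of four points of P. The residues of the sum
-- of all points of P next give P = conv(r, r + b₁, r + b₂, r + b₃, r + b₁ + b₂ + b₃), where Q omits r. It remains
-- to see that b₁, b₂, b₃ generate ℤ³. A lattice point z may be moved into the cube they span. If neither r + z nor
-- the reflected point lies in P, then both z and its reflection lie in corners of the cube, convexity of P + Q puts
-- several translates of z into S, and one of these is congruent modulo 3 to a sum of two vertices, hence equal to it.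

module Submission where

open import Defs
open import Data.List using (List)
open import Data.Bool using (Bool; true; false; _∧_; _∨_; not; if_then_else_)
open import Data.Empty using (⊥; ⊥-elim)
open import Data.Fin using (Fin; zero; suc; inject₁)
import Data.Fin as Fin
import Data.Fin.Properties as Finₚ
open import Data.Integer using (ℤ; +_; -[1+_])
import Data.Integer as ℤ
import Data.Integer.DivMod as ℤD
import Data.Integer.Properties as ℤₚ
open import Data.Integer.Tactic.RingSolver using (solve-∀)
open import Data.List using ([]; _∷_; length; lookup; map; concatMap; _++_)
open import Data.List.Membership.Propositional using (_∈_)
open import Data.List.Properties using (length-map)
open import Data.List.Relation.Unary.All using (All; []; _∷_)
import Data.List.Relation.Unary.All as All
import Data.List.Relation.Unary.All.Properties as Allₚ
open import Data.List.Relation.Unary.AllPairs using (AllPairs; []; _∷_)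
open import Data.List.Relation.Unary.Any using (here; there)
open import Data.Nat using (ℕ; zero; suc; s≤s; z≤n)
import Data.Nat as ℕ
import Data.Nat.Coprimality as Cop
import Data.Nat.Properties as ℕₚ
open import Data.Product using (Σ; ∃-syntax; _×_; _,_; proj₁; proj₂)
open import Data.Sum using (_⊎_; inj₁; inj₂; [_,_]′)
open import Function.Bundles using (_⇔_; mk⇔; Equivalence)
open import Relation.Binary.PropositionalEquality hiding (resp)
open import Relation.Nullary using (¬_; Dec; yes; no)

-- The pair is only known up to unimodular maps, so nothing bounds its coordinates. The search
-- becomes finite because congruences can be turned back into equalities: two vertex sums with the
-- same residue modulo 3 are the same point, so every coincidence seen in F₃³ holds in ℤ³. In the
-- enumeration, points of S not yet known to be vertex sums enter as half sums of two vertex sums of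
-- equal parity. Convexity puts the half sum in S, its residue modulo 3 is determined, and a vertex
-- sum with that residue must be the half sum itself. Residues modulo 2 thus say where midpoints
-- exist, and residues modulo 3 say which points they are. The two coordinate systems are chosen
-- independently of each other. Residues do not bound the volume of P: they show only that the index
-- of the lattice spanned by b₁, b₂, b₃ is prime to 3. This is why the last step works with rational
-- coordinates over the denominator |det|, and why classes modulo 3 can still be read off for an
-- arbitrary lattice point there.

data F₂ : Set where
  𝟎 𝟏 : F₂

data F₃ : Set where
  𝟎 𝟏 𝟐 : F₃

_+₂_ : F₂ → F₂ → F₂
𝟎 +₂ b = b
𝟏 +₂ 𝟎 = 𝟏
𝟏 +₂ 𝟏 = 𝟎

_+₃_ : F₃ → F₃ → F₃
𝟎 +₃ b = b
𝟏 +₃ 𝟎 = 𝟏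
𝟏 +₃ 𝟏 = 𝟐
𝟏 +₃ 𝟐 = 𝟎
𝟐 +₃ 𝟎 = 𝟐
𝟐 +₃ 𝟏 = 𝟎
𝟐 +₃ 𝟐 = 𝟏

-- A data type instead of `Fin 3 → K`, so that vectors with equal coordinates are propositionally
-- equal.
data Vec₃ (K : Set) : Set where
  vec : K → K → K → Vec₃ K

zipV : ∀ {K} → (K → K → K) → Vec₃ K → Vec₃ K → Vec₃ K
zipV _∙_ (vec a b c) (vec x y z) = vec (a ∙ x) (b ∙ y) (c ∙ z)

coord : ∀ {K} → Vec₃ K → Fin 3 → K
coord (vec a b c) zero = a
coord (vec a b c) (suc zero) = b
coord (vec a b c) (suc (suc zero)) = c

-- Convex regions, the cones over them, and zonotopes inside them

module Convexity where
  open import Data.Rational using (ℚ; 0ℚ; 1ℚ; _+_; _*_; _≤_; _/_; mkℚ; 1/_)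
  import Data.Rational as ℚ
  import Data.Rational.Properties as ℚₚ
  open import Data.Rational.Solver using (module +-*-Solver)

  ι : ℤ → ℚ
  ι z = z / 1

  -- The quotient `z / 1` passes through a normalisation that is stuck on a variable `z`. In the
  -- explicit form sums and products of integers compute.
  ι-mkℚ : ∀ z → ι z ≡ mkℚ z 0 (Cop.sym (Cop.1-coprimeTo ℤ.∣ z ∣))
  ι-mkℚ z = ℚₚ.↥p/↧p≡p (mkℚ z 0 (Cop.sym (Cop.1-coprimeTo ℤ.∣ z ∣)))

  ι-+ : ∀ a b → ι (a ℤ.+ b) ≡ ι a + ι b
  ι-+ a b rewrite ι-mkℚ a | ι-mkℚ b =
    cong (_/ 1) (cong₂ ℤ._+_ (sym (ℤₚ.*-identityʳ a)) (sym (ℤₚ.*-identityʳ b)))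

  ι-* : ∀ a b → ι (a ℤ.* b) ≡ ι a * ι b
  ι-* a b rewrite ι-mkℚ a | ι-mkℚ b = refl

  ι-≥0 : ∀ n → 0ℚ ≤ ι (+ n)
  ι-≥0 n = ℚₚ.nonNegative⁻¹ (ι (+ n)) {{ℚₚ.normalize-nonNeg n 1}}

  0≤* : ∀ {p q} → 0ℚ ≤ p → 0ℚ ≤ q → 0ℚ ≤ p * q
  0≤* {p} {q} hp hq = ℚₚ.≤-trans (ℚₚ.≤-reflexive (sym (ℚₚ.*-zeroʳ p)))
    (ℚₚ.*-monoˡ-≤-nonNeg p {{ℚ.nonNegative hp}} hq)

  0≤+ : ∀ {p q} → 0ℚ ≤ p → 0ℚ ≤ q → 0ℚ ≤ p + q
  0≤+ hp hq = ℚₚ.+-mono-≤ hp hq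

  recip : ℕ → ℚ
  recip n = 1/_ (ι (+ suc n)) {{ℚₚ.pos⇒nonZero (ι (+ suc n)) {{ℚₚ.normalize-pos (suc n) 1}}}}

  recip-≥0 : ∀ n → 0ℚ ≤ recip n
  recip-≥0 n = ℚₚ.<⇒≤ (ℚₚ.positive⁻¹ (recip n) {{ℚₚ.1/pos⇒pos (ι (+ suc n)) {{ℚₚ.normalize-pos (suc n) 1}}}})

  recip-* : ∀ n → recip n * ι (+ suc n) ≡ 1ℚ
  recip-* n = ℚₚ.*-inverseˡ (ι (+ suc n)) {{ℚₚ.pos⇒nonZero (ι (+ suc n)) {{ℚₚ.normalize-pos (suc n) 1}}}}

  -- A region together with the convex cone over it: C c x means that x lies in c times the region.
  record Conic (R : Region) : Set₁ where
    field
      C     : ℚ → QPt → Set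
      resp  : ∀ {c d x y} → c ≡ d → x ≈ y → C c x → C d y
      zeroC : C 0ℚ zeroᵖ
      addC  : ∀ {c d x y} → C c x → C d y → C (c + d) (x ⊕ᵖ y)
      scale : ∀ {c x} s → 0ℚ ≤ s → C c x → C (s * c) (s ·ᵖ x)
      to    : ∀ {x} → R x → C 1ℚ x
      from  : ∀ {x} → C 1ℚ x → R x

  Σw : List (ℕ × Pt) → ℕ
  Σw [] = 0
  Σw ((n , _) ∷ L) = n ℕ.+ Σw L

  Σp : List (ℕ × Pt) → Pt
  Σp [] i = + 0
  Σp ((n , x) ∷ L) i = + n ℤ.* x i ℤ.+ Σp L i

  module _ {R : Region} (K : Conic R) where
    open Conic K

    region-resp : ∀ {x y} → x ≈ y → R x → R y
    region-resp e hx = from (resp refl e (to hx))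

    cone-sum : ∀ L → All (λ nx → R (embed (proj₂ nx))) L → C (ι (+ Σw L)) (embed (Σp L))
    cone-sum [] [] = zeroC
    cone-sum ((n , x) ∷ L) (h ∷ hs) =
      resp (trans (cong (_+ ι (+ Σw L)) (ℚₚ.*-identityʳ (ι (+ n)))) (sym (ι-+ (+ n) (+ Σw L))))
        (λ i → trans (cong (_+ ι (Σp L i)) (sym (ι-* (+ n) (x i)))) (sym (ι-+ (+ n ℤ.* x i) (Σp L i))))
        (addC (scale (ι (+ n)) (ι-≥0 n) (to h)) (cone-sum L hs))

    -- The form in which convexity is used for lattice points: natural weights and an integer
    -- identity, with the division by `suc N` done once by scaling in the cone.
    weighted-mean : ∀ L z N → Σw L ≡ suc N → (∀ i → Σp L i ≡ + suc N ℤ.* z i) →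
      All (λ nx → R (embed (proj₂ nx))) L → R (embed z)
    weighted-mean L z N eN ez hs =
      from (resp (trans (cong (λ k → recip N * ι (+ k)) eN) (recip-* N))
        (λ i → begin
          recip N * ι (Σp L i)              ≡⟨ cong (λ k → recip N * ι k) (ez i) ⟩
          recip N * ι (+ suc N ℤ.* z i)     ≡⟨ cong (recip N *_) (ι-* (+ suc N) (z i)) ⟩
          recip N * (ι (+ suc N) * ι (z i)) ≡⟨ sym (ℚₚ.*-assoc (recip N) (ι (+ suc N)) (ι (z i))) ⟩
          recip N * ι (+ suc N) * ι (z i)   ≡⟨ cong (_* ι (z i)) (recip-* N) ⟩
          1ℚ * ι (z i)                      ≡⟨ ℚₚ.*-identityˡ (ι (z i)) ⟩
          ι (z i) ∎)
        (scale (recip N) (recip-≥0 N) (cone-sum L hs)))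
      where open ≡-Reasoning

  sumF-+ : ∀ {n} (v w : Fin n → ℚ) → sumF (λ i → v i + w i) ≡ sumF v + sumF w
  sumF-+ {zero} v w = refl
  sumF-+ {suc n} v w rewrite sumF-+ (λ i → v (suc i)) (λ i → w (suc i)) =
    solve 4 (λ a b c d → (a :+ b) :+ (c :+ d) := (a :+ c) :+ (b :+ d)) refl (v zero) (w zero) _ _
    where open +-*-Solver

  sumF-* : ∀ {n} s (w : Fin n → ℚ) → sumF (λ i → s * w i) ≡ s * sumF w
  sumF-* {zero} s w = sym (ℚₚ.*-zeroʳ s)
  sumF-* {suc n} s w rewrite sumF-* s (λ i → w (suc i)) = sym (ℚₚ.*-distribˡ-+ s (w zero) _)

  sumF-0 : ∀ n → sumF {n} (λ _ → 0ℚ) ≡ 0ℚ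
  sumF-0 zero = refl
  sumF-0 (suc n) = trans (ℚₚ.+-identityˡ _) (sumF-0 n)

  comb-+ : ∀ G v w → comb G (λ i → v i + w i) ≈ (comb G v ⊕ᵖ comb G w)
  comb-+ [] v w j = refl
  comb-+ (g ∷ G) v w j rewrite comb-+ G (λ i → v (suc i)) (λ i → w (suc i)) j =
    solve 5 (λ a b e c d → (a :+ b) :* e :+ (c :+ d) := (a :* e :+ c) :+ (b :* e :+ d)) refl
      (v zero) (w zero) (embed g j) _ _
    where open +-*-Solver

  comb-* : ∀ G s w → comb G (λ i → s * w i) ≈ (s ·ᵖ comb G w)
  comb-* [] s w j = sym (ℚₚ.*-zeroʳ s)
  comb-* (g ∷ G) s w j rewrite comb-* G s (λ i → w (suc i)) j =
    solve 4 (λ s a e c → s :* a :* e :+ s :* c := s :* (a :* e :+ c)) refl s (w zero) (embed g j) _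
    where open +-*-Solver

  comb-0 : ∀ G → comb G (λ _ → 0ℚ) ≈ zeroᵖ
  comb-0 [] j = refl
  comb-0 (g ∷ G) j rewrite comb-0 G j = trans (ℚₚ.+-identityʳ _) (ℚₚ.*-zeroˡ (embed g j))

  -- The hull of the generators outside `Z`. With `Z` empty it is `conv G`; with `Z` the generators
  -- equal to `v` it is the region that `IsVertex` keeps `v` out of.
  convOn : (G : List Pt) → (Fin (length G) → Set) → Region
  convOn G Z x = ∃[ w ] (IsConvexWeight G w × (∀ i → Z i → w i ≡ 0ℚ) × comb G w ≈ x)

  convOn-conic : ∀ G Z → Conic (convOn G Z)
  convOn-conic G Z = record
    { C     = Cone
    ; resp  = λ { refl e (w , nn , s , z , c) → w , nn , s , z , λ i → trans (c i) (e i) }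
    ; zeroC = (λ _ → 0ℚ) , (λ _ → ℚₚ.≤-refl) , sumF-0 (length G) , (λ _ _ → refl) , comb-0 G
    ; addC  = λ { (v , vn , vs , vz , vc) (w , wn , ws , wz , wc) →
        (λ i → v i + w i) , (λ i → 0≤+ (vn i) (wn i)) , trans (sumF-+ v w) (cong₂ _+_ vs ws) ,
        (λ i z → trans (cong₂ _+_ (vz i z) (wz i z)) refl) ,
        λ i → trans (comb-+ G v w i) (cong₂ _+_ (vc i) (wc i)) }
    ; scale = λ { s hs (w , wn , ws , wz , wc) →
        (λ i → s * w i) , (λ i → 0≤* hs (wn i)) , trans (sumF-* s w) (cong (s *_) ws) ,
        (λ i z → trans (cong (s *_) (wz i z)) (ℚₚ.*-zeroʳ s)) ,
        λ i → trans (comb-* G s w i) (cong (s *_) (wc i)) }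
    ; to    = λ { (w , (wn , ws) , wz , wc) → w , wn , ws , wz , wc }
    ; from  = λ { (w , wn , ws , wz , wc) → w , (wn , ws) , wz , wc }
    }
    where
    Cone : ℚ → QPt → Set
    Cone c x = ∃[ w ] ((∀ i → 0ℚ ≤ w i) × sumF w ≡ c × (∀ i → Z i → w i ≡ 0ℚ) × comb G w ≈ x)

  conv-conic : ∀ G → Conic (conv G)
  conv-conic G = record
    { C = C ; resp = resp ; zeroC = zeroC ; addC = addC ; scale = scale
    ; to = λ { (w , h , e) → to (w , h , (λ _ ()) , e) }
    ; from = λ c → let (w , h , _ , e) = from c in w , h , e }
    where open Conic (convOn-conic G (λ _ → ⊥))

  ⊕-conic : ∀ {R T} → Conic R → Conic T → Conic (R ⊕ T)
  ⊕-conic {R} {T} K L = record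
    { C     = C
    ; resp  = λ { refl e (y , z , a , b , f) → y , z , a , b , λ i → trans (sym (e i)) (f i) }
    ; zeroC = zeroᵖ , zeroᵖ , K.zeroC , L.zeroC , λ _ → refl
    ; addC  = λ { (y , z , a , b , f) (y′ , z′ , a′ , b′ , f′) →
        (y ⊕ᵖ y′) , (z ⊕ᵖ z′) , K.addC a a′ , L.addC b b′ ,
        λ i → trans (cong₂ _+_ (f i) (f′ i)) (swap (y i) (z i) (y′ i) (z′ i)) }
    ; scale = λ { s hs (y , z , a , b , f) →
        (s ·ᵖ y) , (s ·ᵖ z) , K.scale s hs a , L.scale s hs b ,
        λ i → trans (cong (s *_) (f i)) (ℚₚ.*-distribˡ-+ s (y i) (z i)) }
    ; to    = λ { (y , z , a , b , f) → y , z , K.to a , L.to b , f }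
    ; from  = λ { (y , z , a , b , f) → y , z , K.from a , L.from b , f }
    }
    where
    module K = Conic K
    module L = Conic L
    C : ℚ → QPt → Set
    C c x = ∃[ y ] ∃[ z ] (K.C c y × L.C c z × x ≈ (y ⊕ᵖ z))
    swap : ∀ a b c d → (a + b) + (c + d) ≡ (a + c) + (b + d)
    swap = solve 4 (λ a b c d → (a :+ b) :+ (c :+ d) := (a :+ c) :+ (b :+ d)) refl
      where open +-*-Solver

  δw : ∀ {n} → Fin n → Fin n → ℚ
  δw zero zero = 1ℚ
  δw zero (suc _) = 0ℚ
  δw (suc _) zero = 0ℚ
  δw (suc i) (suc j) = δw i j

  δw-≥0 : ∀ {n} (i j : Fin n) → 0ℚ ≤ δw i j
  δw-≥0 zero zero = ℚₚ.nonNegative⁻¹ 1ℚ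
  δw-≥0 zero (suc _) = ℚₚ.≤-refl
  δw-≥0 (suc _) zero = ℚₚ.≤-refl
  δw-≥0 (suc i) (suc j) = δw-≥0 i j

  sumF-δw : ∀ {n} (i : Fin n) → sumF (δw i) ≡ 1ℚ
  sumF-δw {suc n} zero = trans (cong (_+_ 1ℚ) (sumF-0 n)) (ℚₚ.+-identityʳ 1ℚ)
  sumF-δw (suc i) = trans (ℚₚ.+-identityˡ _) (sumF-δw i)

  comb-δw : ∀ G (i : Fin (length G)) → comb G (δw i) ≈ embed (lookup G i)
  comb-δw (g ∷ G) zero j = trans (cong₂ _+_ (ℚₚ.*-identityˡ (embed g j)) (comb-0 G j)) (ℚₚ.+-identityʳ _)
  comb-δw (g ∷ G) (suc i) j = trans (cong₂ _+_ (ℚₚ.*-zeroˡ (embed g j)) (comb-δw G i j)) (ℚₚ.+-identityˡ _)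

  δw-off : ∀ {n} (i j : Fin n) → ¬ i ≡ j → δw i j ≡ 0ℚ
  δw-off zero zero h = ⊥-elim (h refl)
  δw-off zero (suc _) h = refl
  δw-off (suc _) zero h = refl
  δw-off (suc i) (suc j) h = δw-off i j (λ e → h (cong suc e))

  index-of : ∀ {z G} → z ∈ᵖ G → ∃[ i ] lookup G i ≈ᶻ z
  index-of (here e) = zero , e
  index-of (there h) = let (i , e) = index-of h in suc i , e

  generator-in-convOn : ∀ G (Z : Fin (length G) → Set) i → ¬ Z i → convOn G Z (embed (lookup G i))
  generator-in-convOn G Z i nz =
    δw i , ((δw-≥0 i) , sumF-δw i) , (λ j zj → δw-off i j (λ { refl → nz zj })) , comb-δw G i

  lookup-∈ : ∀ (zs : List Pt) i → lookup zs i ∈ᵖ zs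
  lookup-∈ (z ∷ zs) zero = here (λ _ → refl)
  lookup-∈ (z ∷ zs) (suc i) = there (lookup-∈ zs i)

  ∈⇒conv : ∀ {z G} → z ∈ᵖ G → conv G (embed z)
  ∈⇒conv {z} {G} h with index-of h
  ... | i , e = δw i , (δw-≥0 i , sumF-δw i) , λ j → trans (comb-δw G i j) (cong ι (e j))

  -- The induction runs in the cone because the tail of a convex weight need not sum to 1.
  conv-least : ∀ {R} → Conic R → ∀ G → (∀ i → R (embed (lookup G i))) → ∀ x → conv G x → R x
  conv-least {R} K G hG x (w , (wn , ws) , wc) = from (resp ws wc (go G w wn hG))
    where
    open Conic K
    go : ∀ G (w : Fin (length G) → ℚ) → (∀ i → 0ℚ ≤ w i) → (∀ i → R (embed (lookup G i))) → C (sumF w) (comb G w)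
    go [] w wn h = zeroC
    go (g ∷ G) w wn h = addC (resp (ℚₚ.*-identityʳ (w zero)) (λ _ → refl) (scale (w zero) (wn zero) (to (h zero))))
      (go G (λ i → w (suc i)) (λ i → wn (suc i)) (λ i → h (suc i)))

  infixl 6 _+ᵖ_ _-ᵖ_
  infixl 7 _*ᵖ_

  _+ᵖ_ _-ᵖ_ : Pt → Pt → Pt
  (x +ᵖ y) i = x i ℤ.+ y i
  (x -ᵖ y) i = x i ℤ.- y i

  _*ᵖ_ : ℤ → Pt → Pt
  (c *ᵖ x) i = c ℤ.* x i

  0ᵖ : Pt
  0ᵖ _ = + 0

  ≈-sym : ∀ {x y} → x ≈ᶻ y → y ≈ᶻ x
  ≈-sym e i = sym (e i)

  ≈-trans : ∀ {x y z} → x ≈ᶻ y → y ≈ᶻ z → x ≈ᶻ z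
  ≈-trans e f i = trans (e i) (f i)

  _≈?_ : ∀ x y → Dec (x ≈ᶻ y)
  x ≈? y = Finₚ.all? (λ i → x i ℤ.≟ y i)

  infix 1 _by_
  infix 4 _≡_[mod_]
  record _≡_[mod_] (x y : Pt) (n : ℤ) : Set where
    constructor _by_
    field
      quotient   : Pt
      difference : x ≈ᶻ (y +ᵖ n *ᵖ quotient)

  -- Unification cannot recover `R` and `z` from `R (embed z)`; the wrapper keeps both visible.
  record _∋_ (R : Region) (z : Pt) : Set where
    constructor lattice
    field member : R (embed z)

  seg : Pt × Pt → List Pt
  seg (a , b) = a ∷ b ∷ []

  module _ {R : Region} (K : Conic R) where
    open Conic K

    Corners : List (Pt × Pt) → Pt → Set
    Corners [] x = R ∋ x
    Corners ((a , b) ∷ L) x = Corners L (x +ᵖ a) × Corners L (x +ᵖ b)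

    -- A point `s a + r b` of the first segment satisfies `x + (s a + r b) + t = s (x + a + t) + r
    -- (x + b + t)`, and both terms are covered by the remaining segments. A zonotope is therefore
    -- contained in a convex region once its corners are.
    corners⇒MinkSum : ∀ L x → Corners L x → ∀ y → MinkSum (map seg L) y → R (embed x ⊕ᵖ y)
    corners⇒MinkSum [] x (lattice h) y e =
      region-resp K (λ i → trans (sym (ℚₚ.+-identityʳ _)) (cong (_+_ (ι (x i))) (sym (e i)))) h
    corners⇒MinkSum ((a , b) ∷ L) x (ha , hb) y (u , t , (w , (wn , ws) , wc) , ht , e) =
      from (resp (trans (cong₂ _+_ (ℚₚ.*-identityʳ s) (ℚₚ.*-identityʳ r)) s+r≡1)
        (λ i → begin
          s * (ι (x i ℤ.+ a i) + t i) + r * (ι (x i ℤ.+ b i) + t i)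
            ≡⟨ cong₂ (λ α β → s * (α + t i) + r * (β + t i)) (ι-+ (x i) (a i)) (ι-+ (x i) (b i)) ⟩
          s * ((ι (x i) + ι (a i)) + t i) + r * ((ι (x i) + ι (b i)) + t i)
            ≡⟨ solve 6 (λ s r x a b t → s :* ((x :+ a) :+ t) :+ r :* ((x :+ b) :+ t)
                  := (s :+ r) :* (x :+ t) :+ (s :* a :+ r :* b)) refl s r (ι (x i)) (ι (a i)) (ι (b i)) (t i) ⟩
          (s + r) * (ι (x i) + t i) + (s * ι (a i) + r * ι (b i))
            ≡⟨ cong₂ _+_ (cong (_* (ι (x i) + t i)) s+r≡1) (u≡ i) ⟩
          1ℚ * (ι (x i) + t i) + u i
            ≡⟨ solve 3 (λ x t u → con 1ℚ :* (x :+ t) :+ u := x :+ (u :+ t)) refl (ι (x i)) (t i) (u i) ⟩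
          ι (x i) + (u i + t i)
            ≡⟨ cong (_+_ (ι (x i))) (sym (e i)) ⟩
          ι (x i) + y i ∎)
        (addC (scale s (wn zero) (to (corners⇒MinkSum L (x +ᵖ a) ha t ht)))
              (scale r (wn (suc zero)) (to (corners⇒MinkSum L (x +ᵖ b) hb t ht)))))
      where
      open +-*-Solver
      open ≡-Reasoning
      s r : ℚ
      s = w zero
      r = w (suc zero)
      s+r≡1 : s + r ≡ 1ℚ
      s+r≡1 = trans (cong (_+_ s) (sym (ℚₚ.+-identityʳ r))) ws
      u≡ : ∀ i → s * ι (a i) + r * ι (b i) ≡ u i
      u≡ i = trans (cong (_+_ (s * ι (a i))) (sym (ℚₚ.+-identityʳ _))) (wc i)

    corners⇒containsSum : ∀ L → All (λ ab → ¬ proj₁ ab ≈ᶻ proj₂ ab) L → Corners L 0ᵖ →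
      ContainsSumOf R (length L)
    corners⇒containsSum L hL h = map seg L , length-map seg L , positive L hL ,
      λ y hy → region-resp K (λ i → ℚₚ.+-identityˡ (y i)) (corners⇒MinkSum L 0ᵖ h y hy)
      where
      positive : ∀ L → All (λ ab → ¬ proj₁ ab ≈ᶻ proj₂ ab) L → All PositiveDim (map seg L)
      positive [] [] = []
      positive ((a , b) ∷ L) (n ∷ ns) =
        (a , b , here (λ _ → refl) , there (here (λ _ → refl)) , n) ∷ positive L ns

    at : ∀ {x y} → R ∋ x → x ≈ᶻ y → R ∋ y
    at (lattice h) e = lattice (region-resp K (λ i → cong ι (e i)) h)

    -- The eight points are the corners of a sum of three segments; the first one, from `a` to
    -- `a + u`, absorbs the translation. The vectors may be parallel or equal, so long segments and
    -- flat parallelograms are covered too.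
    no-zonotope₃ : MinkowskiLength R 2 → ∀ a u v w → ¬ u ≈ᶻ 0ᵖ → ¬ v ≈ᶻ 0ᵖ → ¬ w ≈ᶻ 0ᵖ →
      R ∋ a → R ∋ (a +ᵖ u) → R ∋ (a +ᵖ v) → R ∋ (a +ᵖ w) →
      R ∋ (a +ᵖ u +ᵖ v) → R ∋ (a +ᵖ u +ᵖ w) → R ∋ (a +ᵖ v +ᵖ w) →
      R ∋ (a +ᵖ u +ᵖ v +ᵖ w) → ⊥
    no-zonotope₃ (_ , max) a u v w u≢0 v≢0 w≢0 h hu hv hw huv huw hvw huvw
      = 3≰2 (max 3 (corners⇒containsSum ((a , a +ᵖ u) ∷ (0ᵖ , v) ∷ (0ᵖ , w) ∷ [])
        ((λ e → u≢0 (λ i → trans (cancel (a i) (u i)) (trans (cong (ℤ._- a i) (sym (e i))) (ℤₚ.i≡j⇒i-j≡0 {a i} refl))))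
          ∷ (λ e → v≢0 (≈-sym e)) ∷ (λ e → w≢0 (≈-sym e)) ∷ [])
        ((( at h (λ i → p000 (a i)) , at hw (λ i → p001 (a i) (w i)))
         , at hv (λ i → p010 (a i) (v i)) , at hvw (λ i → p011 (a i) (v i) (w i)))
         , ( at hu (λ i → p000 (a i ℤ.+ u i)) , at huw (λ i → p001 (a i ℤ.+ u i) (w i)))
         , at huv (λ i → p010 (a i ℤ.+ u i) (v i)) , at huvw (λ i → p011 (a i ℤ.+ u i) (v i) (w i)))))
      where
      cancel : ∀ a u → u ≡ (a ℤ.+ u) ℤ.- a
      cancel = solve-∀
      p000 : ∀ a → a ≡ + 0 ℤ.+ a ℤ.+ + 0 ℤ.+ + 0
      p000 = solve-∀
      p001 : ∀ a w → a ℤ.+ w ≡ + 0 ℤ.+ a ℤ.+ + 0 ℤ.+ w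
      p001 = solve-∀
      p010 : ∀ a v → a ℤ.+ v ≡ + 0 ℤ.+ a ℤ.+ v ℤ.+ + 0
      p010 = solve-∀
      p011 : ∀ a v w → a ℤ.+ v ℤ.+ w ≡ + 0 ℤ.+ a ℤ.+ v ℤ.+ w
      p011 = solve-∀
      3≰2 : ¬ 3 ℕ.≤ 2
      3≰2 (s≤s (s≤s ()))

    no-zonotope₂ : MinkowskiLength R 1 → ∀ a u v → ¬ u ≈ᶻ 0ᵖ → ¬ v ≈ᶻ 0ᵖ →
      R ∋ a → R ∋ (a +ᵖ u) → R ∋ (a +ᵖ v) → R ∋ (a +ᵖ u +ᵖ v) → ⊥
    no-zonotope₂ (_ , max) a u v u≢0 v≢0 h hu hv huv
      = 2≰1 (max 2 (corners⇒containsSum ((a , a +ᵖ u) ∷ (0ᵖ , v) ∷ [])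
        ((λ e → u≢0 (λ i → trans (cancel (a i) (u i)) (trans (cong (ℤ._- a i) (sym (e i))) (ℤₚ.i≡j⇒i-j≡0 {a i} refl))))
          ∷ (λ e → v≢0 (≈-sym e)) ∷ [])
        ((at h (λ i → p00 (a i)) , at hv (λ i → p01 (a i) (v i)))
         , at hu (λ i → p00 (a i ℤ.+ u i)) , at huv (λ i → p01 (a i ℤ.+ u i) (v i)))))
      where
      cancel : ∀ a u → u ≡ (a ℤ.+ u) ℤ.- a
      cancel = solve-∀
      p00 : ∀ a → a ≡ + 0 ℤ.+ a ℤ.+ + 0
      p00 = solve-∀
      p01 : ∀ a v → a ℤ.+ v ≡ + 0 ℤ.+ a ℤ.+ v
      p01 = solve-∀
      2≰1 : ¬ 2 ℕ.≤ 1
      2≰1 (s≤s ())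

  -- Homogenised form of the affine map x ↦ U x + b + v: on the cone over a region the translation is scaled with the height.
  module Affine (U : Mat) (b v : Pt) where

    lift : ℚ → QPt → QPt
    lift c y i = (((U i zero / 1) * y zero + ((U i (suc zero) / 1) * y (suc zero) + (U i (suc (suc zero)) / 1) * y (suc (suc zero))))
      + c * (b i / 1)) + c * (v i / 1)

    lift-cong : ∀ c {x y} → x ≈ y → lift c x ≈ lift c y
    lift-cong c e i rewrite e zero | e (suc zero) | e (suc (suc zero)) = refl

    lift-1 : ∀ y → lift 1ℚ y ≈ (affApply U b y ⊕ᵖ embed v)
    lift-1 y i = cong₂ (λ α β → (linear + α) + β) (ℚₚ.*-identityˡ (b i / 1)) (ℚₚ.*-identityˡ (v i / 1))
      where linear = (U i zero / 1) * y zero + ((U i (suc zero) / 1) * y (suc zero) + (U i (suc (suc zero)) / 1) * y (suc (suc zero)))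

    lift-+ : ∀ c d x y → lift (c + d) (x ⊕ᵖ y) ≈ (lift c x ⊕ᵖ lift d y)
    lift-+ c d x y i = solve 13 (λ u₀ u₁ u₂ b v c d x₀ x₁ x₂ y₀ y₁ y₂ →
        ((u₀ :* (x₀ :+ y₀) :+ (u₁ :* (x₁ :+ y₁) :+ u₂ :* (x₂ :+ y₂))) :+ (c :+ d) :* b) :+ (c :+ d) :* v :=
        (((u₀ :* x₀ :+ (u₁ :* x₁ :+ u₂ :* x₂)) :+ c :* b) :+ c :* v) :+ (((u₀ :* y₀ :+ (u₁ :* y₁ :+ u₂ :* y₂)) :+ d :* b) :+ d :* v)) refl
        (U i zero / 1) (U i (suc zero) / 1) (U i (suc (suc zero)) / 1) (b i / 1) (v i / 1) c d
        (x zero) (x (suc zero)) (x (suc (suc zero))) (y zero) (y (suc zero)) (y (suc (suc zero)))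
      where open +-*-Solver

    lift-* : ∀ s c x → lift (s * c) (s ·ᵖ x) ≈ (s ·ᵖ lift c x)
    lift-* s c x i = solve 10 (λ u₀ u₁ u₂ b v s c x₀ x₁ x₂ →
        ((u₀ :* (s :* x₀) :+ (u₁ :* (s :* x₁) :+ u₂ :* (s :* x₂))) :+ s :* c :* b) :+ s :* c :* v :=
        s :* (((u₀ :* x₀ :+ (u₁ :* x₁ :+ u₂ :* x₂)) :+ c :* b) :+ c :* v)) refl
        (U i zero / 1) (U i (suc zero) / 1) (U i (suc (suc zero)) / 1) (b i / 1) (v i / 1) s c (x zero) (x (suc zero)) (x (suc (suc zero)))
      where open +-*-Solver

    lift-0 : lift 0ℚ zeroᵖ ≈ zeroᵖ
    lift-0 i = solve 5 (λ u₀ u₁ u₂ b v → ((u₀ :* con 0ℚ :+ (u₁ :* con 0ℚ :+ u₂ :* con 0ℚ)) :+ con 0ℚ :* b) :+ con 0ℚ :* v := con 0ℚ) refl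
        (U i zero / 1) (U i (suc zero) / 1) (U i (suc (suc zero)) / 1) (b i / 1) (v i / 1)
      where open +-*-Solver

    preimage-conic : ∀ {R} → Conic R → Conic (λ y → R (affApply U b y ⊕ᵖ embed v))
    preimage-conic K = record
      { C = λ c y → C c (lift c y)
      ; resp = λ { {c} refl e h → resp refl (lift-cong c e) h }
      ; zeroC = resp refl (λ i → sym (lift-0 i)) zeroC
      ; addC = λ {c} {d} {x} {y} h h′ → resp refl (λ i → sym (lift-+ c d x y i)) (addC h h′)
      ; scale = λ {c} {x} s hs h → resp refl (λ i → sym (lift-* s c x i)) (scale s hs h)
      ; to = λ {x} h → resp refl (λ i → sym (lift-1 x i)) (to h)
      ; from = λ {x} h → from (resp refl (lift-1 x) h)
      }
      where open Conic K

    image-conic : ∀ {R} → Conic R → Conic (ImageTrans U b v R)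
    image-conic K = record
      { C = λ c x → ∃[ y ] (C c y × x ≈ lift c y)
      ; resp = λ { refl e (y , h , f) → y , h , λ i → trans (sym (e i)) (f i) }
      ; zeroC = zeroᵖ , zeroC , λ i → sym (lift-0 i)
      ; addC = λ { {c} {d} (x , h , f) (y , h′ , f′) → (x ⊕ᵖ y) , addC h h′ , λ i → trans (cong₂ _+_ (f i) (f′ i)) (sym (lift-+ c d x y i)) }
      ; scale = λ { {c} s hs (x , h , f) → (s ·ᵖ x) , scale s hs h , λ i → trans (cong (s *_) (f i)) (sym (lift-* s c x i)) }
      ; to = λ { (y , h , f) → y , to h , λ i → trans (f i) (sym (lift-1 y i)) }
      ; from = λ { (y , h , f) → y , from h , λ i → trans (f i) (lift-1 y i) }
      }
      where open Conic K

    image : Pt → Pt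
    image z i = ((U i zero ℤ.* z zero ℤ.+ (U i (suc zero) ℤ.* z (suc zero) ℤ.+ U i (suc (suc zero)) ℤ.* z (suc (suc zero)))) ℤ.+ b i) ℤ.+ v i

    embed-image : ∀ z → (affApply U b (embed z) ⊕ᵖ embed v) ≈ embed (image z)
    embed-image z i = sym (trans (ι-+ (linear ℤ.+ b i) (v i)) (cong (_+ ι (v i)) (trans (ι-+ linear (b i)) (cong (_+ ι (b i))
        (trans (ι-+ (U i zero ℤ.* z zero) _) (cong₂ _+_ (ι-* (U i zero) (z zero))
          (trans (ι-+ (U i (suc zero) ℤ.* z (suc zero)) _) (cong₂ _+_ (ι-* (U i (suc zero)) (z (suc zero))) (ι-* (U i (suc (suc zero))) (z (suc (suc zero))))))))))))
      where linear = U i zero ℤ.* z zero ℤ.+ (U i (suc zero) ℤ.* z (suc zero) ℤ.+ U i (suc (suc zero)) ℤ.* z (suc (suc zero)))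

    -- Both inclusions are instances of `conv-least`: images and preimages of convex regions under
    -- an affine map are convex, so comparing generators suffices.
    hull-image : ∀ G W → (∀ z → conv G (embed z) → image z ∈ᵖ W) → (∀ w → w ∈ᵖ W → ∃[ z ] (conv G (embed z) × image z ≈ᶻ w)) →
      ∀ x → conv W x ⇔ ImageTrans U b v (conv G) x
    hull-image G W into onto x = mk⇔
      (conv-least (image-conic (conv-conic G)) W (λ n → let (z , h , e) = onto (lookup W n) (lookup-∈ W n)
        in embed z , h , λ i → trans (cong ι (sym (e i))) (sym (embed-image z i))) x)
      (λ { (y , h , e) → region-resp (conv-conic W) (λ i → sym (e i)) (conv-least (preimage-conic (conv-conic W)) G
        (λ n → region-resp (conv-conic W) (λ i → sym (embed-image (lookup G n) i)) (∈⇒conv (into (lookup G n) (∈⇒conv (lookup-∈ G n))))) y h) })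

open Convexity
open import Data.Integer using (_+_; _*_; _-_; -_)

-- Lattice points of P + Q

-- S and SP are the lattice points of P + Q and of P.
record Config (p : Fin 5 → Pt) (q : Fin 4 → Pt) : Set₁ where
  field
    S SP    : Pt → Set
    S-resp  : ∀ {x y} → x ≈ᶻ y → S x → S y
    S-mean  : ∀ L z N → Σw L ≡ suc N → Σp L ≈ᶻ (+ suc N *ᵖ z) → All (λ nx → S (proj₂ nx)) L → S z
    SP-mean : ∀ L z N → Σw L ≡ suc N → Σp L ≈ᶻ (+ suc N *ᵖ z) → All (λ nx → SP (proj₂ nx)) L → SP z
    S-sum   : ∀ i j → S (p i +ᵖ q j)
    SP-p    : ∀ i → SP (p i)
    SP⇒p    : ∀ {z} → SP z → ∃[ i ] z ≈ᶻ p i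
    mod3    : ∀ {x y} → S x → S y → x ≡ y [mod + 3 ] → x ≈ᶻ y
    mod2    : ∀ {x y x′ y′} → S x → S y → S x′ → S y′ → x ≡ y [mod + 2 ] →
              (x +ᵖ y′) ≈ᶻ (x′ +ᵖ y) → x ≈ᶻ y ⊎ x ≈ᶻ x′
    p-para  : ∀ {i j k l} → ¬ i ≡ k → ¬ i ≡ l → ¬ (p i +ᵖ p j) ≈ᶻ (p k +ᵖ p l)
    q-para  : ∀ {i j k l} → ¬ i ≡ k → ¬ i ≡ l → ¬ (q i +ᵖ q j) ≈ᶻ (q k +ᵖ q l)
    p-inj   : ∀ {i j} → p i ≈ᶻ p j → i ≡ j
    q-inj   : ∀ {i j} → q i ≈ᶻ q j → i ≡ j
    vertex  : ∀ {v} → SP v → ∀ L N → Σw L ≡ suc N → Σp L ≈ᶻ (+ suc N *ᵖ v) →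
              ¬ All (λ nx → SP (proj₂ nx) × ¬ proj₂ nx ≈ᶻ v) L

module _ {R : Region} (K : Conic R) where

  lattice-mean : ∀ L z N → Σw L ≡ suc N → Σp L ≈ᶻ (+ suc N *ᵖ z) → All (λ nx → R ∋ proj₂ nx) L → R ∋ z
  lattice-mean L z N e f h = lattice (weighted-mean K L z N e f (All.map _∋_.member h))

  -- If `x = y + 3 k` with `k` nonzero, the segment from `y` to `x` is a translated sum of three
  -- copies of the segment from 0 to `k`.
  lattice-mod3 : MinkowskiLength R 2 → ∀ {x y} → R ∋ x → R ∋ y → x ≡ y [mod + 3 ] → x ≈ᶻ y
  lattice-mod3 ml {x} {y} hx hy (k by e) with k ≈? 0ᵖ
  ... | yes k≈0 = λ i → trans (e i) (trans (cong (λ t → y i + + 3 * t) (k≈0 i)) (ℤₚ.+-identityʳ (y i)))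
  ... | no k≉0 = ⊥-elim (no-zonotope₃ K ml y k k k k≉0 k≉0 k≉0 hy h₁ h₁ h₁ h₂ h₂ h₂
                   (at K hx (λ i → trans (e i) (three (y i) (k i)))))
    where
    h₁ : R ∋ (y +ᵖ k)
    h₁ = lattice-mean ((2 , y) ∷ (1 , x) ∷ []) (y +ᵖ k) 2 refl
      (λ i → trans (cong (λ t → + 2 * y i + (+ 1 * t + + 0)) (e i)) (one (y i) (k i))) (hy ∷ hx ∷ [])
      where
      one : ∀ y k → + 2 * y + (+ 1 * (y + + 3 * k) + + 0) ≡ + 3 * (y + k)
      one = solve-∀
    h₂ : R ∋ (y +ᵖ k +ᵖ k)
    h₂ = lattice-mean ((1 , y) ∷ (2 , x) ∷ []) (y +ᵖ k +ᵖ k) 2 refl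
      (λ i → trans (cong (λ t → + 1 * y i + (+ 2 * t + + 0)) (e i)) (one (y i) (k i))) (hy ∷ hx ∷ [])
      where
      one : ∀ y k → + 1 * y + (+ 2 * (y + + 3 * k) + + 0) ≡ + 3 * (y + k + k)
      one = solve-∀
    three : ∀ y k → y + + 3 * k ≡ y + k + k + k
    three = solve-∀

  lattice-midpoint : ∀ {x y} k → R ∋ x → R ∋ y → x ≈ᶻ (y +ᵖ + 2 *ᵖ k) → R ∋ (y +ᵖ k)
  lattice-midpoint {x} {y} k hx hy e = lattice-mean ((1 , y) ∷ (1 , x) ∷ []) (y +ᵖ k) 1 refl
      (λ i → trans (cong (λ t → + 1 * y i + (+ 1 * t + + 0)) (e i)) (one (y i) (k i))) (hy ∷ hx ∷ [])
      where
      one : ∀ y k → + 1 * y + (+ 1 * (y + + 2 * k) + + 0) ≡ + 2 * (y + k)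
      one = solve-∀

  -- With `x - y = x′ - y′ = 2 k` the parallelogram on these points is the zonotope of `k`, `k` and
  -- `x′ - x`, so one of the two vectors must vanish.
  lattice-mod2 : MinkowskiLength R 2 → ∀ {x y x′ y′} → R ∋ x → R ∋ y → R ∋ x′ → R ∋ y′ →
    x ≡ y [mod + 2 ] → (x +ᵖ y′) ≈ᶻ (x′ +ᵖ y) → x ≈ᶻ y ⊎ x ≈ᶻ x′
  lattice-mod2 ml {x} {y} {x′} {y′} hx hy hx′ hy′ (k by e) par with k ≈? 0ᵖ | x ≈? x′
  ... | yes k≈0 | _ = inj₁ (λ i → trans (e i) (trans (cong (λ t → y i + + 2 * t) (k≈0 i)) (ℤₚ.+-identityʳ (y i))))
  ... | no k≉0 | yes x≈x′ = inj₂ x≈x′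
  ... | no k≉0 | no x≉x′ = ⊥-elim (no-zonotope₃ K ml y k k (x′ -ᵖ x) k≉0 k≉0
          (λ e → x≉x′ (λ i → sym (ℤₚ.i-j≡0⇒i≡j (x′ i) (x i) (e i)))) hy hm hm
          (at K hy′ (λ i → y′≡ (x i) (y i) (x′ i) (y′ i) (par i)))
          (at K hx (λ i → trans (e i) (two (y i) (k i))))
          hm′ hm′
          (at K hx′ (λ i → trans (shift (x i) (x′ i)) (cong (_+ (x′ i - x i)) (trans (e i) (two (y i) (k i)))))))
    where
    two : ∀ y k → y + + 2 * k ≡ y + k + k
    two = solve-∀
    shift : ∀ x x′ → x′ ≡ x + (x′ - x)
    shift = solve-∀
    y′≡ : ∀ x y x′ y′ → x + y′ ≡ x′ + y → y′ ≡ y + (x′ - x)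
    y′≡ x y x′ y′ e = trans (p x y′) (trans (cong (_- x) e) (r x y x′))
      where
      p : ∀ x y′ → y′ ≡ (x + y′) - x
      p = solve-∀
      r : ∀ x y x′ → (x′ + y) - x ≡ y + (x′ - x)
      r = solve-∀
    hm : R ∋ (y +ᵖ k)
    hm = lattice-midpoint k hx hy e
    hm′ : R ∋ (y +ᵖ k +ᵖ (x′ -ᵖ x))
    hm′ = at K (lattice-midpoint k hx′ hy′ (λ i → x′≡ (x i) (y i) (x′ i) (y′ i) (k i) (e i) (par i)))
               (λ i → trans (cong (_+ k i) (y′≡ (x i) (y i) (x′ i) (y′ i) (par i))) (comm (y i) (k i) (x′ i - x i)))
      where
      comm : ∀ y k d → y + d + k ≡ y + k + d
      comm = solve-∀
      x′≡ : ∀ x y x′ y′ k → x ≡ y + + 2 * k → x + y′ ≡ x′ + y → x′ ≡ y′ + + 2 * k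
      x′≡ x y x′ y′ k refl par = trans (p x′ y) (trans (cong (_- y) (sym par)) (r y y′ k))
        where
        p : ∀ x′ y → x′ ≡ (x′ + y) - y
        p = solve-∀
        r : ∀ y y′ k → (y + + 2 * k + y′) - y ≡ y′ + + 2 * k
        r = solve-∀

  -- The points `a`, `c`, `d`, `b` are the corners of the zonotope of `c - a` and `d - a`. The case
  -- `c = d`, where `c` is the midpoint of `a` and `b`, is included.
  lattice-no-parallelogram : MinkowskiLength R 1 → ∀ {a b c d} → R ∋ a → R ∋ b → R ∋ c → R ∋ d →
    ¬ a ≈ᶻ c → ¬ a ≈ᶻ d → ¬ (a +ᵖ b) ≈ᶻ (c +ᵖ d)
  lattice-no-parallelogram ml {a} {b} {c} {d} ha hb hc hd a≉c a≉d par =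
    no-zonotope₂ K ml a (c -ᵖ a) (d -ᵖ a)
      (λ e → a≉c (λ i → sym (ℤₚ.i-j≡0⇒i≡j (c i) (a i) (e i))))
      (λ e → a≉d (λ i → sym (ℤₚ.i-j≡0⇒i≡j (d i) (a i) (e i))))
      ha (at K hc (λ i → shift (a i) (c i))) (at K hd (λ i → shift (a i) (d i)))
      (at K hb (λ i → trans (p (a i) (b i)) (trans (cong (_- a i) (par i)) (r (a i) (c i) (d i)))))
    where
    shift : ∀ a c → c ≡ a + (c - a)
    shift = solve-∀
    p : ∀ a b → b ≡ (a + b) - a
    p = solve-∀
    r : ∀ a c d → (c + d) - a ≡ a + (c - a) + (d - a)
    r = solve-∀

All-lookup : ∀ {A : Set} {T : A → Set} {xs} → All T xs → ∀ i → T (lookup xs i)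
All-lookup (h ∷ hs) zero = h
All-lookup (h ∷ hs) (suc i) = All-lookup hs i

lookup-injective : ∀ {zs} → AllPairs (λ a b → ¬ (a ≈ᶻ b)) zs → ∀ {i j} → lookup zs i ≈ᶻ lookup zs j → i ≡ j
lookup-injective (n ∷ ns) {zero} {zero} e = refl
lookup-injective (n ∷ ns) {zero} {suc j} e = ⊥-elim (All-lookup n j e)
lookup-injective (n ∷ ns) {suc i} {zero} e = ⊥-elim (All-lookup n i (≈-sym e))
lookup-injective (n ∷ ns) {suc i} {suc j} e = cong suc (lookup-injective ns e)

-- Here the hypotheses are used up: `mod3` and `mod2` come from `L(P + Q) = 2`, `p-para` and
-- `q-para` from `L(P) = L(Q) = 1`, and `vertex` from the emptiness of P. From here on only the
-- fields of `Config` and the lists of lattice points matter.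
config : ∀ G H → EmptyPolytope G → MinkowskiLength (conv G) 1 → MinkowskiLength (conv H) 1 →
  MinkowskiLength (conv G ⊕ conv H) 2 →
  ∀ a b c d e → AllPairs (λ a b → ¬ (a ≈ᶻ b)) (a ∷ b ∷ c ∷ d ∷ e ∷ []) →
  (∀ z → conv G (embed z) ⇔ z ∈ᵖ (a ∷ b ∷ c ∷ d ∷ e ∷ [])) →
  ∀ s t u v → AllPairs (λ a b → ¬ (a ≈ᶻ b)) (s ∷ t ∷ u ∷ v ∷ []) →
  (∀ z → conv H (embed z) ⇔ z ∈ᵖ (s ∷ t ∷ u ∷ v ∷ [])) →
  Config (lookup (a ∷ b ∷ c ∷ d ∷ e ∷ [])) (lookup (s ∷ t ∷ u ∷ v ∷ []))
config G H emptyG mlG mlH mlGH a b c d e distG latG s t u v distH latH = record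
  { S       = (conv G ⊕ conv H) ∋_
  ; SP      = conv G ∋_
  ; S-resp  = λ e h → at KGH h e
  ; S-mean  = lattice-mean KGH
  ; SP-mean = lattice-mean KG
  ; S-sum   = λ i j → lattice (embed (p i) , embed (q j) , _∋_.member (inG i) , _∋_.member (inH j) ,
                               λ k → ι-+ (p i k) (q j k))
  ; SP-p    = inG
  ; SP⇒p    = λ { {z} (lattice h) → let (i , e) = index-of (Equivalence.to (latG z) h) in i , ≈-sym e }
  ; mod3    = lattice-mod3 KGH mlGH
  ; mod2    = lattice-mod2 KGH mlGH
  ; p-para  = λ {i} {j} {k} {l} i≢k i≢l → lattice-no-parallelogram KG mlG (inG i) (inG j) (inG k) (inG l)
                (λ e → i≢k (lookup-injective distG e)) (λ e → i≢l (lookup-injective distG e))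
  ; q-para  = λ {i} {j} {k} {l} i≢k i≢l → lattice-no-parallelogram KH mlH (inH i) (inH j) (inH k) (inH l)
                (λ e → i≢k (lookup-injective distH e)) (λ e → i≢l (lookup-injective distH e))
  ; p-inj   = lookup-injective distG
  ; q-inj   = lookup-injective distH
  ; vertex  = λ { {v} (lattice hv) L N eN ev hL → proj₂ (emptyG v hv)
      (weighted-mean (convOn-conic G (λ i → lookup G i ≈ᶻ v)) L v N eN ev (All.map (λ { {nx} (hx , x≉v) → away hx x≉v }) hL)) }
  }
  where
  p = lookup (a ∷ b ∷ c ∷ d ∷ e ∷ [])
  q = lookup (s ∷ t ∷ u ∷ v ∷ [])
  KG = conv-conic G
  KH = conv-conic H
  KGH = ⊕-conic KG KH
  inG : ∀ i → conv G ∋ p i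
  inG i = lattice (Equivalence.from (latG (p i)) (lookup-∈ _ i))
  inH : ∀ j → conv H ∋ q j
  inH j = lattice (Equivalence.from (latH (q j)) (lookup-∈ _ j))
  -- By emptiness every lattice point of P is one of the generators, so a point other than `v`
  -- survives when the generators equal to `v` are dropped.
  away : ∀ {v x} → conv G ∋ x → ¬ x ≈ᶻ v → convOn G (λ i → lookup G i ≈ᶻ v) (embed x)
  away {v} {x} (lattice hx) x≉v with index-of (proj₁ (emptyG x hx))
  ... | i , e = region-resp (convOn-conic G _) (λ k → cong ι (e k))
                  (generator-in-convOn G _ i (λ e′ → x≉v (≈-trans (≈-sym e) e′)))

-- Linear coordinates modulo 2 and modulo 3

infix 1 _by_
infix 4 _≡_[modℤ_]
record _≡_[modℤ_] (a b n : ℤ) : Set where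
  constructor _by_
  field
    quotient   : ℤ
    difference : a ≡ b + n * quotient

module _ {n : ℤ} where

  pointwise : ∀ {x y} → x ≡ y [mod n ] → ∀ i → x i ≡ y i [modℤ n ]
  pointwise (k by e) i = k i by e i

  assemble : ∀ {x y} → (∀ i → x i ≡ y i [modℤ n ]) → x ≡ y [mod n ]
  assemble h = (λ i → _≡_[modℤ_].quotient (h i)) by (λ i → _≡_[modℤ_].difference (h i))

  c-refl : ∀ {a b} → a ≡ b → a ≡ b [modℤ n ]
  c-refl {a} refl = + 0 by lemma a n
    where
    lemma : ∀ a n → a ≡ a + n * + 0
    lemma = solve-∀

  c-sym : ∀ {a b} → a ≡ b [modℤ n ] → b ≡ a [modℤ n ]
  c-sym {b = b} (k by refl) = (- k) by lemma b n k
    where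
    lemma : ∀ b n k → b ≡ b + n * k + n * (- k)
    lemma = solve-∀

  c-trans : ∀ {a b c} → a ≡ b [modℤ n ] → b ≡ c [modℤ n ] → a ≡ c [modℤ n ]
  c-trans {c = c} (k by refl) (l by refl) = (l + k) by lemma c n k l
    where
    lemma : ∀ c n k l → c + n * l + n * k ≡ c + n * (l + k)
    lemma = solve-∀

  c-+ : ∀ {a b c d} → a ≡ b [modℤ n ] → c ≡ d [modℤ n ] → a + c ≡ b + d [modℤ n ]
  c-+ {b = b} {d = d} (k by refl) (l by refl) = (k + l) by lemma b d n k l
    where
    lemma : ∀ b d n k l → b + n * k + (d + n * l) ≡ b + d + n * (k + l)
    lemma = solve-∀

  c-* : ∀ {a b} c → a ≡ b [modℤ n ] → c * a ≡ c * b [modℤ n ]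
  c-* {b = b} c (k by refl) = (c * k) by lemma b c n k
    where
    lemma : ∀ b c n k → c * (b + n * k) ≡ c * b + n * (c * k)
    lemma = solve-∀

-- The common interface of F₂ and F₃. In both fields a nonzero element is its own inverse; `unit`
-- records this, and it lets elimination run without division.
record Residues : Set₁ where
  infixl 6 _⊞_
  field
    n    : ℤ
    K    : Set
    ⟦_⟧  : K → ℤ
    _⊞_  : K → K → K
    𝟘 𝟙  : K
    ⟦𝟘⟧  : ⟦ 𝟘 ⟧ ≡ + 0
    ⟦𝟙⟧  : ⟦ 𝟙 ⟧ ≡ + 1
    rep  : ∀ z → ∃[ r ] z ≡ ⟦ r ⟧ [modℤ n ]
    uniq : ∀ r s → ⟦ r ⟧ ≡ ⟦ s ⟧ [modℤ n ] → r ≡ s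
    hom  : ∀ r s → ⟦ r ⟧ + ⟦ s ⟧ ≡ ⟦ r ⊞ s ⟧ [modℤ n ]
    unit : ∀ r → ¬ r ≡ 𝟘 → ⟦ r ⟧ * ⟦ r ⟧ ≡ + 1 [modℤ n ]
    K≟   : ∀ (r s : K) → Dec (r ≡ s)

coord-ext : ∀ {K} {u v : Vec₃ K} → (∀ i → coord u i ≡ coord v i) → u ≡ v
coord-ext {u = vec a b c} {vec x y z} h with h zero | h (suc zero) | h (suc (suc zero))
... | refl | refl | refl = refl

module Residue (𝓡 : Residues) where
  open Residues 𝓡

  V : Set
  V = Vec₃ K

  _⊞ᵛ_ : V → V → V
  _⊞ᵛ_ = zipV _⊞_

  resᶻ : ℤ → K
  resᶻ z = proj₁ (rep z)

  resᶻ-cong : ∀ {a b} → a ≡ b [modℤ n ] → resᶻ a ≡ resᶻ b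
  resᶻ-cong {a} {b} e = uniq _ _ (c-trans (c-sym (proj₂ (rep a))) (c-trans e (proj₂ (rep b))))

  resᶻ-inj : ∀ {a b} → resᶻ a ≡ resᶻ b → a ≡ b [modℤ n ]
  resᶻ-inj {a} {b} e = c-trans (proj₂ (rep a)) (c-trans (c-refl (cong ⟦_⟧ e)) (c-sym (proj₂ (rep b))))

  resᶻ-⊞ : ∀ a b → resᶻ (a + b) ≡ resᶻ a ⊞ resᶻ b
  resᶻ-⊞ a b = uniq _ _ (c-trans (c-sym (proj₂ (rep (a + b))))
    (c-trans (c-+ (proj₂ (rep a)) (proj₂ (rep b))) (hom _ _)))

  resᶻ-0 : ∀ {a} → a ≡ + 0 [modℤ n ] → resᶻ a ≡ 𝟘
  resᶻ-0 {a} e = uniq _ _ (c-trans (c-sym (proj₂ (rep a))) (c-trans e (c-refl (sym ⟦𝟘⟧))))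

  resᶻ-1 : ∀ {a} → a ≡ + 1 [modℤ n ] → resᶻ a ≡ 𝟙
  resᶻ-1 {a} e = uniq _ _ (c-trans (c-sym (proj₂ (rep a))) (c-trans e (c-refl (sym ⟦𝟙⟧))))

  zero? : ∀ a → (a ≡ + 0 [modℤ n ]) ⊎ (a * a ≡ + 1 [modℤ n ])
  zero? a with rep a
  ... | r , e with K≟ r 𝟘
  ... | yes refl = inj₁ (c-trans e (c-refl ⟦𝟘⟧))
  ... | no r≢0 = inj₂ (c-trans (c-* a e) (c-trans (c-refl (ℤₚ.*-comm a ⟦ r ⟧)) (c-trans (c-* ⟦ r ⟧ e) (unit r r≢0))))

  res : Pt → V
  res x = vec (resᶻ (x zero)) (resᶻ (x (suc zero))) (resᶻ (x (suc (suc zero))))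

  coord-res : ∀ x i → coord (res x) i ≡ resᶻ (x i)
  coord-res x zero = refl
  coord-res x (suc zero) = refl
  coord-res x (suc (suc zero)) = refl

  res-cong : ∀ {x y} → x ≡ y [mod n ] → res x ≡ res y
  res-cong {x} {y} e = coord-ext (λ i → trans (coord-res x i) (trans (resᶻ-cong (pointwise e i)) (sym (coord-res y i))))

  res-inj : ∀ {x y} → res x ≡ res y → x ≡ y [mod n ]
  res-inj {x} {y} e = assemble (λ i → resᶻ-inj (trans (sym (coord-res x i)) (trans (cong (λ u → coord u i) e) (coord-res y i))))

  res-⊞ : ∀ x y → res (x +ᵖ y) ≡ res x ⊞ᵛ res y
  res-⊞ x y rewrite resᶻ-⊞ (x zero) (y zero) | resᶻ-⊞ (x (suc zero)) (y (suc zero))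
    | resᶻ-⊞ (x (suc (suc zero))) (y (suc (suc zero))) = refl

  -- A linear map on integer points with injectivity modulo `n` in place of an inverse matrix, so
  -- composition is immediate. Residues are taken only afterwards, in `label`.
  record Lin : Set where
    field
      f     : Pt → Pt
      f-≈   : ∀ {x y} → x ≈ᶻ y → f x ≈ᶻ f y
      f-+   : ∀ x y → f (x +ᵖ y) ≈ᶻ (f x +ᵖ f y)
      f-*   : ∀ c x → f (c *ᵖ x) ≈ᶻ (c *ᵖ f x)
      f-inj : ∀ {x} → f x ≡ 0ᵖ [mod n ] → x ≡ 0ᵖ [mod n ]

    f-mod : ∀ {x y} → x ≡ y [mod n ] → f x ≡ f y [mod n ]
    f-mod {x} {y} (k by e) = f k by ≈-trans (f-≈ e) (≈-trans (f-+ y (n *ᵖ k)) (λ i → cong (_+_ (f y i)) (f-* n k i)))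

  _∘ˡ_ : Lin → Lin → Lin
  g ∘ˡ h = record
    { f = λ x → G.f (H.f x)
    ; f-≈ = λ e → G.f-≈ (H.f-≈ e)
    ; f-+ = λ x y → ≈-trans (G.f-≈ (H.f-+ x y)) (G.f-+ (H.f x) (H.f y))
    ; f-* = λ c x → ≈-trans (G.f-≈ (H.f-* c x)) (G.f-* c (H.f x))
    ; f-inj = λ e → H.f-inj (G.f-inj e)
    }
    where
    module G = Lin g
    module H = Lin h

  permute : (π ϖ : Fin 3 → Fin 3) → (∀ i → π (ϖ i) ≡ i) → Lin
  permute π ϖ inv = record
    { f = λ x i → x (π i) ; f-≈ = λ e i → e (π i) ; f-+ = λ _ _ _ → refl ; f-* = λ _ _ _ → refl
    ; f-inj = λ {x} e → assemble (λ i → subst (λ j → x j ≡ + 0 [modℤ n ]) (inv i) (pointwise e (ϖ i)))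
    }

  δ-diag : ∀ k → δ k k ≡ + 1
  δ-diag zero = refl
  δ-diag (suc zero) = refl
  δ-diag (suc (suc zero)) = refl

  -- Gauss elimination with pivot k = v k: since (v k)² ≡ 1, it sends v to the k-th unit vector and
  -- fixes every vector whose k-th coordinate vanishes.
  pivot : ∀ (v : Pt) k → v k * v k ≡ + 1 [modℤ n ] → Lin
  pivot v k u = record
    { f = g
    ; f-≈ = λ e i → cong₂ (λ a b → a - (v i - δ k i) * (v k * b)) (e i) (e k)
    ; f-+ = λ x y i → lin+ (x i) (y i) (v i - δ k i) (v k) (x k) (y k)
    ; f-* = λ c x i → lin* c (x i) (v i - δ k i) (v k) (x k)
    ; f-inj = λ {x} e →
        let xk≡0 : x k ≡ + 0 [modℤ n ]
            xk≡0 = c-trans (c-trans (c-refl (sym (ℤₚ.*-identityˡ (x k)))) (times (x k) (c-sym u)))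
                   (c-trans (c-refl (ℤₚ.*-assoc (v k) (v k) (x k)))
                   (c-trans (c-* (v k) (c-trans (c-sym (at-pivot x)) (pointwise e k))) (c-refl (ℤₚ.*-zeroʳ (v k)))))
        in assemble (λ i → c-trans (c-sym (fixes x xk≡0 i)) (pointwise e i))
    }
    where
    g : Pt → Pt
    g x i = x i - (v i - δ k i) * (v k * x k)
    lin+ : ∀ x y d a xk yk → x + y - d * (a * (xk + yk)) ≡ x - d * (a * xk) + (y - d * (a * yk))
    lin+ = solve-∀
    lin* : ∀ c x d a xk → c * x - d * (a * (c * xk)) ≡ c * (x - d * (a * xk))
    lin* = solve-∀
    times : ∀ {a b} c → a ≡ b [modℤ n ] → a * c ≡ b * c [modℤ n ]
    times {a} {b} c e = c-trans (c-refl (ℤₚ.*-comm a c)) (c-trans (c-* c e) (c-refl (ℤₚ.*-comm c b)))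
    at-pivot : ∀ x → g x k ≡ v k * x k [modℤ n ]
    at-pivot x = c-trans (c-refl (trans (cong (λ d → x k - (v k - d) * (v k * x k)) (δ-diag k)) (expand (x k) (v k))))
      (c-trans (c-+ {n} {a = x k + v k * x k} (c-refl refl) (c-* (- x k) u)) (c-refl (collapse (x k) (v k))))
      where
      expand : ∀ x a → x - (a - + 1) * (a * x) ≡ (x + a * x) + (- x) * (a * a)
      expand = solve-∀
      collapse : ∀ x a → (x + a * x) + (- x) * + 1 ≡ a * x
      collapse = solve-∀
    fixes : ∀ x → x k ≡ + 0 [modℤ n ] → ∀ i → g x i ≡ x i [modℤ n ]
    fixes x e i = c-trans (c-+ {n} {a = x i} (c-refl refl) (c-trans (c-refl (neg (v i - δ k i) (v k) (x k))) (c-* (- (v i - δ k i) * v k) e)))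
      (c-refl (zero-out (x i) (- (v i - δ k i) * v k)))
      where
      neg : ∀ d a x → - (d * (a * x)) ≡ - d * a * x
      neg = solve-∀
      zero-out : ∀ x d → x + d * + 0 ≡ x
      zero-out = solve-∀

  pivot-self : ∀ (v : Pt) k u → Lin.f (pivot v k u) v ≡ δ k [mod n ]
  pivot-self v k u = assemble λ i →
    c-trans (c-refl (expand (v i) (δ k i) (v k)))
      (c-trans (c-+ {n} {a = v i} (c-refl refl) (c-* (- (v i - δ k i)) u)) (c-refl (collapse (v i) (δ k i))))
    where
    expand : ∀ v d a → v - (v - d) * (a * a) ≡ v + (- (v - d)) * (a * a)
    expand = solve-∀
    collapse : ∀ v d → v + (- (v - d)) * + 1 ≡ d
    collapse = solve-∀

  pivot-fix : ∀ (v : Pt) k u (x : Pt) → x k ≡ + 0 [modℤ n ] → Lin.f (pivot v k u) x ≡ x [mod n ]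
  pivot-fix v k u x e = assemble λ i →
    c-trans (c-+ {n} {a = x i} (c-refl refl) (c-trans (c-refl (neg (v i - δ k i) (v k) (x k))) (c-* (- (v i - δ k i) * v k) e)))
      (c-refl (zero-out (x i) (- (v i - δ k i) * v k)))
    where
    neg : ∀ d a x → - (d * (a * x)) ≡ - d * a * x
    neg = solve-∀
    zero-out : ∀ x d → x + d * + 0 ≡ x
    zero-out = solve-∀

  record Label : Set where
    field
      lab     : Pt → V
      lab-0   : lab 0ᵖ ≡ vec 𝟘 𝟘 𝟘
      lab-+   : ∀ x y → lab (x +ᵖ y) ≡ lab x ⊞ᵛ lab y
      lab-mod : ∀ {x y} → x ≡ y [mod n ] → lab x ≡ lab y
      lab-inj : ∀ {x y} → lab x ≡ lab y → x ≡ y [mod n ]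

    lab-≈ : ∀ {x y} → x ≈ᶻ y → lab x ≡ lab y
    lab-≈ e = lab-mod (assemble (λ i → c-refl (e i)))

  label : Lin → Label
  label g = record
    { lab = λ x → res (f x)
    ; lab-0 = trans (res-cong {y = 0ᵖ} (assemble (λ i → c-trans (c-refl (f-≈ {0ᵖ} {+ 0 *ᵖ 0ᵖ} (λ _ → refl) i)) (c-refl (f-* (+ 0) 0ᵖ i)))))
              (coord-ext λ { zero → resᶻ-0 (c-refl refl) ; (suc zero) → resᶻ-0 (c-refl refl) ; (suc (suc zero)) → resᶻ-0 (c-refl refl) })
    ; lab-+ = λ x y → trans (res-cong (assemble (λ i → c-refl (f-+ x y i)))) (res-⊞ (f x) (f y))
    ; lab-mod = λ e → res-cong (f-mod e)
    ; lab-inj = λ {x} {y} e → let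
        fx≡fy = res-inj {f x} {f y} e
        split : f x ≈ᶻ (f y +ᵖ f (x -ᵖ y))
        split = ≈-trans (f-≈ (λ i → sub (x i) (y i))) (f-+ y (x -ᵖ y))
        d≡0 = f-inj {x -ᵖ y} (assemble (λ i → c-trans (c-refl (trans (back (f y i) (f (x -ᵖ y) i)) (cong (_- f y i) (sym (split i)))))
                (c-trans (c-+ {a = f x i} {b = f y i} {c = - f y i} (pointwise fx≡fy i) (c-refl refl)) (c-refl (ℤₚ.+-inverseʳ (f y i))))))
        in assemble (λ i → c-trans (c-refl (sub (x i) (y i))) (c-trans (c-+ {a = y i} {b = y i} (c-refl refl) (pointwise d≡0 i)) (c-refl (ℤₚ.+-identityʳ (y i)))))
    }
    where
    open Lin g
    sub : ∀ x y → x ≡ y + (x - y)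
    sub = solve-∀
    back : ∀ y d → d ≡ y + d - y
    back = solve-∀

  swap₀₁ swap₀₂ swap₁₂ : Fin 3 → Fin 3
  swap₀₁ zero = suc zero
  swap₀₁ (suc zero) = zero
  swap₀₁ (suc (suc zero)) = suc (suc zero)
  swap₀₂ zero = suc (suc zero)
  swap₀₂ (suc zero) = suc zero
  swap₀₂ (suc (suc zero)) = zero
  swap₁₂ zero = zero
  swap₁₂ (suc zero) = suc (suc zero)
  swap₁₂ (suc (suc zero)) = suc zero

  swap₀₁² : ∀ i → swap₀₁ (swap₀₁ i) ≡ i
  swap₀₁² zero = refl
  swap₀₁² (suc zero) = refl
  swap₀₁² (suc (suc zero)) = refl

  swap₀₂² : ∀ i → swap₀₂ (swap₀₂ i) ≡ i
  swap₀₂² zero = refl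
  swap₀₂² (suc zero) = refl
  swap₀₂² (suc (suc zero)) = refl

  swap₁₂² : ∀ i → swap₁₂ (swap₁₂ i) ≡ i
  swap₁₂² zero = refl
  swap₁₂² (suc zero) = refl
  swap₁₂² (suc (suc zero)) = refl

  p-trans : ∀ {x y z} → x ≡ y [mod n ] → y ≡ z [mod n ] → x ≡ z [mod n ]
  p-trans e f = assemble (λ i → c-trans (pointwise e i) (pointwise f i))

  frame₁ : ∀ v → ¬ v ≡ 0ᵖ [mod n ] → Σ Lin λ g → Lin.f g v ≡ δ zero [mod n ]
  frame₁ v v≢0 with zero? (v zero) | zero? (v (suc zero)) | zero? (v (suc (suc zero)))
  ... | inj₂ u | _ | _ = pivot v zero u , pivot-self v zero u
  ... | inj₁ _ | inj₂ u | _ =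
    pivot (λ i → v (swap₀₁ i)) zero u ∘ˡ permute swap₀₁ swap₀₁ swap₀₁² , pivot-self (λ i → v (swap₀₁ i)) zero u
  ... | inj₁ _ | inj₁ _ | inj₂ u =
    pivot (λ i → v (swap₀₂ i)) zero u ∘ˡ permute swap₀₂ swap₀₂ swap₀₂² , pivot-self (λ i → v (swap₀₂ i)) zero u
  ... | inj₁ a | inj₁ b | inj₁ c = ⊥-elim (v≢0 (assemble λ { zero → a ; (suc zero) → b ; (suc (suc zero)) → c }))

  -- Once `v` has become the first unit vector, `w` keeps a nonzero coordinate after the first one,
  -- for otherwise it would be a multiple of `v`. Pivoting there leaves the first unit vector alone.
  frame₂ : ∀ v w → ¬ v ≡ 0ᵖ [mod n ] → (∀ c → ¬ w ≡ c *ᵖ v [mod n ]) →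
    Σ Lin λ g → Lin.f g v ≡ δ zero [mod n ] × Lin.f g w ≡ δ (suc zero) [mod n ]
  frame₂ v w v≢0 indep with frame₁ v v≢0
  ... | g , gv with zero? (Lin.f g w (suc zero)) | zero? (Lin.f g w (suc (suc zero)))
  ... | inj₂ u | _ = pivot (f w) (suc zero) u ∘ˡ g ,
      p-trans (Lin.f-mod (pivot (f w) (suc zero) u) gv) (pivot-fix (f w) (suc zero) u (δ zero) (c-refl refl)) ,
      pivot-self (f w) (suc zero) u
    where open Lin g
  ... | inj₁ _ | inj₂ u = h ∘ˡ (permute swap₁₂ swap₁₂ swap₁₂² ∘ˡ g) ,
      p-trans (Lin.f-mod h {y = δ zero} (p-trans {y = λ i → δ zero (swap₁₂ i)} (assemble λ i → pointwise gv (swap₁₂ i))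
        (assemble λ { zero → c-refl refl ; (suc zero) → c-refl refl ; (suc (suc zero)) → c-refl refl })))
        (pivot-fix w′ (suc zero) u (δ zero) (c-refl refl)) ,
      pivot-self w′ (suc zero) u
    where
    open Lin g
    w′ : Pt
    w′ i = f w (swap₁₂ i)
    h = pivot w′ (suc zero) u
  ... | inj₁ a | inj₁ b = ⊥-elim (indep c (Label.lab-inj (label g) (res-cong
          (assemble λ i → c-trans (line i) (c-trans (c-* c (c-sym (pointwise gv i))) (c-refl (sym (f-* c v i))))))))
    where
    open Lin g
    c = f w zero
    line : ∀ i → f w i ≡ c * δ zero i [modℤ n ]
    line zero = c-refl (sym (ℤₚ.*-identityʳ c))
    line (suc zero) = c-trans a (c-refl (sym (ℤₚ.*-zeroʳ c)))
    line (suc (suc zero)) = c-trans b (c-refl (sym (ℤₚ.*-zeroʳ c)))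

  e₀ᵛ e₁ᵛ e₂ᵛ : V
  e₀ᵛ = vec 𝟙 𝟘 𝟘
  e₁ᵛ = vec 𝟘 𝟙 𝟘
  e₂ᵛ = vec 𝟘 𝟘 𝟙

  -- What can still be arranged for two more vectors: the first of them outside the plane of `e₀ᵛ`
  -- and `e₁ᵛ` is moved to `e₂ᵛ`. Modulo 3 this leaves 117 of the 729 pairs.
  NormalPair : V → V → Set
  NormalPair u v = u ≡ e₂ᵛ ⊎ (coord u (suc (suc zero)) ≡ 𝟘 × (v ≡ e₂ᵛ ⊎ coord v (suc (suc zero)) ≡ 𝟘))

  res-δ₀ : res (δ zero) ≡ e₀ᵛ
  res-δ₀ = coord-ext λ { zero → resᶻ-1 (c-refl refl) ; (suc zero) → resᶻ-0 (c-refl refl) ; (suc (suc zero)) → resᶻ-0 (c-refl refl) }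
  res-δ₁ : res (δ (suc zero)) ≡ e₁ᵛ
  res-δ₁ = coord-ext λ { zero → resᶻ-0 (c-refl refl) ; (suc zero) → resᶻ-1 (c-refl refl) ; (suc (suc zero)) → resᶻ-0 (c-refl refl) }
  res-δ₂ : res (δ (suc (suc zero))) ≡ e₂ᵛ
  res-δ₂ = coord-ext λ { zero → resᶻ-0 (c-refl refl) ; (suc zero) → resᶻ-0 (c-refl refl) ; (suc (suc zero)) → resᶻ-1 (c-refl refl) }

  frame : ∀ v w x y → ¬ v ≡ 0ᵖ [mod n ] → (∀ c → ¬ w ≡ c *ᵖ v [mod n ]) →
    Σ Label λ ℓ → let open Label ℓ in lab v ≡ e₀ᵛ × lab w ≡ e₁ᵛ × NormalPair (lab x) (lab y)
  frame v w x y v≢0 indep with frame₂ v w v≢0 indep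
  ... | g , gv , gw with zero? (Lin.f g x (suc (suc zero))) | zero? (Lin.f g y (suc (suc zero)))
  ... | inj₂ u | _ = label (h ∘ˡ g) , keep zero gv (c-refl refl) res-δ₀ , keep (suc zero) gw (c-refl refl) res-δ₁ ,
      inj₁ (trans (res-cong (pivot-self (f x) (suc (suc zero)) u)) res-δ₂)
    where
    open Lin g
    h = pivot (f x) (suc (suc zero)) u
    keep : ∀ {z u′} k → f z ≡ δ k [mod n ] → δ k (suc (suc zero)) ≡ + 0 [modℤ n ] → res (δ k) ≡ u′ → res (Lin.f h (f z)) ≡ u′
    keep k e e′ e″ = trans (res-cong (p-trans (Lin.f-mod h e) (pivot-fix (f x) (suc (suc zero)) u (δ k) e′))) e″
  ... | inj₁ a | inj₂ u = label (h ∘ˡ g) , keep zero gv (c-refl refl) res-δ₀ , keep (suc zero) gw (c-refl refl) res-δ₁ ,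
      inj₂ (trans (cong (λ t → coord t (suc (suc zero))) (res-cong (pivot-fix (f y) (suc (suc zero)) u (f x) a))) (resᶻ-0 a) ,
            inj₁ (trans (res-cong (pivot-self (f y) (suc (suc zero)) u)) res-δ₂))
    where
    open Lin g
    h = pivot (f y) (suc (suc zero)) u
    keep : ∀ {z u′} k → f z ≡ δ k [mod n ] → δ k (suc (suc zero)) ≡ + 0 [modℤ n ] → res (δ k) ≡ u′ → res (Lin.f h (f z)) ≡ u′
    keep k e e′ e″ = trans (res-cong (p-trans (Lin.f-mod h e) (pivot-fix (f y) (suc (suc zero)) u (δ k) e′))) e″
  ... | inj₁ a | inj₁ b = label g , trans (res-cong gv) res-δ₀ , trans (res-cong gw) res-δ₁ , inj₂ (resᶻ-0 a , inj₂ (resᶻ-0 b))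

rep₂ : F₂ → ℤ
rep₂ 𝟎 = + 0
rep₂ 𝟏 = + 1

rep₃ : F₃ → ℤ
rep₃ 𝟎 = + 0
rep₃ 𝟏 = + 1
rep₃ 𝟐 = + 2

_≟₂_ : (r s : F₂) → Dec (r ≡ s)
𝟎 ≟₂ 𝟎 = yes refl
𝟎 ≟₂ 𝟏 = no λ ()
𝟏 ≟₂ 𝟎 = no λ ()
𝟏 ≟₂ 𝟏 = yes refl

_≟₃_ : (r s : F₃) → Dec (r ≡ s)
𝟎 ≟₃ 𝟎 = yes refl
𝟎 ≟₃ 𝟏 = no λ ()
𝟎 ≟₃ 𝟐 = no λ ()
𝟏 ≟₃ 𝟎 = no λ ()
𝟏 ≟₃ 𝟏 = yes refl
𝟏 ≟₃ 𝟐 = no λ ()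
𝟐 ≟₃ 𝟎 = no λ ()
𝟐 ≟₃ 𝟏 = no λ ()
𝟐 ≟₃ 𝟐 = yes refl

small-multiple : ∀ n a b k → ℤ.∣ a - b ∣ ℕ.< n → a ≡ b + + n * k → a ≡ b
small-multiple n a b k lt e with k | e
... | + zero | e = trans e (trans (cong (_+_ b) (ℤₚ.*-zeroʳ (+ n))) (ℤₚ.+-identityʳ b))
... | + suc m | e = ⊥-elim (big (+ suc m) (s≤s z≤n) e)
  where
  big : ∀ k → 1 ℕ.≤ ℤ.∣ k ∣ → a ≡ b + + n * k → ⊥
  big k pos e = ℕₚ.<⇒≱ lt (ℕₚ.≤-trans (ℕₚ.≤-reflexive (sym (ℕₚ.*-identityʳ n))) (ℕₚ.≤-trans (ℕₚ.*-monoʳ-≤ n pos)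
    (ℕₚ.≤-reflexive (trans (sym (ℤₚ.abs-* (+ n) k)) (cong ℤ.∣_∣ (trans (back b (+ n * k)) (cong (_- b) (sym e))))))))
    where
    back : ∀ y d → d ≡ y + d - y
    back = solve-∀
... | -[1+ m ] | e = ⊥-elim (big -[1+ m ] (s≤s z≤n) e)
  where
  big : ∀ k → 1 ℕ.≤ ℤ.∣ k ∣ → a ≡ b + + n * k → ⊥
  big k pos e = ℕₚ.<⇒≱ lt (ℕₚ.≤-trans (ℕₚ.≤-reflexive (sym (ℕₚ.*-identityʳ n))) (ℕₚ.≤-trans (ℕₚ.*-monoʳ-≤ n pos)
    (ℕₚ.≤-reflexive (trans (sym (ℤₚ.abs-* (+ n) k)) (cong ℤ.∣_∣ (trans (back b (+ n * k)) (cong (_- b) (sym e))))))))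
    where
    back : ∀ y d → d ≡ y + d - y
    back = solve-∀

residues₂ : Residues
residues₂ = record
  { n = + 2 ; K = F₂ ; ⟦_⟧ = rep₂ ; _⊞_ = _+₂_ ; 𝟘 = 𝟎 ; 𝟙 = 𝟏 ; ⟦𝟘⟧ = refl ; ⟦𝟙⟧ = refl
  ; rep = λ z → digit (z ℤD.%ℕ 2) (ℤD.n%ℕd<d z 2) z (z ℤD./ℕ 2) (ℤD.a≡a%ℕn+[a/ℕn]*n z 2)
  ; uniq = λ { 𝟎 𝟎 _ → refl ; 𝟏 𝟏 _ → refl
             ; 𝟎 𝟏 (k by e) → ⊥-elim (absurd₁ (small-multiple 2 (+ 0) (+ 1) k (s≤s (s≤s z≤n)) e))
             ; 𝟏 𝟎 (k by e) → ⊥-elim (absurd₂ (small-multiple 2 (+ 1) (+ 0) k (s≤s (s≤s z≤n)) e)) }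
  ; hom = λ { 𝟎 𝟎 → + 0 by refl ; 𝟎 𝟏 → + 0 by refl ; 𝟏 𝟎 → + 0 by refl ; 𝟏 𝟏 → + 1 by refl }
  ; unit = λ { 𝟎 h → ⊥-elim (h refl) ; 𝟏 _ → + 0 by refl }
  ; K≟ = _≟₂_
  }
  where
  absurd₁ : ¬ (+ 0) ≡ (+ 1)
  absurd₁ ()
  absurd₂ : ¬ (+ 1) ≡ (+ 0)
  absurd₂ ()
  digit : ∀ r → r ℕ.< 2 → ∀ z k → z ≡ + r + k * + 2 → ∃[ s ] z ≡ rep₂ s [modℤ + 2 ]
  digit 0 _ z k e = 𝟎 , (k by trans e (cong (_+_ (+ 0)) (ℤₚ.*-comm k (+ 2))))
  digit 1 _ z k e = 𝟏 , (k by trans e (cong (_+_ (+ 1)) (ℤₚ.*-comm k (+ 2))))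
  digit (suc (suc _)) (s≤s (s≤s ())) z k e

residues₃ : Residues
residues₃ = record
  { n = + 3 ; K = F₃ ; ⟦_⟧ = rep₃ ; _⊞_ = _+₃_ ; 𝟘 = 𝟎 ; 𝟙 = 𝟏 ; ⟦𝟘⟧ = refl ; ⟦𝟙⟧ = refl
  ; rep = λ z → digit (z ℤD.%ℕ 3) (ℤD.n%ℕd<d z 3) z (z ℤD./ℕ 3) (ℤD.a≡a%ℕn+[a/ℕn]*n z 3)
  ; uniq = λ r s (k by e) → rep₃-injective r s (small-multiple 3 (rep₃ r) (rep₃ s) k (close r s) e)
  ; hom = λ { 𝟎 s → + 0 by trans (ℤₚ.+-identityˡ (rep₃ s)) (sym (ℤₚ.+-identityʳ (rep₃ s)))
            ; 𝟏 𝟎 → + 0 by refl ; 𝟏 𝟏 → + 0 by refl ; 𝟏 𝟐 → + 1 by refl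
            ; 𝟐 𝟎 → + 0 by refl ; 𝟐 𝟏 → + 1 by refl ; 𝟐 𝟐 → + 1 by refl }
  ; unit = λ { 𝟎 h → ⊥-elim (h refl) ; 𝟏 _ → + 0 by refl ; 𝟐 _ → + 1 by refl }
  ; K≟ = _≟₃_
  }
  where
  rep₃-injective : ∀ r s → rep₃ r ≡ rep₃ s → r ≡ s
  rep₃-injective 𝟎 𝟎 e = refl
  rep₃-injective 𝟏 𝟏 e = refl
  rep₃-injective 𝟐 𝟐 e = refl
  close : ∀ r s → ℤ.∣ rep₃ r - rep₃ s ∣ ℕ.< 3
  close 𝟎 𝟎 = s≤s z≤n
  close 𝟎 𝟏 = s≤s (s≤s z≤n)
  close 𝟎 𝟐 = s≤s (s≤s (s≤s z≤n))
  close 𝟏 𝟎 = s≤s (s≤s z≤n)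
  close 𝟏 𝟏 = s≤s z≤n
  close 𝟏 𝟐 = s≤s (s≤s z≤n)
  close 𝟐 𝟎 = s≤s (s≤s (s≤s z≤n))
  close 𝟐 𝟏 = s≤s (s≤s z≤n)
  close 𝟐 𝟐 = s≤s z≤n
  digit : ∀ r → r ℕ.< 3 → ∀ z k → z ≡ + r + k * + 3 → ∃[ s ] z ≡ rep₃ s [modℤ + 3 ]
  digit 0 _ z k e = 𝟎 , (k by trans e (cong (_+_ (+ 0)) (ℤₚ.*-comm k (+ 3))))
  digit 1 _ z k e = 𝟏 , (k by trans e (cong (_+_ (+ 1)) (ℤₚ.*-comm k (+ 3))))
  digit 2 _ z k e = 𝟐 , (k by trans e (cong (_+_ (+ 2)) (ℤₚ.*-comm k (+ 3))))
  digit (suc (suc (suc _))) (s≤s (s≤s (s≤s ()))) z k e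

-- Case enumeration over F₂ and F₃

V₂ V₃ : Set
V₂ = Vec₃ F₂
V₃ = Vec₃ F₃

infixl 6 _⊞₂_ _⊞₃_
-- Later arguments see these operations only through laws proved of them; the finite checks unfold
-- them in order to evaluate.
opaque
  _⊞₂_ : V₂ → V₂ → V₂
  _⊞₂_ = zipV _+₂_
  _⊞₃_ : V₃ → V₃ → V₃
  _⊞₃_ = zipV _+₃_

infix 4 _≟ᵇ₂_ _≟ᵇ₃_

_==₂_ : F₂ → F₂ → Bool
𝟎 ==₂ 𝟎 = true
𝟏 ==₂ 𝟏 = true
_ ==₂ _ = false

_==₃_ : F₃ → F₃ → Bool
𝟎 ==₃ 𝟎 = true
𝟏 ==₃ 𝟏 = true
𝟐 ==₃ 𝟐 = true
_ ==₃ _ = false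

opaque
  _≟ᵇ₂_ : V₂ → V₂ → Bool
  vec a b c ≟ᵇ₂ vec x y z = (a ==₂ x) ∧ (b ==₂ y) ∧ (c ==₂ z)

  _≟ᵇ₃_ : V₃ → V₃ → Bool
  vec a b c ≟ᵇ₃ vec x y z = (a ==₃ x) ∧ (b ==₃ y) ∧ (c ==₃ z)

  allF₂ : (F₂ → Bool) → Bool
  allF₂ f = f 𝟎 ∧ f 𝟏

  allV₂ : (V₂ → Bool) → Bool
  allV₂ f = allF₂ λ a → allF₂ λ b → allF₂ λ c → f (vec a b c)

  allF₃ : (F₃ → Bool) → Bool
  allF₃ f = f 𝟎 ∧ f 𝟏 ∧ f 𝟐

  allV₃ : (V₃ → Bool) → Bool
  allV₃ f = allF₃ λ a → allF₃ λ b → allF₃ λ c → f (vec a b c)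

  anyᶠ : ∀ {n} → (Fin n → Bool) → Bool
  anyᶠ {zero} f = false
  anyᶠ {suc n} f = f zero ∨ anyᶠ (λ i → f (suc i))

  allᶠ : ∀ {n} → (Fin n → Bool) → Bool
  allᶠ {zero} f = true
  allᶠ {suc n} f = f zero ∧ allᶠ (λ i → f (suc i))

  _==ᶠ_ : ∀ {n} → Fin n → Fin n → Bool
  zero ==ᶠ zero = true
  suc i ==ᶠ suc j = i ==ᶠ j
  _ ==ᶠ _ = false

  anyˡ : ∀ {A : Set} → (A → Bool) → List A → Bool
  anyˡ f [] = false
  anyˡ f (x ∷ xs) = f x ∨ anyˡ f xs

  filterˡ : ∀ {A : Set} → (A → Bool) → List A → List A
  filterˡ f [] = []
  filterˡ f (x ∷ xs) = if f x then x ∷ filterˡ f xs else filterˡ f xs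

infixr 3 _⇒_
_⇒_ : Bool → Bool → Bool
true ⇒ b = b
false ⇒ b = true

pattern #0 = zero
pattern #1 = suc zero
pattern #2 = suc (suc zero)
pattern #3 = suc (suc (suc zero))
pattern #4 = suc (suc (suc (suc zero)))

five : ∀ {X : Set} → X → X → X → X → X → Fin 5 → X
five a b c d e #0 = a
five a b c d e #1 = b
five a b c d e #2 = c
five a b c d e #3 = d
five a b c d e #4 = e

four : ∀ {X : Set} → X → X → X → X → Fin 4 → X
four a b c d #0 = a
four a b c d #1 = b
four a b c d #2 = c
four a b c d #3 = d

0₃ : V₃
0₃ = vec 𝟎 𝟎 𝟎
0₂ : V₂
0₂ = vec 𝟎 𝟎 𝟎

normal₃ : V₃ → V₃ → Bool
normal₃ u v = (u ≟ᵇ₃ vec 𝟎 𝟎 𝟏) ∨ ((coord u #2 ==₃ 𝟎) ∧ ((v ≟ᵇ₃ vec 𝟎 𝟎 𝟏) ∨ (coord v #2 ==₃ 𝟎)))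

normal₂ : V₂ → V₂ → Bool
normal₂ u v = (u ≟ᵇ₂ vec 𝟎 𝟎 𝟏) ∨ ((coord u #2 ==₂ 𝟎) ∧ ((v ≟ᵇ₂ vec 𝟎 𝟎 𝟏) ∨ (coord v #2 ==₂ 𝟎)))

-- An edge (m , n , s , r) stands for the relation p m - p n = q s - q r.
Edge : Set
Edge = Fin 5 × Fin 5 × Fin 4 × Fin 4

tab₃ : V₃ → V₃ → Fin 5 → V₃
tab₃ u v = five 0₃ (vec 𝟏 𝟎 𝟎) (vec 𝟎 𝟏 𝟎) u v

tab₂ : V₂ → V₂ → Fin 5 → V₂
tab₂ u v = five 0₂ (vec 𝟏 𝟎 𝟎) (vec 𝟎 𝟏 𝟎) u v

-- Three distinct points of F₃³ are collinear if and only if their sum vanishes.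
noCap : (Fin 5 → V₃) → Bool
noCap A = anyᶠ λ i → anyᶠ λ j → not (i ==ᶠ j) ∧
  ((A i ≟ᵇ₃ A j) ∨ anyᶠ λ k → not (i ==ᶠ k) ∧ not (j ==ᶠ k) ∧ (A i ⊞₃ A j ⊞₃ A k ≟ᵇ₃ 0₃))

repeats₂ : (Fin 5 → V₂) → Bool
repeats₂ A = anyᶠ λ i → anyᶠ λ j → not (i ==ᶠ j) ∧ (A i ≟ᵇ₂ A j)

module _ (A : Fin 5 → V₃) (B : Fin 4 → V₃) where

  isEdge : Edge → Bool
  isEdge (m , n , s , r) = not (m ==ᶠ n) ∧ (A m ⊞₃ B r ≟ᵇ₃ A n ⊞₃ B s)

  edgesAt : Fin 4 → Fin 4 → Bool
  edgesAt s r = anyᶠ λ m → anyᶠ λ n → isEdge (m , n , s , r)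

-- Pairs among the first two, three and four points of Q. One order per pair is enough, since
-- reversing an edge exchanges `m` and `n` as well.
pairs₂ pairs₃ pairs₄ : List (Fin 4 × Fin 4)
pairs₂ = (#0 , #1) ∷ []
pairs₃ = pairs₂ ++ (#0 , #2) ∷ (#1 , #2) ∷ []
pairs₄ = pairs₃ ++ (#0 , #3) ∷ (#1 , #3) ∷ (#2 , #3) ∷ []

indices₅ : List (Fin 5)
indices₅ = #0 ∷ #1 ∷ #2 ∷ #3 ∷ #4 ∷ []

candidates : List (Fin 4 × Fin 4) → List Edge
candidates sr = concatMap (λ { (s , r) → concatMap (λ m → map (λ n → m , n , s , r) indices₅) indices₅ }) sr

edges : (Fin 5 → V₃) → (Fin 4 → V₃) → List (Fin 4 × Fin 4) → List Edge
edges A B sr = filterˡ (isEdge A B) (candidates sr)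

-- A common edge is a coincidence among the twenty sums of residues, so the claim is that they
-- cannot all be different in F₃³ when the residues of P form a cap. The points of Q are chosen one
-- at a time and a branch closes at the first coincidence; entries not chosen yet repeat the last
-- one and are not consulted.
edgeExists : Bool
edgeExists = allV₃ λ u → allV₃ λ v → let A = tab₃ u v in normal₃ u v ∧ not (noCap A) ⇒
  (allV₃ λ x → let B = four 0₃ x x x in (x ≟ᵇ₃ 0₃) ∨ edgesAt A B #0 #1 ∨
    (allV₃ λ y → let B = four 0₃ x y y in (y ≟ᵇ₃ 0₃) ∨ (y ≟ᵇ₃ x) ∨ edgesAt A B #0 #2 ∨ edgesAt A B #1 #2 ∨
      (allV₃ λ z → let B = four 0₃ x y z in (z ≟ᵇ₃ 0₃) ∨ (z ≟ᵇ₃ x) ∨ (z ≟ᵇ₃ y) ∨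
         edgesAt A B #0 #3 ∨ edgesAt A B #1 #3 ∨ edgesAt A B #2 #3)))

-- Two equal difference vectors within P (first clause) or within Q (the other two, for the two
-- orientations) span a parallelogram, which length 1 forbids.
sameEdge : Edge → Edge → Bool
sameEdge (m , n , s , r) (m′ , n′ , s′ , r′) =
  ((s ==ᶠ s′) ∧ (r ==ᶠ r′) ∧ not (m ==ᶠ m′)) ∨
  ((m ==ᶠ m′) ∧ (n ==ᶠ n′) ∧ not (s ==ᶠ s′)) ∨
  ((m ==ᶠ n′) ∧ (n ==ᶠ m′) ∧ not (s ==ᶠ r′))

bad : List Edge → Bool
bad es = anyˡ (λ e → anyˡ (sameEdge e) es) es

-- Conditions on residues that no configuration meets: inc contradicts an edge relation, and each of the others yields
-- two different parallel segments in S with the same even difference vector.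
module Kill (A : Fin 5 → V₃) (B : Fin 4 → V₃) where

  eq₃ : Fin 5 → Fin 4 → Fin 5 → Fin 4 → Bool
  eq₃ i j k l = A i ⊞₃ B j ≟ᵇ₃ A k ⊞₃ B l

  module Parity (A′ : Fin 5 → V₂) (B′ : Fin 4 → V₂) where

    eq₂ : Fin 5 → Fin 4 → Fin 5 → Fin 4 → Bool
    eq₂ i j k l = A′ i ⊞₂ B′ j ≟ᵇ₂ A′ k ⊞₂ B′ l

    -- The zero sum modulo 3 of three sums, the first two congruent modulo 2, makes the third their midpoint.
    middle : Fin 5 → Fin 4 → Fin 5 → Fin 4 → Fin 5 → Fin 4 → Bool
    middle i j k l m n = eq₂ i j k l ∧ not (eq₃ i j k l) ∧
      ((A i ⊞₃ B j) ⊞₃ (A k ⊞₃ B l) ⊞₃ (A m ⊞₃ B n) ≟ᵇ₃ 0₃)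

    -- For `star`: the segment from `p c + q s` to `p m + q d`, moved along the edge vector
    -- `p n - p m = q r - q s`, becomes the segment from `p c + q r` to `p n + q d`.
    inc star : Edge → Bool
    inc (m , n , s , r) = not (eq₂ m r n s)
    star (m , n , s , r) = anyᶠ λ c → anyᶠ λ d → from m n s r c d ∨ from n m r s c d
      where
      from : Fin 5 → Fin 5 → Fin 4 → Fin 4 → Fin 5 → Fin 4 → Bool
      from m n s r c d = eq₂ m d c s ∧ not (eq₃ m d c s)

    flip : Edge → Edge
    flip (m , n , s , r) = n , m , r , s

    -- The sum of the two edge vectors is realised twice: from `p n + q r′` to `p m + q s′`, and
    -- from `p n′ + q r` to `p m′ + q s`.
    twins : Edge → Edge → Bool
    twins (m , n , s , r) (m′ , n′ , s′ , r′) = eq₂ m s′ n r′ ∧ not (eq₃ m s′ n r′) ∧ not (eq₃ m s′ m′ s)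

    -- Twice the edge vector leads from `p n + q r` to `p m + q s`. The `middle` condition realises
    -- it a second time, ending at `p i + q j` and starting at `p n + q z` or at `p c + q r`.
    longP longQ : Edge → Bool
    longP (m , n , s , r) = anyᶠ λ z → anyᶠ λ i → anyᶠ λ j → middle i j n z m z ∧ not (eq₃ i j m s)
    longQ (m , n , s , r) = anyᶠ λ c → anyᶠ λ i → anyᶠ λ j → middle i j c r c s ∧ not (eq₃ i j m s)

    -- Since `p e + q z` is the midpoint of `p b + q z` and `p i + q j`, moving by `p e - p b` takes
    -- `p e + q z` to `p i + q j` and `p b + q z′` to `p e + q z′`. An even segment between the
    -- first points of these two moves therefore occurs twice; `shiftQ` exchanges P and Q.
    shiftP shiftQ : Bool
    shiftP = anyᶠ λ b → anyᶠ λ e → anyᶠ λ z → anyᶠ λ i → anyᶠ λ j → middle i j b z e z ∧ not (eq₃ e z i j) ∧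
      anyᶠ λ z′ → eq₂ e z b z′ ∧ not (eq₃ e z b z′)
    shiftQ = anyᶠ λ x → anyᶠ λ y → anyᶠ λ c → anyᶠ λ i → anyᶠ λ j → middle i j c x c y ∧ not (eq₃ c y i j) ∧
      anyᶠ λ c′ → eq₂ c y c′ x ∧ not (eq₃ c y c′ x)

    killed : List Edge → Bool
    killed es = anyˡ inc es ∨ anyˡ star es ∨
      anyˡ (λ e → anyˡ (λ e′ → twins e e′ ∨ twins e (flip e′)) es) es ∨
      anyˡ (λ e → longP e ∨ longP (flip e) ∨ longQ e ∨ longQ (flip e)) es ∨ shiftP ∨ shiftQ

-- A point of Q whose parity, in coordinates where Q and P share an edge, is that of a point of P is that point.
agree : Bool → Bool → Bool
agree true b = b
agree false b = not b

aligned : (Fin 5 → V₃) → V₃ → (Fin 5 → V₂) → V₂ → Bool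
aligned A x A′ a = allᶠ λ c → agree (A c ≟ᵇ₃ x) (A′ c ≟ᵇ₂ a)

inP : (Fin 5 → V₃) → V₃ → Bool
inP A x = anyᶠ λ c → A c ≟ᵇ₃ x

e₀₃ : V₃
e₀₃ = vec 𝟏 𝟎 𝟎
e₀₂ : V₂
e₀₂ = vec 𝟏 𝟎 𝟎

-- The common edge puts `q 0`, `q 1` at the residues of `p 0`, `p 1`; `x` and `y` are the other two
-- points of Q. Unless both sit at residues of P, each parity table that respects `aligned` and
-- separates the points must be killed.
module Classify (A : Fin 5 → V₃) where

  parityOf₃ : V₃ → V₃ → List Edge → (Fin 5 → V₂) → V₂ → V₂ → Bool
  parityOf₃ x y es A′ a b = aligned A y A′ b ⇒ (b ≟ᵇ₂ a) ∨ Kill.Parity.killed A (four 0₃ e₀₃ x y) A′ (four 0₂ e₀₂ a b) es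

  parityOf₂ : V₃ → V₃ → List Edge → (Fin 5 → V₂) → V₂ → Bool
  parityOf₂ x y es A′ a = aligned A x A′ a ⇒ allV₂ (parityOf₃ x y es A′ a)

  parities : V₃ → V₃ → List Edge → V₂ → V₂ → Bool
  parities x y es u v = normal₂ u v ∧ not (repeats₂ (tab₂ u v)) ⇒ allV₂ (parityOf₂ x y es (tab₂ u v))

  leaf : V₃ → V₃ → List Edge → Bool
  leaf x y es = bad es ∨ (inP A x ∧ inP A y) ∨ allV₂ λ u → allV₂ (parities x y es u)

  second : V₃ → V₃ → Bool
  second x y = (y ≟ᵇ₃ 0₃) ∨ (y ≟ᵇ₃ e₀₃) ∨ (y ≟ᵇ₃ x) ∨ leaf x y (edges A (four 0₃ e₀₃ x y) pairs₄)

  -- A first pruning before `y` is enumerated: the fourth entry is a placeholder, and only edges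
  -- among the first three points of Q are tested.
  first : V₃ → Bool
  first x = (x ≟ᵇ₃ 0₃) ∨ (x ≟ᵇ₃ e₀₃) ∨ bad (edges A (four 0₃ e₀₃ x x) pairs₃) ∨ allV₃ (second x)

classification : Bool
classification = allV₃ λ u → allV₃ λ v → normal₃ u v ∧ not (noCap (tab₃ u v)) ⇒ allV₃ (Classify.first (tab₃ u v))

opaque
  unfolding _⊞₂_ _≟ᵇ₂_

  edgeExists-true : edgeExists ≡ true
  edgeExists-true = refl

  classification-true : classification ≡ true
  classification-true = refl

-- An equation follows from others once L - R is a linear combination of their differences, an identity left to the ring solver.
linear₁ : ∀ {a b L R} c → a ≡ b → L - R ≡ c * (a - b) → L ≡ R
linear₁ {a} {L = L} {R} c refl e = ℤₚ.i-j≡0⇒i≡j L R (trans e (trans (cong (c *_) (ℤₚ.+-inverseʳ a)) (ℤₚ.*-zeroʳ c)))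

linear₂ : ∀ {a b a′ b′ L R} c c′ → a ≡ b → a′ ≡ b′ → L - R ≡ c * (a - b) + c′ * (a′ - b′) → L ≡ R
linear₂ {a} {a′ = a′} {L = L} {R} c c′ refl refl e = ℤₚ.i-j≡0⇒i≡j L R (trans e
  (cong₂ _+_ (trans (cong (c *_) (ℤₚ.+-inverseʳ a)) (ℤₚ.*-zeroʳ c)) (trans (cong (c′ *_) (ℤₚ.+-inverseʳ a′)) (ℤₚ.*-zeroʳ c′))))

vanish : ∀ x c a → x + c * (a - a) ≡ x
vanish = solve-∀

linear₃ : ∀ {a b a′ b′ a″ b″ L R} c c′ c″ → a ≡ b → a′ ≡ b′ → a″ ≡ b″ →
  L - R ≡ c * (a - b) + c′ * (a′ - b′) + c″ * (a″ - b″) → L ≡ R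
linear₃ {a} {b} {a′} {b′} {a″} c c′ c″ e e′ refl f = linear₂ {a} {b} {a′} {b′} c c′ e e′
  (trans f (vanish (c * (a - b) + c′ * (a′ - b′)) c″ a″))

linear₄ : ∀ {a b a′ b′ a″ b″ a‴ b‴ L R} c c′ c″ c‴ → a ≡ b → a′ ≡ b′ → a″ ≡ b″ → a‴ ≡ b‴ →
  L - R ≡ c * (a - b) + c′ * (a′ - b′) + c″ * (a″ - b″) + c‴ * (a‴ - b‴) → L ≡ R
linear₄ {a} {b} {a′} {b′} {a″} {b″} {a‴} c c′ c″ c‴ e e′ e″ refl f = linear₃ {a} {b} {a′} {b′} {a″} {b″} c c′ c″ e e′ e″
  (trans f (vanish (c * (a - b) + c′ * (a′ - b′) + c″ * (a″ - b″)) c‴ a‴))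

cancelʳ : ∀ c a b → a + c ≡ b + c → a ≡ b
cancelʳ c a b e = linear₁ (+ 1) e (ring a b c)
  where
  ring : ∀ a b c → a - b ≡ + 1 * ((a + c) - (b + c))
  ring = solve-∀

cancelˡ : ∀ c a b → c + a ≡ c + b → a ≡ b
cancelˡ c a b e = cancelʳ c a b (trans (ℤₚ.+-comm a c) (trans e (ℤₚ.+-comm c b)))

-- Vertices of P and Q modulo 2 and modulo 3

module Modular {p q} (cfg : Config p q) where
  open Config cfg

  p-mod3 : ∀ {i j} → p i ≡ p j [mod + 3 ] → i ≡ j
  p-mod3 {i} {j} (k by e) = p-inj (λ t → cancelʳ (q zero t) (p i t) (p j t)
    (mod3 (S-sum i zero) (S-sum j zero) (k by λ s → linear₁ (+ 1) (e s) (ring (p i s) (p j s) (k s) (q zero s))) t))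
    where
    ring : ∀ x y k z → (x + z) - ((y + z) + + 3 * k) ≡ + 1 * (x - (y + + 3 * k))
    ring = solve-∀

  q-mod3 : ∀ {i j} → q i ≡ q j [mod + 3 ] → i ≡ j
  q-mod3 {i} {j} (k by e) = q-inj (λ t → cancelˡ (p zero t) (q i t) (q j t)
    (mod3 (S-sum zero i) (S-sum zero j) (k by λ s → linear₁ (+ 1) (e s) (ring (q i s) (q j s) (k s) (p zero s))) t))
    where
    ring : ∀ x y k z → (z + x) - ((z + y) + + 3 * k) ≡ + 1 * (x - (y + + 3 * k))
    ring = solve-∀

  -- An even difference of two points of P would appear in P + Q twice, once at `q 0` and once at
  -- `q 1`.
  p-mod2 : ∀ {i j} → p i ≡ p j [mod + 2 ] → i ≡ j
  p-mod2 {i} {j} (k by e) with mod2 (S-sum i zero) (S-sum j zero) (S-sum i (suc zero)) (S-sum j (suc zero))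
      (k by λ s → linear₁ (+ 1) (e s) (ring (p i s) (p j s) (k s) (q zero s)))
      (λ s → comm (p i s) (p j s) (q zero s) (q (suc zero) s))
    where
    ring : ∀ x y k z → (x + z) - ((y + z) + + 2 * k) ≡ + 1 * (x - (y + + 2 * k))
    ring = solve-∀
    comm : ∀ x y z w → (x + z) + (y + w) ≡ (x + w) + (y + z)
    comm = solve-∀
  ... | inj₁ same = p-inj (λ t → cancelʳ (q zero t) (p i t) (p j t) (same t))
  ... | inj₂ same with q-inj {zero} {suc zero} (λ t → cancelˡ (p i t) (q zero t) (q (suc zero) t) (same t))
  ... | ()

  q-mod2 : ∀ {i j} → q i ≡ q j [mod + 2 ] → i ≡ j
  q-mod2 {i} {j} (k by e) with mod2 (S-sum zero i) (S-sum zero j) (S-sum (suc zero) i) (S-sum (suc zero) j)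
      (k by λ s → linear₁ (+ 1) (e s) (ring (q i s) (q j s) (k s) (p zero s)))
      (λ s → comm (q i s) (q j s) (p zero s) (p (suc zero) s))
    where
    ring : ∀ x y k z → (z + x) - ((z + y) + + 2 * k) ≡ + 1 * (x - (y + + 2 * k))
    ring = solve-∀
    comm : ∀ x y z w → (z + x) + (w + y) ≡ (w + x) + (z + y)
    comm = solve-∀
  ... | inj₁ same = q-inj (λ t → cancelˡ (p zero t) (q i t) (q j t) (same t))
  ... | inj₂ same with p-inj {zero} {suc zero} (λ t → cancelʳ (q i t) (p zero t) (p (suc zero) t) (same t))
  ... | ()

  -- The centroid `g` would be a lattice point of P. If it is one of the three points, it is the
  -- midpoint of the other two, a degenerate parallelogram; otherwise it is a mean of other lattice
  -- points and so no vertex.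
  cap : ∀ {i j k} g → ¬ i ≡ j → ¬ i ≡ k → ¬ j ≡ k → ¬ (p i +ᵖ p j +ᵖ p k) ≈ᶻ (+ 3 *ᵖ g)
  cap {i} {j} {k} g i≢j i≢k j≢k e with p i ≈? g | p j ≈? g | p k ≈? g
  ... | yes f | _ | _ = p-para {j} {k} {i} {i} (λ x → i≢j (sym x)) (λ x → i≢j (sym x))
        (λ t → linear₂ (+ 1) (- + 3) (e t) (f t) (ring (p i t) (p j t) (p k t) (g t)))
    where
    ring : ∀ x y z g → (y + z) - (x + x) ≡ + 1 * ((x + y + z) - + 3 * g) + (- + 3) * (x - g)
    ring = solve-∀
  ... | _ | yes f | _ = p-para {i} {k} {j} {j} i≢j i≢j
        (λ t → linear₂ (+ 1) (- + 3) (e t) (f t) (ring (p i t) (p j t) (p k t) (g t)))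
    where
    ring : ∀ x y z g → (x + z) - (y + y) ≡ + 1 * ((x + y + z) - + 3 * g) + (- + 3) * (y - g)
    ring = solve-∀
  ... | _ | _ | yes f = p-para {i} {j} {k} {k} i≢k i≢k
        (λ t → linear₂ (+ 1) (- + 3) (e t) (f t) (ring (p i t) (p j t) (p k t) (g t)))
    where
    ring : ∀ x y z g → (x + y) - (z + z) ≡ + 1 * ((x + y + z) - + 3 * g) + (- + 3) * (z - g)
    ring = solve-∀
  ... | no ni | no nj | no nk = vertex (SP-mean L g 2 refl mean (SP-p i ∷ SP-p j ∷ SP-p k ∷ []))
        L 2 refl mean ((SP-p i , ni) ∷ (SP-p j , nj) ∷ (SP-p k , nk) ∷ [])
    where
    L : List (ℕ × Pt)
    L = (1 , p i) ∷ (1 , p j) ∷ (1 , p k) ∷ []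
    ring : ∀ x y z → + 1 * x + (+ 1 * y + (+ 1 * z + + 0)) ≡ x + y + z
    ring = solve-∀
    mean : Σp L ≈ᶻ (+ 3 *ᵖ g)
    mean t = trans (ring (p i t) (p j t) (p k t)) (e t)

  -- The half sum of x and y is a lattice point of the region that is congruent to t modulo 3.
  midpoint : ∀ {x y t} → S x → S y → S t → x ≡ y [mod + 2 ] → (x +ᵖ y +ᵖ t) ≡ 0ᵖ [mod + 3 ] →
    (x +ᵖ y) ≈ᶻ (t +ᵖ t)
  midpoint {x} {y} {t} hx hy ht (k by e) (l by f) = λ i → linear₂ (+ 1) (+ 2) (e i) (m≈t i) (ring₂ (x i) (y i) (k i) (t i))
    where
    ring₀ : ∀ x y k → (+ 1 * x + (+ 1 * y + + 0)) - (+ 2 * (y + k)) ≡ + 1 * (x - (y + + 2 * k))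
    ring₀ = solve-∀
    hm : S (y +ᵖ k)
    hm = S-mean ((1 , x) ∷ (1 , y) ∷ []) (y +ᵖ k) 1 refl (λ i → linear₁ (+ 1) (e i) (ring₀ (x i) (y i) (k i))) (hx ∷ hy ∷ [])
    ring₁ : ∀ x y k t l → (y + k) - (t + + 3 * (y + k - l)) ≡
      (- + 1) * ((x + y + t) - (+ 0 + + 3 * l)) + (+ 1) * (x - (y + + 2 * k))
    ring₁ = solve-∀
    m≈t : (y +ᵖ k) ≈ᶻ t
    m≈t = mod3 hm ht ((λ i → y i + k i - l i) by λ i → linear₂ (- + 1) (+ 1) (f i) (e i) (ring₁ (x i) (y i) (k i) (t i) (l i)))
    ring₂ : ∀ x y k t → (x + y) - (t + t) ≡ + 1 * (x - (y + + 2 * k)) + + 2 * ((y + k) - t)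
    ring₂ = solve-∀

  d : Fin 5 → Pt
  d i = p i -ᵖ p zero

  private
    module R₂ = Residue residues₂
    module R₃ = Residue residues₃

    undo : ∀ {n i j} → d i ≡ d j [mod n ] → p i ≡ p j [mod n ]
    undo {n} {i} {j} (k by e) = k by λ t → linear₁ (+ 1) (e t) (ring n (p i t) (p j t) (p zero t) (k t))
      where
      ring : ∀ n x y o k → x - (y + n * k) ≡ + 1 * ((x - o) - ((y - o) + n * k))
      ring = solve-∀

    undo₀ : ∀ {n i} → d i ≡ 0ᵖ [mod n ] → p i ≡ p zero [mod n ]
    undo₀ {n} {i} (k by e) = k by λ t → linear₁ (+ 1) (e t) (ring n (p i t) (p zero t) (k t))
      where
      ring : ∀ n x o k → x - (o + n * k) ≡ + 1 * ((x - o) - (+ 0 + n * k))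
      ring = solve-∀

    multiple : ∀ {n x v c ρ} → c ≡ ρ [modℤ n ] → x ≡ c *ᵖ v [mod n ] → x ≡ ρ *ᵖ v [mod n ]
    multiple {n} {x} {v} {c} {ρ} (k by e) (l by f) = (k *ᵖ v +ᵖ l) by λ t →
      linear₂ (+ 1) (v t) (f t) e (ring n (x t) (v t) c ρ k (l t))
      where
      ring : ∀ n x v c ρ k l → x - (ρ * v + n * (k * v + l)) ≡
        + 1 * (x - (c * v + n * l)) + v * (c - (ρ + n * k))
      ring = solve-∀

    simplify : ∀ {n} (x y z : Pt) → y ≈ᶻ z → x ≡ y [mod n ] → x ≡ z [mod n ]
    simplify {n} x y z e (k by f) = k by λ t → trans (f t) (cong (_+ n * k t) (e t))

  frame-exists₂ : Σ R₂.Label λ ℓ → let open R₂.Label ℓ in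
    lab (d #1) ≡ R₂.e₀ᵛ × lab (d #2) ≡ R₂.e₁ᵛ × R₂.NormalPair (lab (d #3)) (lab (d #4))
  frame-exists₂ = R₂.frame (d #1) (d #2) (d #3) (d #4) (λ e → absurd₁ (p-mod2 (undo₀ e))) indep
    where
    absurd₁ : ¬ suc zero ≡ zero {4}
    absurd₁ ()
    2≢0 : ¬ suc (suc zero) ≡ zero {4}
    2≢0 ()
    2≢1 : ¬ suc (suc zero) ≡ suc {4} zero
    2≢1 ()
    residue : ∀ ρ → ¬ d #2 ≡ rep₂ ρ *ᵖ d #1 [mod + 2 ]
    residue 𝟎 e = 2≢0 (p-mod2 (undo₀ (simplify (d #2) (+ 0 *ᵖ d #1) 0ᵖ (λ _ → refl) e)))
    residue 𝟏 e = 2≢1 (p-mod2 (undo (simplify (d #2) (+ 1 *ᵖ d #1) (d #1) (λ t → ℤₚ.*-identityˡ (d #1 t)) e)))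
    indep : ∀ c → ¬ d #2 ≡ c *ᵖ d #1 [mod + 2 ]
    indep c e = let (ρ , r) = Residues.rep residues₂ c in residue ρ (multiple r e)

  frame-exists₃ : Σ R₃.Label λ ℓ → let open R₃.Label ℓ in
    lab (d #1) ≡ R₃.e₀ᵛ × lab (d #2) ≡ R₃.e₁ᵛ × R₃.NormalPair (lab (d #3)) (lab (d #4))
  frame-exists₃ = R₃.frame (d #1) (d #2) (d #3) (d #4) (λ e → absurd₁ (p-mod3 (undo₀ e))) indep
    where
    absurd₁ : ¬ suc zero ≡ zero {4}
    absurd₁ ()
    2≢0 : ¬ suc (suc zero) ≡ zero {4}
    2≢0 ()
    2≢1 : ¬ suc (suc zero) ≡ suc {4} zero
    2≢1 ()
    residue : ∀ ρ → ¬ d #2 ≡ rep₃ ρ *ᵖ d #1 [mod + 3 ]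
    residue 𝟎 e = 2≢0 (p-mod3 (undo₀ (simplify (d #2) (+ 0 *ᵖ d #1) 0ᵖ (λ _ → refl) e)))
    residue 𝟏 e = 2≢1 (p-mod3 (undo (simplify (d #2) (+ 1 *ᵖ d #1) (d #1) (λ t → ℤₚ.*-identityˡ (d #1 t)) e)))
    -- `d #2 ≡ 2 d #1` modulo 3 says that `p #0 + p #1 + p #2` is three times a lattice point.
    residue 𝟐 (k by f) = cap {#0} {#1} {#2} (p #1 +ᵖ k) (λ ()) (λ ()) (λ ())
      (λ t → linear₁ (+ 1) (f t) (ring (p #0 t) (p #1 t) (p #2 t) (k t)))
      where
      ring : ∀ a b c k → (a + b + c) - + 3 * (b + k) ≡
        + 1 * ((c - a) - (+ 2 * (b - a) + + 3 * k))
      ring = solve-∀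
    indep : ∀ c → ¬ d #2 ≡ c *ᵖ d #1 [mod + 3 ]
    indep c e = let (ρ , r) = Residues.rep residues₃ c in residue ρ (multiple r e)

  opaque
    frame-mod2 : Σ R₂.Label λ ℓ → let open R₂.Label ℓ in
      lab (d #1) ≡ R₂.e₀ᵛ × lab (d #2) ≡ R₂.e₁ᵛ × R₂.NormalPair (lab (d #3)) (lab (d #4))
    frame-mod2 = frame-exists₂

    frame-mod3 : Σ R₃.Label λ ℓ → let open R₃.Label ℓ in
      lab (d #1) ≡ R₃.e₀ᵛ × lab (d #2) ≡ R₃.e₁ᵛ × R₃.NormalPair (lab (d #3)) (lab (d #4))
    frame-mod3 = frame-exists₃

-- From residues to lattice points

∧-elim : ∀ {a b} → a ∧ b ≡ true → a ≡ true × b ≡ true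
∧-elim {true} e = refl , e

∧-intro : ∀ {a b} → a ≡ true → b ≡ true → a ∧ b ≡ true
∧-intro refl e = e

∨-elim : ∀ {a b} → a ∨ b ≡ true → a ≡ true ⊎ b ≡ true
∨-elim {true} e = inj₁ refl
∨-elim {false} e = inj₂ e

⇒-elim : ∀ {a b} → (a ⇒ b) ≡ true → a ≡ true → b ≡ true
⇒-elim e refl = e

not-elim : ∀ {a} → not a ≡ true → ¬ a ≡ true
not-elim {false} e ()

not-intro : ∀ {a} → ¬ a ≡ true → not a ≡ true
not-intro {false} h = refl
not-intro {true} h = ⊥-elim (h refl)

opaque
  unfolding _⊞₂_ _≟ᵇ₂_

  allF₂-elim : ∀ g → allF₂ g ≡ true → ∀ r → g r ≡ true
  allF₂-elim g e 𝟎 = proj₁ (∧-elim e)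
  allF₂-elim g e 𝟏 = proj₂ (∧-elim {g 𝟎} e)

  allV₂-elim : ∀ {f} → allV₂ f ≡ true → ∀ v → f v ≡ true
  allV₂-elim {f} h (vec a b c) = allF₂-elim (λ c → f (vec a b c))
    (allF₂-elim (λ b → allF₂ λ c → f (vec a b c)) (allF₂-elim (λ a → allF₂ λ b → allF₂ λ c → f (vec a b c)) h a) b) c

  allF₃-elim : ∀ g → allF₃ g ≡ true → ∀ r → g r ≡ true
  allF₃-elim g e 𝟎 = proj₁ (∧-elim e)
  allF₃-elim g e 𝟏 = proj₁ (∧-elim (proj₂ (∧-elim {g 𝟎} e)))
  allF₃-elim g e 𝟐 = proj₂ (∧-elim {g 𝟏} (proj₂ (∧-elim {g 𝟎} e)))

  allV₃-elim : ∀ {f} → allV₃ f ≡ true → ∀ v → f v ≡ true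
  allV₃-elim {f} h (vec a b c) = allF₃-elim (λ c → f (vec a b c))
    (allF₃-elim (λ b → allF₃ λ c → f (vec a b c)) (allF₃-elim (λ a → allF₃ λ b → allF₃ λ c → f (vec a b c)) h a) b) c

  anyᶠ-elim : ∀ {n} {f : Fin n → Bool} → anyᶠ f ≡ true → ∃[ i ] f i ≡ true
  anyᶠ-elim {suc n} {f} e with ∨-elim {f zero} e
  ... | inj₁ h = zero , h
  ... | inj₂ h = let (i , g) = anyᶠ-elim h in suc i , g

  allᶠ-intro : ∀ {n} {f : Fin n → Bool} → (∀ i → f i ≡ true) → allᶠ f ≡ true
  allᶠ-intro {zero} h = refl
  allᶠ-intro {suc n} h = ∧-intro (h zero) (allᶠ-intro (λ i → h (suc i)))

  anyˡ-elim : ∀ {X : Set} {P : X → Set} {f : X → Bool} {xs} → All P xs → anyˡ f xs ≡ true → ∃[ x ] (P x × f x ≡ true)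
  anyˡ-elim {f = f} {x ∷ xs} (px ∷ h) e with ∨-elim {f x} e
  ... | inj₁ g = x , px , g
  ... | inj₂ g = anyˡ-elim h g

  filterˡ-All : ∀ {X : Set} (f : X → Bool) xs → All (λ x → f x ≡ true) (filterˡ f xs)
  filterˡ-All f [] = []
  filterˡ-All f (x ∷ xs) with f x in eq
  ... | true = eq ∷ filterˡ-All f xs
  ... | false = filterˡ-All f xs

  ==ᶠ-refl : ∀ {n} (i : Fin n) → (i ==ᶠ i) ≡ true
  ==ᶠ-refl zero = refl
  ==ᶠ-refl (suc i) = ==ᶠ-refl i

  ==ᶠ-sound : ∀ {n} {i j : Fin n} → (i ==ᶠ j) ≡ true → i ≡ j
  ==ᶠ-sound {i = zero} {zero} e = refl
  ==ᶠ-sound {i = suc i} {suc j} e = cong suc (==ᶠ-sound e)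

any-case : ∀ {n} {f : Fin n → Bool} {X : Set} → anyᶠ f ≡ true → (∀ i → f i ≡ true → X) → X
any-case e k = let (i , h) = anyᶠ-elim e in k i h

∧-case : ∀ {a b} {X : Set} → a ∧ b ≡ true → (a ≡ true → b ≡ true → X) → X
∧-case e k = let (h , h′) = ∧-elim e in k h h′

≢-elim : ∀ {n} {i j : Fin n} → not (i ==ᶠ j) ≡ true → ¬ i ≡ j
≢-elim {i = i} h refl = not-elim h (==ᶠ-refl i)

==₂-sound : ∀ r s → (r ==₂ s) ≡ true → r ≡ s
==₂-sound 𝟎 𝟎 e = refl
==₂-sound 𝟏 𝟏 e = refl

==₂-refl : ∀ r → (r ==₂ r) ≡ true
==₂-refl 𝟎 = refl
==₂-refl 𝟏 = refl

==₃-sound : ∀ r s → (r ==₃ s) ≡ true → r ≡ s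
==₃-sound 𝟎 𝟎 e = refl
==₃-sound 𝟏 𝟏 e = refl
==₃-sound 𝟐 𝟐 e = refl

==₃-refl : ∀ r → (r ==₃ r) ≡ true
==₃-refl 𝟎 = refl
==₃-refl 𝟏 = refl
==₃-refl 𝟐 = refl

opaque
  unfolding _⊞₂_ _≟ᵇ₂_

  ≟ᵇ₂-sound : ∀ {u v} → (u ≟ᵇ₂ v) ≡ true → u ≡ v
  ≟ᵇ₂-sound {vec a b c} {vec x y z} e with ∧-elim {a ==₂ x} e
  ... | h₁ , h′ with ∧-elim {b ==₂ y} h′
  ... | h₂ , h₃ with ==₂-sound a x h₁ | ==₂-sound b y h₂ | ==₂-sound c z h₃
  ... | refl | refl | refl = refl

  ≟ᵇ₂-refl : ∀ {u v} → u ≡ v → (u ≟ᵇ₂ v) ≡ true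
  ≟ᵇ₂-refl {vec a b c} refl = ∧-intro (==₂-refl a) (∧-intro (==₂-refl b) (==₂-refl c))

  ≟ᵇ₃-sound : ∀ {u v} → (u ≟ᵇ₃ v) ≡ true → u ≡ v
  ≟ᵇ₃-sound {vec a b c} {vec x y z} e with ∧-elim {a ==₃ x} e
  ... | h₁ , h′ with ∧-elim {b ==₃ y} h′
  ... | h₂ , h₃ with ==₃-sound a x h₁ | ==₃-sound b y h₂ | ==₃-sound c z h₃
  ... | refl | refl | refl = refl

  ≟ᵇ₃-refl : ∀ {u v} → u ≡ v → (u ≟ᵇ₃ v) ≡ true
  ≟ᵇ₃-refl {vec a b c} refl = ∧-intro (==₃-refl a) (∧-intro (==₃-refl b) (==₃-refl c))

∨-introˡ : ∀ {a b} → a ≡ true → a ∨ b ≡ true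
∨-introˡ refl = refl

∨-introʳ : ∀ {a b} → b ≡ true → a ∨ b ≡ true
∨-introʳ {true} h = refl
∨-introʳ {false} h = h

-- A and B give coordinates modulo 3 of p i - p 0 and q j - q 0, and A′ and B′ coordinates modulo 2.
record Tables {p q} (cfg : Config p q) (A : Fin 5 → V₃) (B : Fin 4 → V₃) (A′ : Fin 5 → V₂) (B′ : Fin 4 → V₂) : Set where
  field
    eq₃⇒  : ∀ {i j k l} → A i ⊞₃ B j ≡ A k ⊞₃ B l → (p i +ᵖ q j) ≈ᶻ (p k +ᵖ q l)
    eq₃⇐  : ∀ {i j k l} → (p i +ᵖ q j) ≈ᶻ (p k +ᵖ q l) → A i ⊞₃ B j ≡ A k ⊞₃ B l
    eq₂⇒  : ∀ {i j k l} → A′ i ⊞₂ B′ j ≡ A′ k ⊞₂ B′ l → (p i +ᵖ q j) ≡ (p k +ᵖ q l) [mod + 2 ]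
    eq₂⇐  : ∀ {i j k l} → (p i +ᵖ q j) ≡ (p k +ᵖ q l) [mod + 2 ] → A′ i ⊞₂ B′ j ≡ A′ k ⊞₂ B′ l
    zero₃ : ∀ {i j k l m n} → A i ⊞₃ B j ⊞₃ (A k ⊞₃ B l) ⊞₃ (A m ⊞₃ B n) ≡ 0₃ →
            (p i +ᵖ q j +ᵖ (p k +ᵖ q l) +ᵖ (p m +ᵖ q n)) ≡ 0ᵖ [mod + 3 ]
    cap₃ : ∀ {i j k} → A i ⊞₃ A j ⊞₃ A k ≡ 0₃ → (p i +ᵖ p j +ᵖ p k) ≡ 0ᵖ [mod + 3 ]

module Sound {p q} (cfg : Config p q) {A B A′ B′} (T : Tables cfg A B A′ B′) where
  open Config cfg
  open Tables T
  open Modular cfg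
  open Kill A B
  open Parity A′ B′

  same : ∀ {i j k l} → eq₃ i j k l ≡ true → (p i +ᵖ q j) ≈ᶻ (p k +ᵖ q l)
  same {i} {j} {k} {l} h = eq₃⇒ {i} {j} {k} {l} (≟ᵇ₃-sound h)

  differ : ∀ {i j k l} → not (eq₃ i j k l) ≡ true → ¬ (p i +ᵖ q j) ≈ᶻ (p k +ᵖ q l)
  differ {i} {j} {k} {l} h e = not-elim h (≟ᵇ₃-refl (eq₃⇐ {i} {j} {k} {l} e))

  noCap-false : ¬ noCap A ≡ true
  noCap-false h with anyᶠ-elim h
  ... | i , hi with anyᶠ-elim hi
  ... | j , hj with ∧-elim {not (i ==ᶠ j)} hj
  ... | i≢j , h′ with ∨-elim {A i ≟ᵇ₃ A j} h′
  ... | inj₁ eq = ≢-elim i≢j (p-inj (λ t → cancelʳ (q zero t) (p i t) (p j t)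
                    (eq₃⇒ {i} {zero} {j} {zero} (cong (_⊞₃ B zero) (≟ᵇ₃-sound eq)) t)))
  ... | inj₂ h″ with anyᶠ-elim h″
  ... | k , hk with ∧-elim {not (i ==ᶠ k)} hk
  ... | i≢k , hk′ with ∧-elim {not (j ==ᶠ k)} hk′
  ... | j≢k , z = line (cap₃ {i} {j} {k} (≟ᵇ₃-sound z))
    where
    line : ¬ (p i +ᵖ p j +ᵖ p k) ≡ 0ᵖ [mod + 3 ]
    line (g by e) = cap g (≢-elim i≢j) (≢-elim i≢k) (≢-elim j≢k) (λ t → trans (e t) (ℤₚ.+-identityˡ _))

  IsEdge : Edge → Set
  IsEdge (m , n , s , r) = ¬ m ≡ n × (p m +ᵖ q r) ≈ᶻ (p n +ᵖ q s)

  edge-sound : ∀ {e} → isEdge A B e ≡ true → IsEdge e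
  edge-sound {m , n , s , r} h with ∧-elim {not (m ==ᶠ n)} h
  ... | m≢n , e = ≢-elim m≢n , eq₃⇒ {m} {r} {n} {s} (≟ᵇ₃-sound e)

  edges-sound : ∀ sr → All IsEdge (edges A B sr)
  edges-sound sr = All.map (λ {e} → edge-sound {e}) (filterˡ-All (isEdge A B) (candidates sr))
    where import Data.List.Relation.Unary.All as All

  edge-q : ∀ {m n s r} → IsEdge (m , n , s , r) → ¬ s ≡ r
  edge-q {m} {n} {s} (m≢n , e) refl = m≢n (p-inj (λ t → cancelʳ (q s t) (p m t) (p n t) (e t)))

  reverse-edge : ∀ {e} → IsEdge e → IsEdge (flip e)
  reverse-edge {m , n , s , r} (m≢n , e) = (λ x → m≢n (sym x)) , ≈-sym e

  sameEdge-sound : ∀ {e e′} → IsEdge e → IsEdge e′ → ¬ sameEdge e e′ ≡ true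
  sameEdge-sound {m , n , s , r} {m′ , n′ , s′ , r′} E@(m≢n , e) E′@(m′≢n′ , e′) h
    with ∨-elim {(s ==ᶠ s′) ∧ (r ==ᶠ r′) ∧ not (m ==ᶠ m′)} h
  ... | inj₁ h₁ = ∧-case {s ==ᶠ s′} h₁ λ a b → ∧-case {r ==ᶠ r′} b λ b c →
        caseQ (==ᶠ-sound a) (==ᶠ-sound b) (≢-elim c)
    where
    ring : ∀ m n s r m′ n′ → (m + n′) - (n + m′) ≡
      + 1 * ((m + r) - (n + s)) + (- + 1) * ((m′ + r) - (n′ + s))
    ring = solve-∀
    caseQ : s ≡ s′ → r ≡ r′ → ¬ m ≡ m′ → ⊥
    caseQ refl refl m≢m′ = p-para {m} {n′} {n} {m′} m≢n m≢m′
      (λ t → linear₂ (+ 1) (- + 1) (e t) (e′ t) (ring (p m t) (p n t) (q s t) (q r t) (p m′ t) (p n′ t)))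
  ... | inj₂ h₂ with ∨-elim {(m ==ᶠ m′) ∧ (n ==ᶠ n′) ∧ not (s ==ᶠ s′)} h₂
  ... | inj₁ h₁ = ∧-case {m ==ᶠ m′} h₁ λ a b → ∧-case {n ==ᶠ n′} b λ b c →
        caseP (==ᶠ-sound a) (==ᶠ-sound b) (≢-elim c)
    where
    ring : ∀ m n s r s′ r′ → (s + r′) - (r + s′) ≡
      (- + 1) * ((m + r) - (n + s)) + (+ 1) * ((m + r′) - (n + s′))
    ring = solve-∀
    caseP : m ≡ m′ → n ≡ n′ → ¬ s ≡ s′ → ⊥
    caseP refl refl s≢s′ = q-para {s} {r′} {r} {s′} (edge-q {m} {n} {s} {r} E) s≢s′
      (λ t → linear₂ (- + 1) (+ 1) (e t) (e′ t) (ring (p m t) (p n t) (q s t) (q r t) (q s′ t) (q r′ t)))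
  ... | inj₂ h₁ = ∧-case {m ==ᶠ n′} h₁ λ a b → ∧-case {n ==ᶠ m′} b λ b c →
        caseP (==ᶠ-sound a) (==ᶠ-sound b) (≢-elim c)
    where
    ring : ∀ m n s r s′ r′ → (s + s′) - (r + r′) ≡
      (- + 1) * ((m + r) - (n + s)) + (- + 1) * ((n + r′) - (m + s′))
    ring = solve-∀
    caseP : m ≡ n′ → n ≡ m′ → ¬ s ≡ r′ → ⊥
    caseP refl refl s≢r′ = q-para {s} {s′} {r} {r′} (edge-q {m} {n} {s} {r} E) s≢r′
      (λ t → linear₂ (- + 1) (- + 1) (e t) (e′ t) (ring (p m t) (p n t) (q s t) (q r t) (q s′ t) (q r′ t)))

  bad-sound : ∀ {es} → All IsEdge es → ¬ bad es ≡ true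
  bad-sound {es} hes h with anyˡ-elim {f = λ e → anyˡ (sameEdge e) es} hes h
  ... | e , he , h′ with anyˡ-elim {f = sameEdge e} hes h′
  ... | e′ , he′ , h″ = sameEdge-sound {e} {e′} he he′ h″

  -- Two distinct parallel segments with even difference vectors would span a zonotope of length 3.
  clash : ∀ i j k l m n m′ n′ → eq₂ i j k l ≡ true → not (eq₃ i j k l) ≡ true → ¬ (p i +ᵖ q j) ≈ᶻ (p m +ᵖ q n) →
    ¬ ((p i +ᵖ q j) +ᵖ (p m′ +ᵖ q n′)) ≈ᶻ ((p m +ᵖ q n) +ᵖ (p k +ᵖ q l))
  clash i j k l m n m′ n′ par d₁ d₂ e
    with mod2 (S-sum i j) (S-sum k l) (S-sum m n) (S-sum m′ n′) (eq₂⇒ {i} {j} {k} {l} (≟ᵇ₂-sound par)) e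
  ... | inj₁ x≈y = differ {i} {j} {k} {l} d₁ x≈y
  ... | inj₂ x≈x′ = d₂ x≈x′

  inc-sound : ∀ {e} → IsEdge e → ¬ inc e ≡ true
  inc-sound {m , n , s , r} (_ , e) h = not-elim h (≟ᵇ₂-refl (eq₂⇐ {m} {r} {n} {s}
    ((λ _ → + 0) by λ t → trans (e t) (sym (ℤₚ.+-identityʳ (p n t + q s t))))))

  star-from : ∀ m n s r → IsEdge (m , n , s , r) → ∀ c d → eq₂ m d c s ≡ true → not (eq₃ m d c s) ≡ true → ⊥
  star-from m n s r (m≢n , e) c d h₂ h₃ = clash m d c s n d c r h₂ h₃
    (λ f → m≢n (p-inj (λ t → cancelʳ (q d t) (p m t) (p n t) (f t))))
    (λ t → linear₁ (+ 1) (e t) (ring (p m t) (p n t) (p c t) (q s t) (q r t) (q d t)))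
    where
    ring : ∀ m n c s r d → ((m + d) + (c + r)) - ((n + d) + (c + s)) ≡ + 1 * ((m + r) - (n + s))
    ring = solve-∀

  star-sound : ∀ {e} → IsEdge e → ¬ star e ≡ true
  star-sound {m , n , s , r} E h with anyᶠ-elim h
  ... | c , hc with anyᶠ-elim hc
  ... | d , hd with ∨-elim {eq₂ m d c s ∧ not (eq₃ m d c s)} hd
  ... | inj₁ g = ∧-case {eq₂ m d c s} g λ g₂ g₃ → star-from m n s r E c d g₂ g₃
  ... | inj₂ g = ∧-case {eq₂ n d c r} g λ g₂ g₃ → star-from n m r s (reverse-edge {m , n , s , r} E) c d g₂ g₃

  twins-sound : ∀ {e e′} → IsEdge e → IsEdge e′ → ¬ twins e e′ ≡ true
  twins-sound {m , n , s , r} {m′ , n′ , s′ , r′} (_ , e) (_ , e′) h with ∧-elim {eq₂ m s′ n r′} h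
  ... | h₂ , h′ with ∧-elim {not (eq₃ m s′ n r′)} h′
  ... | h₃ , h₃′ = clash m s′ n r′ m′ s n′ r h₂ h₃ (differ {m} {s′} {m′} {s} h₃′)
    (λ t → linear₂ (+ 1) (- + 1) (e t) (e′ t) (ring (p m t) (p n t) (q s t) (q r t) (p m′ t) (p n′ t) (q s′ t) (q r′ t)))
    where
    ring : ∀ m n s r m′ n′ s′ r′ → ((m + s′) + (n′ + r)) - ((m′ + s) + (n + r′)) ≡
      + 1 * ((m + r) - (n + s)) + (- + 1) * ((m′ + r′) - (n′ + s′))
    ring = solve-∀

  middle-sound : ∀ i j k l m n → middle i j k l m n ≡ true →
    eq₂ i j k l ≡ true × not (eq₃ i j k l) ≡ true ×
    ((p i +ᵖ q j) +ᵖ (p k +ᵖ q l)) ≈ᶻ ((p m +ᵖ q n) +ᵖ (p m +ᵖ q n))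
  middle-sound i j k l m n h with ∧-elim {eq₂ i j k l} h
  ... | h₂ , h′ with ∧-elim {not (eq₃ i j k l)} h′
  ... | h₃ , z = h₂ , h₃ , midpoint (S-sum i j) (S-sum k l) (S-sum m n) (eq₂⇒ {i} {j} {k} {l} (≟ᵇ₂-sound h₂))
                   (zero₃ {i} {j} {k} {l} {m} {n} (≟ᵇ₃-sound z))

  MiddleOf : Fin 5 → Fin 4 → Fin 5 → Fin 4 → Fin 5 → Fin 4 → Set
  MiddleOf i j k l m n = eq₂ i j k l ≡ true × not (eq₃ i j k l) ≡ true ×
    ((p i +ᵖ q j) +ᵖ (p k +ᵖ q l)) ≈ᶻ ((p m +ᵖ q n) +ᵖ (p m +ᵖ q n))

  longP-clash : ∀ {m n s r} → IsEdge (m , n , s , r) → ∀ z i j → MiddleOf i j n z m z → ¬ not (eq₃ i j m s) ≡ true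
  longP-clash {m} {n} {s} {r} (_ , e) z i j (h₂ , h₃ , f) h₃′ = clash i j n z m s n r h₂ h₃ (differ {i} {j} {m} {s} h₃′)
    (λ t → identity (p m t) (p n t) (q s t) (q r t) (p i t) (q j t) (q z t) (e t) (f t))
    where
    ring : ∀ m n s r i j z → ((i + j) + (n + r)) - ((m + s) + (n + z)) ≡
      + 1 * ((m + r) - (n + s)) + + 1 * (((i + j) + (n + z)) - ((m + z) + (m + z)))
    ring = solve-∀
    identity : ∀ m n s r i j z → m + r ≡ n + s → (i + j) + (n + z) ≡ (m + z) + (m + z) →
      (i + j) + (n + r) ≡ (m + s) + (n + z)
    identity m n s r i j z e f = linear₂ (+ 1) (+ 1) e f (ring m n s r i j z)

  longQ-clash : ∀ {m n s r} → IsEdge (m , n , s , r) → ∀ c i j → MiddleOf i j c r c s → ¬ not (eq₃ i j m s) ≡ true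
  longQ-clash {m} {n} {s} {r} (_ , e) c i j (h₂ , h₃ , f) h₃′ = clash i j c r m s n r h₂ h₃ (differ {i} {j} {m} {s} h₃′)
    (λ t → identity (p m t) (p n t) (q s t) (q r t) (p i t) (q j t) (p c t) (e t) (f t))
    where
    ring : ∀ m n s r i j c → ((i + j) + (n + r)) - ((m + s) + (c + r)) ≡
      (- + 1) * ((m + r) - (n + s)) + + 1 * (((i + j) + (c + r)) - ((c + s) + (c + s)))
    ring = solve-∀
    identity : ∀ m n s r i j c → m + r ≡ n + s → (i + j) + (c + r) ≡ (c + s) + (c + s) →
      (i + j) + (n + r) ≡ (m + s) + (c + r)
    identity m n s r i j c e f = linear₂ (- + 1) (+ 1) e f (ring m n s r i j c)

  shiftP-clash : ∀ b e z i j z′ → MiddleOf i j b z e z → not (eq₃ e z i j) ≡ true →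
    eq₂ e z b z′ ≡ true → ¬ not (eq₃ e z b z′) ≡ true
  shiftP-clash b e z i j z′ (_ , _ , f) h₃′ h₂ h₃ = clash e z b z′ i j e z′ h₂ h₃ (differ {e} {z} {i} {j} h₃′)
    (λ t → identity (p b t) (p e t) (q z t) (q z′ t) (p i t) (q j t) (f t))
    where
    ring : ∀ b e z z′ i j → ((e + z) + (e + z′)) - ((i + j) + (b + z′)) ≡
      (- + 1) * (((i + j) + (b + z)) - ((e + z) + (e + z)))
    ring = solve-∀
    identity : ∀ b e z z′ i j → (i + j) + (b + z) ≡ (e + z) + (e + z) →
      (e + z) + (e + z′) ≡ (i + j) + (b + z′)
    identity b e z z′ i j f = linear₁ (- + 1) f (ring b e z z′ i j)

  shiftQ-clash : ∀ x y c i j c′ → MiddleOf i j c x c y → not (eq₃ c y i j) ≡ true →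
    eq₂ c y c′ x ≡ true → ¬ not (eq₃ c y c′ x) ≡ true
  shiftQ-clash x y c i j c′ (_ , _ , f) h₃′ h₂ h₃ = clash c y c′ x i j c′ y h₂ h₃ (differ {c} {y} {i} {j} h₃′)
    (λ t → identity (q x t) (q y t) (p c t) (p c′ t) (p i t) (q j t) (f t))
    where
    ring : ∀ x y c c′ i j → ((c + y) + (c′ + y)) - ((i + j) + (c′ + x)) ≡
      (- + 1) * (((i + j) + (c + x)) - ((c + y) + (c + y)))
    ring = solve-∀
    identity : ∀ x y c c′ i j → (i + j) + (c + x) ≡ (c + y) + (c + y) →
      (c + y) + (c′ + y) ≡ (i + j) + (c′ + x)
    identity x y c c′ i j f = linear₁ (- + 1) f (ring x y c c′ i j)

  longP-sound : ∀ {e} → IsEdge e → ¬ longP e ≡ true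
  longP-sound {m , n , s , r} E h =
    any-case h λ z h → any-case h λ i h → any-case h λ j h →
        ∧-case {middle i j n z m z} h λ mid h → longP-clash {m} {n} {s} {r} E z i j (middle-sound i j n z m z mid) h

  longQ-sound : ∀ {e} → IsEdge e → ¬ longQ e ≡ true
  longQ-sound {m , n , s , r} E h =
    any-case h λ c h → any-case h λ i h → any-case h λ j h →
        ∧-case {middle i j c r c s} h λ mid h → longQ-clash {m} {n} {s} {r} E c i j (middle-sound i j c r c s mid) h

  shiftP-sound : ¬ shiftP ≡ true
  shiftP-sound h =
    any-case h λ b h → any-case h λ e h → any-case h λ z h →
        any-case h λ i h → any-case h λ j h → ∧-case {middle i j b z e z} h λ mid h →
        ∧-case {not (eq₃ e z i j)} h λ h₃′ h → any-case h λ z′ h → ∧-case {eq₂ e z b z′} h λ h₂ h₃ →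
        shiftP-clash b e z i j z′ (middle-sound i j b z e z mid) h₃′ h₂ h₃

  shiftQ-sound : ¬ shiftQ ≡ true
  shiftQ-sound h =
    any-case h λ x h → any-case h λ y h → any-case h λ c h →
        any-case h λ i h → any-case h λ j h → ∧-case {middle i j c x c y} h λ mid h →
        ∧-case {not (eq₃ c y i j)} h λ h₃′ h → any-case h λ c′ h → ∧-case {eq₂ c y c′ x} h λ h₂ h₃ →
        shiftQ-clash x y c i j c′ (middle-sound i j c x c y mid) h₃′ h₂ h₃

  killed-sound : ∀ {es} → All IsEdge es → ¬ killed es ≡ true
  killed-sound {es} hes h with ∨-elim {anyˡ inc es} h
  ... | inj₁ g = let (e , he , g′) = anyˡ-elim {f = inc} hes g in inc-sound {e} he g′
  ... | inj₂ h with ∨-elim {anyˡ star es} h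
  ... | inj₁ g = let (e , he , g′) = anyˡ-elim {f = star} hes g in star-sound {e} he g′
  ... | inj₂ h with ∨-elim {anyˡ (λ e → anyˡ (λ e′ → twins e e′ ∨ twins e (flip e′)) es) es} h
  ... | inj₁ g = let (e , he , g′) = anyˡ-elim {f = λ e → anyˡ (λ e′ → twins e e′ ∨ twins e (flip e′)) es} hes g
                     (e′ , he′ , g″) = anyˡ-elim {f = λ e′ → twins e e′ ∨ twins e (flip e′)} hes g′ in both e e′ he he′ g″
    where
    both : ∀ e e′ → IsEdge e → IsEdge e′ → ¬ (twins e e′ ∨ twins e (flip e′)) ≡ true
    both e e′ he he′ h with ∨-elim {twins e e′} h
    ... | inj₁ g = twins-sound {e} {e′} he he′ g
    ... | inj₂ g = twins-sound {e} {flip e′} he (reverse-edge {e′} he′) g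
  ... | inj₂ h with ∨-elim {anyˡ (λ e → longP e ∨ longP (flip e) ∨ longQ e ∨ longQ (flip e)) es} h
  ... | inj₁ g = let (e , he , g′) = anyˡ-elim {f = λ e → longP e ∨ longP (flip e) ∨ longQ e ∨ longQ (flip e)} hes g in long e he g′
    where
    long : ∀ e → IsEdge e → ¬ (longP e ∨ longP (flip e) ∨ longQ e ∨ longQ (flip e)) ≡ true
    long e he h with ∨-elim {longP e} h
    ... | inj₁ g = longP-sound {e} he g
    ... | inj₂ h with ∨-elim {longP (flip e)} h
    ... | inj₁ g = longP-sound {flip e} (reverse-edge {e} he) g
    ... | inj₂ h with ∨-elim {longQ e} h
    ... | inj₁ g = longQ-sound {e} he g
    ... | inj₂ g = longQ-sound {flip e} (reverse-edge {e} he) g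
  ... | inj₂ h with ∨-elim {shiftP} h
  ... | inj₁ g = shiftP-sound g
  ... | inj₂ g = shiftQ-sound g

opaque
  unfolding _⊞₂_
  ⊞₂-zip : ∀ u v → u ⊞₂ v ≡ zipV _+₂_ u v
  ⊞₂-zip u v = refl
  ⊞₃-zip : ∀ u v → u ⊞₃ v ≡ zipV _+₃_ u v
  ⊞₃-zip u v = refl

+₂-identityʳ : ∀ r → r +₂ 𝟎 ≡ r
+₂-identityʳ 𝟎 = refl
+₂-identityʳ 𝟏 = refl

+₃-identityʳ : ∀ r → r +₃ 𝟎 ≡ r
+₃-identityʳ 𝟎 = refl
+₃-identityʳ 𝟏 = refl
+₃-identityʳ 𝟐 = refl

⊞₂-identityʳ : ∀ u → u ⊞₂ 0₂ ≡ u
⊞₂-identityʳ (vec a b c) = trans (⊞₂-zip _ _) (coord-ext λ { zero → +₂-identityʳ a ; (suc zero) → +₂-identityʳ b ; (suc (suc zero)) → +₂-identityʳ c })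

⊞₂-identityˡ : ∀ u → 0₂ ⊞₂ u ≡ u
⊞₂-identityˡ (vec a b c) = ⊞₂-zip _ _

⊞₃-identityʳ : ∀ u → u ⊞₃ 0₃ ≡ u
⊞₃-identityʳ (vec a b c) = trans (⊞₃-zip _ _) (coord-ext λ { zero → +₃-identityʳ a ; (suc zero) → +₃-identityʳ b ; (suc (suc zero)) → +₃-identityʳ c })

⊞₃-identityˡ : ∀ u → 0₃ ⊞₃ u ≡ u
⊞₃-identityˡ (vec a b c) = ⊞₃-zip _ _

module Coordinates {p q} (cfg : Config p q) where
  open Config cfg
  open Modular cfg
  module R₂ = Residue residues₂
  module R₃ = Residue residues₃

  dq : Fin 4 → Pt
  dq j = q j -ᵖ q zero

  private
    shift : ∀ {n} i j k l → (d i +ᵖ dq j) ≡ (d k +ᵖ dq l) [mod n ] → (p i +ᵖ q j) ≡ (p k +ᵖ q l) [mod n ]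
    shift {n} i j k l (m by e) = m by λ t → linear₁ (+ 1) (e t) (ring n (p i t) (q j t) (p k t) (q l t) (p zero t) (q zero t) (m t))
      where
      ring : ∀ n i j k l a b m → (i + j) - ((k + l) + n * m) ≡
        + 1 * (((i - a) + (j - b)) - (((k - a) + (l - b)) + n * m))
      ring = solve-∀

    unshift : ∀ {n} i j k l → (p i +ᵖ q j) ≡ (p k +ᵖ q l) [mod n ] → (d i +ᵖ dq j) ≡ (d k +ᵖ dq l) [mod n ]
    unshift {n} i j k l (m by e) = m by λ t → linear₁ (+ 1) (e t) (ring n (p i t) (q j t) (p k t) (q l t) (p zero t) (q zero t) (m t))
      where
      ring : ∀ n i j k l a b m → ((i - a) + (j - b)) - (((k - a) + (l - b)) + n * m) ≡
        + 1 * ((i + j) - ((k + l) + n * m))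
      ring = solve-∀

    ≈⇒mod : ∀ {n x y} → x ≈ᶻ y → x ≡ y [mod n ]
    ≈⇒mod e = assemble (λ t → c-refl (e t))

  ℓ₂ : R₂.Label
  ℓ₂ = proj₁ frame-mod2
  ℓ₃ : R₃.Label
  ℓ₃ = proj₁ frame-mod3

  lab₂ : Pt → V₂
  lab₂ = R₂.Label.lab ℓ₂
  lab₃ : Pt → V₃
  lab₃ = R₃.Label.lab ℓ₃

  u₂ v₂ : V₂
  u₂ = lab₂ (d #3)
  v₂ = lab₂ (d #4)
  u₃ v₃ : V₃
  u₃ = lab₃ (d #3)
  v₃ = lab₃ (d #4)

  lab₂-0 : ∀ {x} → x ≈ᶻ 0ᵖ → lab₂ x ≡ 0₂
  lab₂-0 e = trans (R₂.Label.lab-≈ ℓ₂ e) (R₂.Label.lab-0 ℓ₂)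
  lab₃-0 : ∀ {x} → x ≈ᶻ 0ᵖ → lab₃ x ≡ 0₃
  lab₃-0 e = trans (R₃.Label.lab-≈ ℓ₃ e) (R₃.Label.lab-0 ℓ₃)

  lab₂-+ : ∀ x y → lab₂ (x +ᵖ y) ≡ lab₂ x ⊞₂ lab₂ y
  lab₂-+ x y = trans (R₂.Label.lab-+ ℓ₂ x y) (sym (⊞₂-zip _ _))
  lab₃-+ : ∀ x y → lab₃ (x +ᵖ y) ≡ lab₃ x ⊞₃ lab₃ y
  lab₃-+ x y = trans (R₃.Label.lab-+ ℓ₃ x y) (sym (⊞₃-zip _ _))

  A-lab : ∀ i → tab₃ u₃ v₃ i ≡ lab₃ (d i)
  A-lab #0 = sym (lab₃-0 (λ t → ℤₚ.+-inverseʳ (p zero t)))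
  A-lab #1 = sym (proj₁ (proj₂ frame-mod3))
  A-lab #2 = sym (proj₁ (proj₂ (proj₂ frame-mod3)))
  A-lab #3 = refl
  A-lab #4 = refl

  A′-lab : ∀ i → tab₂ u₂ v₂ i ≡ lab₂ (d i)
  A′-lab #0 = sym (lab₂-0 (λ t → ℤₚ.+-inverseʳ (p zero t)))
  A′-lab #1 = sym (proj₁ (proj₂ frame-mod2))
  A′-lab #2 = sym (proj₁ (proj₂ (proj₂ frame-mod2)))
  A′-lab #3 = refl
  A′-lab #4 = refl

  normal₃-true : normal₃ u₃ v₃ ≡ true
  normal₃-true = go (proj₂ (proj₂ (proj₂ frame-mod3)))
    where
    go : ∀ {u v} → R₃.NormalPair u v → normal₃ u v ≡ true
    go (inj₁ e) = ∨-introˡ (≟ᵇ₃-refl e)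
    go {u} (inj₂ (e , f)) = ∨-introʳ {u ≟ᵇ₃ vec 𝟎 𝟎 𝟏} (∧-intro (trans (cong (_==₃ 𝟎) e) refl)
      ([ (λ h → ∨-introˡ (≟ᵇ₃-refl h)) , (λ h → ∨-introʳ (trans (cong (_==₃ 𝟎) h) refl)) ]′ f))

  normal₂-true : normal₂ u₂ v₂ ≡ true
  normal₂-true = go (proj₂ (proj₂ (proj₂ frame-mod2)))
    where
    go : ∀ {u v} → R₂.NormalPair u v → normal₂ u v ≡ true
    go (inj₁ e) = ∨-introˡ (≟ᵇ₂-refl e)
    go {u} (inj₂ (e , f)) = ∨-introʳ {u ≟ᵇ₂ vec 𝟎 𝟎 𝟏} (∧-intro (trans (cong (_==₂ 𝟎) e) refl)
      ([ (λ h → ∨-introˡ (≟ᵇ₂-refl h)) , (λ h → ∨-introʳ (trans (cong (_==₂ 𝟎) h) refl)) ]′ f))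

  sum₃ : ∀ {B : Fin 4 → V₃} i j → B j ≡ lab₃ (dq j) → tab₃ u₃ v₃ i ⊞₃ B j ≡ lab₃ (d i +ᵖ dq j)
  sum₃ i j e = trans (cong₂ _⊞₃_ (A-lab i) e) (sym (lab₃-+ (d i) (dq j)))

  sum₂ : ∀ {B : Fin 4 → V₂} i j → B j ≡ lab₂ (dq j) → tab₂ u₂ v₂ i ⊞₂ B j ≡ lab₂ (d i +ᵖ dq j)
  sum₂ i j e = trans (cong₂ _⊞₂_ (A′-lab i) e) (sym (lab₂-+ (d i) (dq j)))

  same₃ : ∀ {B : Fin 4 → V₃} i j k l → B j ≡ lab₃ (dq j) → B l ≡ lab₃ (dq l) →
    tab₃ u₃ v₃ i ⊞₃ B j ≡ tab₃ u₃ v₃ k ⊞₃ B l → (p i +ᵖ q j) ≈ᶻ (p k +ᵖ q l)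
  same₃ {B} i j k l bj bl e = mod3 (S-sum i j) (S-sum k l) (shift i j k l
    (R₃.Label.lab-inj ℓ₃ (trans (sym (sum₃ {B} i j bj)) (trans e (sum₃ {B} k l bl)))))

  tables : ∀ (B : Fin 4 → V₃) (B′ : Fin 4 → V₂) → (∀ j → B j ≡ lab₃ (dq j)) → (∀ j → B′ j ≡ lab₂ (dq j)) → Tables cfg (tab₃ u₃ v₃) B (tab₂ u₂ v₂) B′
  tables B B′ hB hB′ = record
    { eq₃⇒ = λ {i} {j} {k} {l} → same₃ {B} i j k l (hB j) (hB l)
    ; eq₃⇐ = λ {i} {j} {k} {l} e → trans (sum₃ {B} i j (hB j)) (trans (R₃.Label.lab-mod ℓ₃ (unshift i j k l (≈⇒mod e)))
               (sym (sum₃ {B} k l (hB l))))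
    ; eq₂⇒ = λ {i} {j} {k} {l} e → shift i j k l (R₂.Label.lab-inj ℓ₂ (trans (sym (sum₂ {B′} i j (hB′ j))) (trans e (sum₂ {B′} k l (hB′ l)))))
    ; eq₂⇐ = λ {i} {j} {k} {l} e → trans (sum₂ {B′} i j (hB′ j)) (trans (R₂.Label.lab-mod ℓ₂ (unshift i j k l e))
               (sym (sum₂ {B′} k l (hB′ l))))
    ; zero₃ = λ {i} {j} {k} {l} {m} {n} e → zero-sum i j k l m n
        (R₃.Label.lab-inj ℓ₃ {y = 0ᵖ} (trans (lab₃-+ (d i +ᵖ dq j +ᵖ (d k +ᵖ dq l)) (d m +ᵖ dq n))
          (trans (cong₂ _⊞₃_ (trans (lab₃-+ (d i +ᵖ dq j) (d k +ᵖ dq l)) (cong₂ _⊞₃_ (sym (sum₃ {B} i j (hB j))) (sym (sum₃ {B} k l (hB l)))))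
            (sym (sum₃ {B} m n (hB n)))) (trans e (sym (lab₃-0 (λ _ → refl)))))))
    ; cap₃ = λ {i} {j} {k} e → cap-sum i j k
        (R₃.Label.lab-inj ℓ₃ {y = 0ᵖ} (trans (lab₃-+ (d i +ᵖ d j) (d k))
          (trans (cong₂ _⊞₃_ (trans (lab₃-+ (d i) (d j)) (cong₂ _⊞₃_ (sym (A-lab i)) (sym (A-lab j)))) (sym (A-lab k)))
            (trans e (sym (lab₃-0 (λ _ → refl)))))))
    }
    where
    zero-sum : ∀ i j k l m n → (d i +ᵖ dq j +ᵖ (d k +ᵖ dq l) +ᵖ (d m +ᵖ dq n)) ≡ 0ᵖ [mod + 3 ] →
      (p i +ᵖ q j +ᵖ (p k +ᵖ q l) +ᵖ (p m +ᵖ q n)) ≡ 0ᵖ [mod + 3 ]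
    zero-sum i j k l m n (w by e) = (p zero +ᵖ q zero +ᵖ w) by λ t → linear₁ (+ 1) (e t)
      (ring (p i t) (q j t) (p k t) (q l t) (p m t) (q n t) (p zero t) (q zero t) (w t))
      where
      ring : ∀ i j k l m n a b w → ((i + j) + (k + l) + (m + n)) - (+ 0 + + 3 * (a + b + w)) ≡
        + 1 * ((((i - a) + (j - b)) + ((k - a) + (l - b)) + ((m - a) + (n - b))) - (+ 0 + + 3 * w))
      ring = solve-∀
    cap-sum : ∀ i j k → (d i +ᵖ d j +ᵖ d k) ≡ 0ᵖ [mod + 3 ] → (p i +ᵖ p j +ᵖ p k) ≡ 0ᵖ [mod + 3 ]
    cap-sum i j k (w by e) = (p zero +ᵖ w) by λ t → linear₁ (+ 1) (e t) (ring (p i t) (p j t) (p k t) (p zero t) (w t))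
      where
      ring : ∀ i j k a w → (i + j + k) - (+ 0 + + 3 * (a + w)) ≡
        + 1 * (((i - a) + (j - a) + (k - a)) - (+ 0 + + 3 * w))
      ring = solve-∀

  dq-mod3 : ∀ {i j} → lab₃ (dq i) ≡ lab₃ (dq j) → i ≡ j
  dq-mod3 {i} {j} e = q-mod3 (unbase (R₃.Label.lab-inj ℓ₃ e))
    where
    unbase : dq i ≡ dq j [mod + 3 ] → q i ≡ q j [mod + 3 ]
    unbase (k by e) = k by λ t → linear₁ (+ 1) (e t) (ring (q i t) (q j t) (q zero t) (k t))
      where
      ring : ∀ x y o k → x - (y + + 3 * k) ≡ + 1 * ((x - o) - ((y - o) + + 3 * k))
      ring = solve-∀

  dq-mod2 : ∀ {i j} → lab₂ (dq i) ≡ lab₂ (dq j) → i ≡ j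
  dq-mod2 {i} {j} e = q-mod2 (unbase (R₂.Label.lab-inj ℓ₂ e))
    where
    unbase : dq i ≡ dq j [mod + 2 ] → q i ≡ q j [mod + 2 ]
    unbase (k by e) = k by λ t → linear₁ (+ 1) (e t) (ring (q i t) (q j t) (q zero t) (k t))
      where
      ring : ∀ x y o k → x - (y + + 2 * k) ≡ + 1 * ((x - o) - ((y - o) + + 2 * k))
      ring = solve-∀

  dq0₃ : 0₃ ≡ lab₃ (dq #0)
  dq0₃ = sym (lab₃-0 (λ t → ℤₚ.+-inverseʳ (q zero t)))
  dq0₂ : 0₂ ≡ lab₂ (dq #0)
  dq0₂ = sym (lab₂-0 (λ t → ℤₚ.+-inverseʳ (q zero t)))

  B₃ : Fin 4 → V₃
  B₃ = four 0₃ (lab₃ (dq #1)) (lab₃ (dq #2)) (lab₃ (dq #3))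
  B₂ : Fin 4 → V₂
  B₂ = four 0₂ (lab₂ (dq #1)) (lab₂ (dq #2)) (lab₂ (dq #3))

  B₃-lab : ∀ j → B₃ j ≡ lab₃ (dq j)
  B₃-lab #0 = dq0₃
  B₃-lab #1 = refl
  B₃-lab #2 = refl
  B₃-lab #3 = refl

  B₂-lab : ∀ j → B₂ j ≡ lab₂ (dq j)
  B₂-lab #0 = dq0₂
  B₂-lab #1 = refl
  B₂-lab #2 = refl
  B₂-lab #3 = refl

  T : Tables cfg (tab₃ u₃ v₃) B₃ (tab₂ u₂ v₂) B₂
  T = tables B₃ B₂ B₃-lab B₂-lab

  guard₃ : normal₃ u₃ v₃ ∧ not (noCap (tab₃ u₃ v₃)) ≡ true
  guard₃ = ∧-intro normal₃-true (not-intro (Sound.noCap-false cfg T))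

  CommonEdge : Set
  CommonEdge = ∃[ m ] ∃[ n ] ∃[ s ] ∃[ r ] (¬ m ≡ n × (p m +ᵖ q r) ≈ᶻ (p n +ᵖ q s))

  edgesAt-sound : ∀ {B : Fin 4 → V₃} s r → B s ≡ lab₃ (dq s) → B r ≡ lab₃ (dq r) → edgesAt (tab₃ u₃ v₃) B s r ≡ true → CommonEdge
  edgesAt-sound {B} s r bs br h =
    any-case h λ m h → any-case h λ n h → ∧-case {not (m ==ᶠ n)} h λ m≢n h →
    m , n , s , r , ≢-elim m≢n , same₃ {B} m r n s br bs (≟ᵇ₃-sound h)

  private
    A₃ : Fin 5 → V₃
    A₃ = tab₃ u₃ v₃
    A₂ : Fin 5 → V₂
    A₂ = tab₂ u₂ v₂
    x₃ y₃ z₃ : V₃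
    x₃ = lab₃ (dq #1)
    y₃ = lab₃ (dq #2)
    z₃ = lab₃ (dq #3)

    ThirdPoint SecondPoint FirstPoint : V₃ → V₃ → V₃ → Bool
    ThirdPoint x y z = let B = four 0₃ x y z in (z ≟ᵇ₃ 0₃) ∨ (z ≟ᵇ₃ x) ∨ (z ≟ᵇ₃ y) ∨
         edgesAt A₃ B #0 #3 ∨ edgesAt A₃ B #1 #3 ∨ edgesAt A₃ B #2 #3
    SecondPoint _ x y = let B = four 0₃ x y y in (y ≟ᵇ₃ 0₃) ∨ (y ≟ᵇ₃ x) ∨ edgesAt A₃ B #0 #2 ∨ edgesAt A₃ B #1 #2 ∨ allV₃ (ThirdPoint x y)
    FirstPoint _ _ x = let B = four 0₃ x x x in (x ≟ᵇ₃ 0₃) ∨ edgesAt A₃ B #0 #1 ∨ allV₃ (SecondPoint x x)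

    distinct : ∀ {i j} → ¬ i ≡ j → {w w′ : V₃} → w ≡ lab₃ (dq i) → w′ ≡ lab₃ (dq j) → ¬ (w ≟ᵇ₃ w′) ≡ true
    distinct i≢j a b h = i≢j (dq-mod3 (trans (sym a) (trans (≟ᵇ₃-sound h) b)))

    orElse : ∀ {a b} {X : Set} → (a ≡ true → X) → (b ≡ true → X) → a ∨ b ≡ true → X
    orElse {a} f g h = [ f , g ]′ (∨-elim {a} h)

    never : ∀ {a} {X : Set} → ¬ a ≡ true → a ≡ true → X
    never n h = ⊥-elim (n h)

    pick₃ : ThirdPoint x₃ y₃ z₃ ≡ true → CommonEdge
    pick₃ = orElse (never (distinct {#3} {#0} (λ ()) refl dq0₃))
      (orElse (never (distinct {#3} {#1} (λ ()) refl refl)) (orElse (never (distinct {#3} {#2} (λ ()) refl refl))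
      (orElse (edgesAt-sound {four 0₃ x₃ y₃ z₃} #0 #3 dq0₃ refl)
      (orElse (edgesAt-sound {four 0₃ x₃ y₃ z₃} #1 #3 refl refl) (edgesAt-sound {four 0₃ x₃ y₃ z₃} #2 #3 refl refl)))))

    pick₂ : SecondPoint x₃ x₃ y₃ ≡ true → CommonEdge
    pick₂ = orElse (never (distinct {#2} {#0} (λ ()) refl dq0₃)) (orElse (never (distinct {#2} {#1} (λ ()) refl refl))
      (orElse (edgesAt-sound {four 0₃ x₃ y₃ y₃} #0 #2 dq0₃ refl) (orElse (edgesAt-sound {four 0₃ x₃ y₃ y₃} #1 #2 refl refl)
      (λ h → pick₃ (allV₃-elim {ThirdPoint x₃ y₃} h z₃)))))

    pick₁ : FirstPoint x₃ x₃ x₃ ≡ true → CommonEdge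
    pick₁ = orElse (never (distinct {#1} {#0} (λ ()) refl dq0₃)) (orElse (edgesAt-sound {four 0₃ x₃ x₃ x₃} #0 #1 dq0₃ refl)
      (λ h → pick₂ (allV₃-elim {SecondPoint x₃ x₃} h y₃)))

  common-edge : CommonEdge
  common-edge = pick₁ (allV₃-elim {FirstPoint x₃ x₃} (⇒-elim (allV₃-elim (allV₃-elim edgeExists-true u₃) v₃) guard₃) x₃)

  repeats₂-false : ¬ repeats₂ A₂ ≡ true
  repeats₂-false h =
    any-case h λ i h → any-case h λ j h → ∧-case {not (i ==ᶠ j)} h λ i≢j h → ≢-elim i≢j (same-parity i j (≟ᵇ₂-sound h))
    where
    same-parity : ∀ i j → A₂ i ≡ A₂ j → i ≡ j
    same-parity i j e = p-mod2 (strip (Tables.eq₂⇒ T {i} {#0} {j} {#0} (cong (_⊞₂ 0₂) e)))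
      where
      strip : (p i +ᵖ q #0) ≡ (p j +ᵖ q #0) [mod + 2 ] → p i ≡ p j [mod + 2 ]
      strip (k by e) = k by λ t → linear₁ (+ 1) (e t) (ring (p i t) (p j t) (q #0 t) (k t))
        where
        ring : ∀ x y o k → x - (y + + 2 * k) ≡ + 1 * ((x + o) - ((y + o) + + 2 * k))
        ring = solve-∀

  guard₂ : normal₂ u₂ v₂ ∧ not (repeats₂ A₂) ≡ true
  guard₂ = ∧-intro normal₂-true (not-intro repeats₂-false)

  agree-intro : ∀ {a b} → (a ≡ true → b ≡ true) → (b ≡ true → a ≡ true) → agree a b ≡ true
  agree-intro {true} f g = f refl
  agree-intro {false} {true} f g = g refl
  agree-intro {false} {false} f g = refl

  candidates-All : ∀ {X : Edge → Set} {sr} → All (λ sr → ∀ m n → X (m , n , sr)) sr → All X (candidates sr)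
  candidates-All h = concat⁺ (map⁺ (All.map (λ f → concat⁺ (map⁺ (All.universal (λ m → map⁺ (All.universal (λ n → f m n) indices₅)) indices₅))) h))
    where
    open import Data.List.Relation.Unary.All.Properties using (concat⁺; map⁺)
    import Data.List.Relation.Unary.All as All

  opaque
    unfolding filterˡ
    filterˡ-All₂ : ∀ {X : Edge → Set} f {xs} → All X xs → All (λ x → X x × f x ≡ true) (filterˡ f xs)
    filterˡ-All₂ f [] = []
    filterˡ-All₂ f {x ∷ xs} (h ∷ hs) with f x in eq
    ... | true = (h , eq) ∷ filterˡ-All₂ f hs
    ... | false = filterˡ-All₂ f hs

  module Aligned (common : (p #0 +ᵖ q #1) ≈ᶻ (p #1 +ᵖ q #0)) where

    private
      d≈dq : d #1 ≈ᶻ dq #1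
      d≈dq t = linear₁ (- + 1) (common t) (ring (p #0 t) (p #1 t) (q #0 t) (q #1 t))
        where
        ring : ∀ a b c d → (b - a) - (d - c) ≡ (- + 1) * ((a + d) - (b + c))
        ring = solve-∀

      e₃-lab : e₀₃ ≡ lab₃ (dq #1)
      e₃-lab = trans (A-lab #1) (R₃.Label.lab-≈ ℓ₃ d≈dq)
      e₂-lab : e₀₂ ≡ lab₂ (dq #1)
      e₂-lab = trans (A′-lab #1) (R₂.Label.lab-≈ ℓ₂ d≈dq)

      a₂ b₂ : V₂
      a₂ = lab₂ (dq #2)
      b₂ = lab₂ (dq #3)

    private
      Tᶜ : Tables cfg A₃ (four 0₃ e₀₃ y₃ z₃) A₂ (four 0₂ e₀₂ (lab₂ (dq #2)) (lab₂ (dq #3)))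
      Tᶜ = tables (four 0₃ e₀₃ y₃ z₃) (four 0₂ e₀₂ (lab₂ (dq #2)) (lab₂ (dq #3)))
        (λ { #0 → dq0₃ ; #1 → e₃-lab ; #2 → refl ; #3 → refl })
        (λ { #0 → dq0₂ ; #1 → e₂-lab ; #2 → refl ; #3 → refl })

      module S = Sound cfg Tᶜ

    on-P : ∀ c j → A₃ c ≡ four 0₃ e₀₃ y₃ z₃ j → (p c +ᵖ q #0) ≈ᶻ (p #0 +ᵖ q j)
    on-P c j e = Tables.eq₃⇒ Tᶜ {c} {#0} {#0} {j} (trans (⊞₃-identityʳ (A₃ c)) (trans e (sym (⊞₃-identityˡ _))))

    -- If `q j - q 0` and `p c - p 0` have the same parity, the segment from `p c + q 0` to
    -- `p 0 + q j` is even, and the common edge carries it to the one from `p c + q 1` to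
    -- `p 1 + q j`. As `p 0` and `p 1` differ, the segment must be a point.
    aligned-true : ∀ j → aligned A₃ (four 0₃ e₀₃ y₃ z₃ j) A₂ (four 0₂ e₀₂ a₂ b₂ j) ≡ true
    aligned-true j = allᶠ-intro λ c → agree-intro
      (λ h → ≟ᵇ₂-refl (trans (sym (⊞₂-identityʳ (A₂ c))) (trans (Tables.eq₂⇐ Tᶜ {c} {#0} {#0} {j} (≈⇒mod (on-P c j (≟ᵇ₃-sound h)))) (⊞₂-identityˡ _))))
      (λ h → ≟ᵇ₃-refl (meet c (Tables.eq₂⇒ Tᶜ {#0} {j} {c} {#0} (trans (⊞₂-identityˡ _) (trans (sym (≟ᵇ₂-sound h)) (sym (⊞₂-identityʳ (A₂ c))))))))
      where
      meet : ∀ c → (p #0 +ᵖ q j) ≡ (p c +ᵖ q #0) [mod + 2 ] → A₃ c ≡ four 0₃ e₀₃ y₃ z₃ j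
      meet c par = [ (λ e → trans (sym (⊞₃-identityʳ (A₃ c))) (trans (sym (Tables.eq₃⇐ Tᶜ {#0} {j} {c} {#0} e)) (⊞₃-identityˡ _)))
                   , (λ e → ⊥-elim (0≢1 (p-inj (λ t → cancelʳ (q j t) (p #0 t) (p #1 t) (e t))))) ]′
        (mod2 (S-sum #0 j) (S-sum c #0) (S-sum #1 j) (S-sum c #1) par
          (λ t → linear₁ (+ 1) (common t) (ring (p #0 t) (p #1 t) (p c t) (q #0 t) (q #1 t) (q j t))))
        where
        0≢1 : ¬ zero ≡ suc {4} zero
        0≢1 ()
        ring : ∀ a b c s r j → ((a + j) + (c + r)) - ((b + j) + (c + s)) ≡ + 1 * ((a + r) - (b + s))
        ring = solve-∀

    -- The last entry of this table is a placeholder, not the residue of `q #3`. `OnB` keeps track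
    -- of the fact that `pairs₃` never reaches it.
    edges₃-sound : All S.IsEdge (edges A₃ (four 0₃ e₀₃ y₃ y₃) pairs₃)
    edges₃-sound = All.map (λ {e} h → sound e h) (filterˡ-All₂ (isEdge A₃ B) (candidates-All {X = OnB}
        ((λ m n → dq0₃ , e₃-lab) ∷ (λ m n → dq0₃ , refl) ∷ (λ m n → e₃-lab , refl) ∷ [])))
      where
      import Data.List.Relation.Unary.All as All
      B : Fin 4 → V₃
      B = four 0₃ e₀₃ y₃ y₃
      OnB : Edge → Set
      OnB (m , n , s , r) = B s ≡ lab₃ (dq s) × B r ≡ lab₃ (dq r)
      sound : ∀ e → OnB e × isEdge A₃ B e ≡ true → S.IsEdge e
      sound (m , n , s , r) ((bs , br) , h) = ∧-case {not (m ==ᶠ n)} h λ m≢n h →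
        ≢-elim m≢n , same₃ {B} m r n s br bs (≟ᵇ₃-sound h)

    TranslateInP : Set
    TranslateInP = ∃[ c ] ∃[ d ] ((p c +ᵖ q #0) ≈ᶻ (p #0 +ᵖ q #2) × (p d +ᵖ q #0) ≈ᶻ (p #0 +ᵖ q #3))

    private
      open Classify A₃
      es : List Edge
      es = edges A₃ (four 0₃ e₀₃ y₃ z₃) pairs₄

      impossible : ¬ allV₂ (λ u → allV₂ (parities y₃ z₃ es u)) ≡ true
      impossible h = never {X = ⊥} (S.killed-sound (S.edges-sound pairs₄)) (last
          (⇒-elim (allV₂-elim {parityOf₃ y₃ z₃ es A₂ a₂} (⇒-elim (allV₂-elim {parityOf₂ y₃ z₃ es A₂}
            (⇒-elim (allV₂-elim {parities y₃ z₃ es u₂} (allV₂-elim {λ u → allV₂ (parities y₃ z₃ es u)} h u₂) v₂) guard₂) a₂)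
            (aligned-true #2)) b₂) (aligned-true #3)))
        where
        last : ∀ {k} → (b₂ ≟ᵇ₂ a₂) ∨ k ≡ true → k ≡ true
        last = orElse (λ h → ⊥-elim (3≢2 (dq-mod2 (≟ᵇ₂-sound h)))) (λ h → h)
          where
          3≢2 : ¬ suc (suc (suc zero)) ≡ suc (suc (zero {1}))
          3≢2 ()

      in-leaf : leaf y₃ z₃ es ≡ true → TranslateInP
      in-leaf = orElse (never (S.bad-sound (S.edges-sound pairs₄)))
        (orElse (λ h → ∧-case {inP A₃ y₃} h λ f g → any-case f λ c f → any-case g λ d g →
            c , d , on-P c #2 (≟ᵇ₃-sound f) , on-P d #3 (≟ᵇ₃-sound g))
        (never impossible))

      in-second : second y₃ z₃ ≡ true → TranslateInP
      in-second = orElse (never (distinct {#3} {#0} (λ ()) refl dq0₃)) (orElse (never (distinct {#3} {#1} (λ ()) refl e₃-lab))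
        (orElse (never (distinct {#3} {#2} (λ ()) refl refl)) in-leaf))

      in-first : Classify.first A₃ y₃ ≡ true → TranslateInP
      in-first = orElse (never (distinct {#2} {#0} (λ ()) refl dq0₃)) (orElse (never (distinct {#2} {#1} (λ ()) refl e₃-lab))
        (orElse (never (S.bad-sound edges₃-sound)) (λ h → in-second (allV₃-elim {second y₃} h z₃))))

    translate-in-P : TranslateInP
    translate-in-P = in-first (allV₃-elim {Classify.first A₃} (⇒-elim (allV₃-elim (allV₃-elim classification-true u₃) v₃) guard₃) y₃)

-- Q as a translate of the hull of four points of P

record Perm (n : ℕ) : Set where
  field
    to from : Fin n → Fin n
    to-from : ∀ i → to (from i) ≡ i
    from-to : ∀ i → from (to i) ≡ i

  to-injective : ∀ {i j} → to i ≡ to j → i ≡ j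
  to-injective {i} {j} e = trans (sym (from-to i)) (trans (cong from e) (from-to j))

swap : ∀ {n} → Fin n → Fin n → Fin n → Fin n
swap a b i with i Fin.≟ a | i Fin.≟ b
... | yes _ | _ = b
... | no _ | yes _ = a
... | no _ | no _ = i

swap-l : ∀ {n} (a b : Fin n) → swap a b a ≡ b
swap-l a b with a Fin.≟ a
... | yes _ = refl
... | no h = ⊥-elim (h refl)

swap-r : ∀ {n} (a b : Fin n) → swap a b b ≡ a
swap-r a b with b Fin.≟ a | b Fin.≟ b
... | yes e | _ = e
... | no _ | yes _ = refl
... | no _ | no h = ⊥-elim (h refl)

swap-other : ∀ {n} (a b i : Fin n) → ¬ i ≡ a → ¬ i ≡ b → swap a b i ≡ i
swap-other a b i h k with i Fin.≟ a | i Fin.≟ b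
... | yes e | _ = ⊥-elim (h e)
... | no _ | yes e = ⊥-elim (k e)
... | no _ | no _ = refl

swap-involutive : ∀ {n} (a b i : Fin n) → swap a b (swap a b i) ≡ i
swap-involutive a b i = go (i Fin.≟ a) (i Fin.≟ b)
  where
  go : Dec (i ≡ a) → Dec (i ≡ b) → swap a b (swap a b i) ≡ i
  go (yes refl) _ = trans (cong (swap a b) (swap-l a b)) (swap-r a b)
  go (no _) (yes refl) = trans (cong (swap a b) (swap-r a b)) (swap-l a b)
  go (no h) (no k) = trans (cong (swap a b) (swap-other a b i h k)) (swap-other a b i h k)

opaque
  -- Redirects position k to t and leaves alone every other position whose image was not t.
  place : ∀ {n} (σ : Perm n) k t → Σ (Perm n) λ σ′ → Perm.to σ′ k ≡ t ×
    (∀ j → ¬ j ≡ k → ¬ Perm.to σ j ≡ t → Perm.to σ′ j ≡ Perm.to σ j)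
  place σ k t = record
      { to = λ i → to (swap k (from t) i) ; from = λ i → swap k (from t) (from i)
      ; to-from = λ i → trans (cong to (swap-involutive k (from t) (from i))) (to-from i)
      ; from-to = λ i → trans (cong (swap k (from t)) (from-to _)) (swap-involutive k (from t) i) } ,
    trans (cong to (swap-l k (from t))) (to-from t) ,
    λ j j≢k h → cong to (swap-other k (from t) j j≢k (λ e → h (trans (cong to e) (to-from t))))
    where open Perm σ

id-perm : ∀ {n} → Perm n
id-perm = record { to = λ i → i ; from = λ i → i ; to-from = λ _ → refl ; from-to = λ _ → refl }

shiftW : Pt → List (ℕ × Pt) → List (ℕ × Pt)
shiftW t = map (λ nx → proj₁ nx , (proj₂ nx +ᵖ t))

Σw-shift : ∀ t L → Σw (shiftW t L) ≡ Σw L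
Σw-shift t [] = refl
Σw-shift t ((n , x) ∷ L) = cong (n ℕ.+_) (Σw-shift t L)

Σp-shift : ∀ t L i → Σp (shiftW t L) i ≡ Σp L i + + Σw L * t i
Σp-shift t [] i = refl
Σp-shift t ((n , x) ∷ L) i = trans (cong (_+_ (+ n * (x i + t i))) (Σp-shift t L i))
  (ring (+ n) (x i) (t i) (Σp L i) (+ Σw L))
  where
  ring : ∀ n x t L W → n * (x + t) + (L + W * t) ≡ (n * x + L) + (n + W) * t
  ring = solve-∀

-- Every condition on S is invariant under translation, so replacing Q by `Q - t` only means that S
-- is read at `z + t`.
relabel : ∀ {p q} → Config p q → (σ : Perm 5) (τ : Perm 4) (t : Pt) (q′ : Fin 4 → Pt) →
  (∀ j → q (Perm.to τ j) ≈ᶻ (q′ j +ᵖ t)) → Config (λ i → p (Perm.to σ i)) q′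
relabel {p} {q} cfg σ τ t q′ e = record
  { S       = λ z → c.S (z +ᵖ t)
  ; SP      = c.SP
  ; S-resp  = λ f → c.S-resp (λ i → cong (_+ t i) (f i))
  ; S-mean  = λ L z N eN ez hL → c.S-mean (shiftW t L) (z +ᵖ t) N (trans (Σw-shift t L) eN)
      (λ i → trans (Σp-shift t L i) (trans (cong₂ (λ a w → a + + w * t i) (ez i) eN) (sym (ℤₚ.*-distribˡ-+ (+ suc N) (z i) (t i)))))
      (Allₚ.map⁺ hL)
  ; SP-mean = c.SP-mean
  ; S-sum   = λ i j → c.S-resp (λ k → trans (cong (_+_ (p (σ.to i) k)) (e j k)) (sym (ℤₚ.+-assoc (p (σ.to i) k) (q′ j k) (t k))))
                        (c.S-sum (σ.to i) (τ.to j))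
  ; SP-p    = λ i → c.SP-p (σ.to i)
  ; SP⇒p    = λ h → let (i , f) = c.SP⇒p h in σ.from i , λ k → trans (f k) (cong (λ j → p j k) (sym (σ.to-from i)))
  ; mod3    = λ { {x} {y} hx hy (k by f) → λ i → cancelʳ (t i) (x i) (y i) (c.mod3 hx hy (k by λ j → linear₁ (+ 1) (f j) (ring (+ 3) (x j) (y j) (t j) (k j))) i) }
  ; mod2    = λ { {x} {y} {x′} {y′} hx hy hx′ hy′ (k by f) g →
      [ (λ h → inj₁ (λ i → cancelʳ (t i) (x i) (y i) (h i))) , (λ h → inj₂ (λ i → cancelʳ (t i) (x i) (x′ i) (h i))) ]′
      (c.mod2 hx hy hx′ hy′ (k by λ j → linear₁ (+ 1) (f j) (ring (+ 2) (x j) (y j) (t j) (k j)))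
        (λ j → linear₁ (+ 1) (g j) (ring₂ (x j) (y j) (x′ j) (y′ j) (t j)))) }
  ; p-para  = λ i≢k i≢l → c.p-para (λ f → i≢k (σ.to-injective f)) (λ f → i≢l (σ.to-injective f))
  ; q-para  = λ {i} {j} {k} {l} i≢k i≢l f → c.q-para (λ g → i≢k (τ.to-injective g)) (λ g → i≢l (τ.to-injective g))
      (λ s → trans (cong₂ _+_ (e i s) (e j s)) (trans (linear₁ (+ 1) (f s) (ring₃ (q′ i s) (q′ j s) (q′ k s) (q′ l s) (t s)))
        (sym (cong₂ _+_ (e k s) (e l s)))))
  ; p-inj   = λ f → σ.to-injective (c.p-inj f)
  ; q-inj   = λ {i} {j} f → τ.to-injective (c.q-inj (λ s → trans (e i s) (trans (cong (_+ t s) (f s)) (sym (e j s)))))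
  ; vertex  = c.vertex
  }
  where
  module c = Config cfg
  module σ = Perm σ
  module τ = Perm τ
  ring : ∀ n x y t k → (x + t) - ((y + t) + n * k) ≡ + 1 * (x - (y + n * k))
  ring = solve-∀
  ring₂ : ∀ x y x′ y′ t → ((x + t) + (y′ + t)) - ((x′ + t) + (y + t)) ≡ + 1 * ((x + y′) - (x′ + y))
  ring₂ = solve-∀
  ring₃ : ∀ i j k l t → ((i + t) + (j + t)) - ((k + t) + (l + t)) ≡ + 1 * ((i + j) - (k + l))
  ring₃ = solve-∀

-- As `inject₁` misses `#4`, the numbering is such that `p #4` is the vertex of P without a
-- counterpart in Q.
NormalForm : (p : Fin 5 → Pt) (q : Fin 4 → Pt) → Set₁
NormalForm p q = Σ (Perm 5) λ σ → Σ (Perm 4) λ τ → Σ Pt λ t →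
  (∀ j → q (Perm.to τ j) ≈ᶻ (p (Perm.to σ (inject₁ j)) +ᵖ t)) ×
  Config (λ i → p (Perm.to σ i)) (λ j → p (Perm.to σ (inject₁ j)))

compose : ∀ {n} → Perm n → Perm n → Perm n
compose σ ρ = record
  { to = λ i → σ.to (ρ.to i) ; from = λ i → ρ.from (σ.from i)
  ; to-from = λ i → trans (cong σ.to (ρ.to-from _)) (σ.to-from i)
  ; from-to = λ i → trans (cong ρ.from (σ.from-to _)) (ρ.from-to i) }
  where
  module σ = Perm σ
  module ρ = Perm ρ

normal-form : ∀ {p q} → Config p q → NormalForm p q
normal-form {p} {q} cfg = step₁ (Coordinates.common-edge cfg)
  where
  module c = Config cfg
  step₁ : Coordinates.CommonEdge cfg → NormalForm p q
  step₁ (m , n , s , r , m≢n , e) = step₂ (Coordinates.Aligned.translate-in-P cfg′ common)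
    where
    s≢r : ¬ s ≡ r
    s≢r refl = m≢n (c.p-inj (λ t → cancelʳ (q s t) (p m t) (p n t) (e t)))
    σ₀ = place id-perm #0 m
    σ₁ = place (proj₁ σ₀) #1 n
    τ₀ = place id-perm #0 s
    τ₁ = place (proj₁ τ₀) #1 r
    σ = proj₁ σ₁
    τ = proj₁ τ₁
    σ0 : Perm.to σ #0 ≡ m
    σ0 = trans (proj₂ (proj₂ σ₁) #0 (λ ()) (λ f → m≢n (trans (sym (proj₁ (proj₂ σ₀))) f))) (proj₁ (proj₂ σ₀))
    τ0 : Perm.to τ #0 ≡ s
    τ0 = trans (proj₂ (proj₂ τ₁) #0 (λ ()) (λ f → s≢r (trans (sym (proj₁ (proj₂ τ₀))) f))) (proj₁ (proj₂ τ₀))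
    p₁ : Fin 5 → Pt
    p₁ i = p (Perm.to σ i)
    q₁ : Fin 4 → Pt
    q₁ j = q (Perm.to τ j)
    cfg′ : Config p₁ q₁
    cfg′ = relabel cfg σ τ 0ᵖ q₁ (λ j k → sym (ℤₚ.+-identityʳ _))
    module c′ = Config cfg′
    common : (p₁ #0 +ᵖ q₁ #1) ≈ᶻ (p₁ #1 +ᵖ q₁ #0)
    common t = trans (cong₂ (λ i j → p i t + q j t) σ0 (proj₁ (proj₂ τ₁)))
      (trans (e t) (sym (cong₂ (λ i j → p i t + q j t) (proj₁ (proj₂ σ₁)) τ0)))
    step₂ : Coordinates.Aligned.TranslateInP cfg′ common → NormalForm p q
    step₂ (c , d , ec , ed) = compose σ ρ , τ , t , translate ,
      relabel cfg (compose σ ρ) τ t (λ j → p₁ (Perm.to ρ (inject₁ j))) translate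
      where
      t : Pt
      t = q₁ #0 -ᵖ p₁ #0
      at-c : ∀ {i j} → c ≡ i → (p₁ i +ᵖ q₁ #0) ≈ᶻ (p₁ #0 +ᵖ q₁ j) → q₁ #2 ≈ᶻ q₁ j
      at-c {j = j} refl f k = cancelˡ (p₁ #0 k) (q₁ #2 k) (q₁ j k) (trans (sym (ec k)) (f k))
      at-d : ∀ {i j} → d ≡ i → (p₁ i +ᵖ q₁ #0) ≈ᶻ (p₁ #0 +ᵖ q₁ j) → q₁ #3 ≈ᶻ q₁ j
      at-d {j = j} refl f k = cancelˡ (p₁ #0 k) (q₁ #3 k) (q₁ j k) (trans (sym (ed k)) (f k))
      contra : ∀ {i j} → ¬ i ≡ j → ¬ q₁ i ≈ᶻ q₁ j
      contra h f = h (c′.q-inj f)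
      -- The points `q₁ #0` and `q₁ #1` are already the translates of `p₁ #0` and `p₁ #1`, so `c`
      -- and `d` are two further indices; any coincidence would identify two points of Q.
      c≢0 : ¬ c ≡ #0
      c≢0 f = contra {#2} {#0} (λ ()) (at-c {#0} {#0} f (λ _ → refl))
      c≢1 : ¬ c ≡ #1
      c≢1 f = contra {#2} {#1} (λ ()) (at-c {#1} {#1} f (λ k → sym (common k)))
      d≢0 : ¬ d ≡ #0
      d≢0 f = contra {#3} {#0} (λ ()) (at-d {#0} {#0} f (λ _ → refl))
      d≢1 : ¬ d ≡ #1
      d≢1 f = contra {#3} {#1} (λ ()) (at-d {#1} {#1} f (λ k → sym (common k)))
      d≢c : ¬ d ≡ c
      d≢c f = contra {#3} {#2} (λ ()) (at-d {c} {#2} f ec)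
      ρ₀ = place id-perm #2 c
      ρ₁ = place (proj₁ ρ₀) #3 d
      ρ = proj₁ ρ₁
      ρ2 : Perm.to ρ #2 ≡ c
      ρ2 = trans (proj₂ (proj₂ ρ₁) #2 (λ ()) (λ f → d≢c (trans (sym f) (proj₁ (proj₂ ρ₀))))) (proj₁ (proj₂ ρ₀))
      ρ-low : ∀ i → ¬ i ≡ #2 → ¬ i ≡ #3 → ¬ c ≡ i → ¬ d ≡ i → Perm.to ρ i ≡ i
      ρ-low i i≢2 i≢3 c≢i d≢i = trans (proj₂ (proj₂ ρ₁) i i≢3 (λ f → d≢i (trans (sym f) stay))) stay
        where stay = proj₂ (proj₂ ρ₀) i i≢2 (λ f → c≢i (sym f))
      move : ∀ {i j} → (p₁ i +ᵖ q₁ #0) ≈ᶻ (p₁ #0 +ᵖ q₁ j) → q₁ j ≈ᶻ (p₁ i +ᵖ t)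
      move {i} {j} f k = linear₁ (- + 1) (f k) (ring (p₁ i k) (q₁ #0 k) (p₁ #0 k) (q₁ j k))
        where
        ring : ∀ x y o z → z - (x + (y - o)) ≡ (- + 1) * ((x + y) - (o + z))
        ring = solve-∀
      along : ∀ {i i′ j} → i′ ≡ i → (p₁ i +ᵖ q₁ #0) ≈ᶻ (p₁ #0 +ᵖ q₁ j) → q₁ j ≈ᶻ (p₁ i′ +ᵖ t)
      along {i} {j = j} refl f = move {i} {j} f
      translate : ∀ j → q₁ j ≈ᶻ (p₁ (Perm.to ρ (inject₁ j)) +ᵖ t)
      translate #0 = along {#0} {j = #0} (ρ-low #0 (λ ()) (λ ()) c≢0 d≢0) (λ _ → refl)
      translate #1 = along {#1} {j = #1} (ρ-low #1 (λ ()) (λ ()) c≢1 d≢1) (λ k → sym (common k))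
      translate #2 = along {c} {j = #2} ρ2 ec
      translate #3 = along {d} {j = #3} (proj₁ (proj₂ ρ₁)) ed

-- The bipyramid

tot : (Fin 5 → ℤ) → ℤ
tot f = f #0 + (f #1 + (f #2 + (f #3 + f #4)))

indicator : Fin 5 → Fin 5 → ℤ
indicator i t = if i ==ᶠ t then + 1 else + 0

multiplicity : List (Fin 5) → Fin 5 → ℤ
multiplicity [] t = + 0
multiplicity (i ∷ L) t = indicator i t + multiplicity L t

isOne : ℤ → Bool
isOne (+ 1) = true
isOne _ = false

isOne-sound : ∀ z → isOne z ≡ true → z ≡ + 1
isOne-sound (+ 1) e = refl
isOne-sound (+ zero) ()
isOne-sound (+ suc (suc n)) ()
isOne-sound -[1+ n ] ()

-- The list runs through the five indices exactly once. Stated by integer multiplicities, this turns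
-- a sum over the list into the sum over all vertices by linearity.
covers : List (Fin 5) → Bool
covers L = allᶠ λ t → isOne (multiplicity L t)

over : List (Fin 5) → (Fin 5 → ℤ) → ℤ
over [] f = + 0
over (i ∷ L) f = f i + over L f

opaque
  unfolding _≟ᵇ₂_

  allᶠ-elim : ∀ {n} {f : Fin n → Bool} → allᶠ f ≡ true → ∀ i → f i ≡ true
  allᶠ-elim h zero = proj₁ (∧-elim h)
  allᶠ-elim {suc n} {f} h (suc i) = allᶠ-elim {n} {λ i → f (suc i)} (proj₂ (∧-elim {f zero} h)) i

  tot-indicator : ∀ i (f : Fin 5 → ℤ) → tot (λ t → indicator i t * f t) ≡ f i
  tot-indicator #0 f = ring (f #0) (f #1) (f #2) (f #3) (f #4)
    where
    ring : ∀ a b c d e → + 1 * a + (+ 0 * b + (+ 0 * c + (+ 0 * d + + 0 * e))) ≡ a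
    ring = solve-∀
  tot-indicator #1 f = ring (f #0) (f #1) (f #2) (f #3) (f #4)
    where
    ring : ∀ a b c d e → + 0 * a + (+ 1 * b + (+ 0 * c + (+ 0 * d + + 0 * e))) ≡ b
    ring = solve-∀
  tot-indicator #2 f = ring (f #0) (f #1) (f #2) (f #3) (f #4)
    where
    ring : ∀ a b c d e → + 0 * a + (+ 0 * b + (+ 1 * c + (+ 0 * d + + 0 * e))) ≡ c
    ring = solve-∀
  tot-indicator #3 f = ring (f #0) (f #1) (f #2) (f #3) (f #4)
    where
    ring : ∀ a b c d e → + 0 * a + (+ 0 * b + (+ 0 * c + (+ 1 * d + + 0 * e))) ≡ d
    ring = solve-∀
  tot-indicator #4 f = ring (f #0) (f #1) (f #2) (f #3) (f #4)
    where
    ring : ∀ a b c d e → + 0 * a + (+ 0 * b + (+ 0 * c + (+ 0 * d + + 1 * e))) ≡ e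
    ring = solve-∀

tot-+ : ∀ (f g : Fin 5 → ℤ) → tot f + tot g ≡ tot (λ t → f t + g t)
tot-+ f g = ring (f #0) (f #1) (f #2) (f #3) (f #4) (g #0) (g #1) (g #2) (g #3) (g #4)
  where
  ring : ∀ a b c d e a′ b′ c′ d′ e′ → (a + (b + (c + (d + e)))) + (a′ + (b′ + (c′ + (d′ + e′)))) ≡
    (a + a′) + ((b + b′) + ((c + c′) + ((d + d′) + (e + e′))))
  ring = solve-∀

tot-cong : ∀ {f g : Fin 5 → ℤ} → (∀ t → f t ≡ g t) → tot f ≡ tot g
tot-cong h = cong₂ _+_ (h #0) (cong₂ _+_ (h #1) (cong₂ _+_ (h #2) (cong₂ _+_ (h #3) (h #4))))

over-multiplicity : ∀ L (f : Fin 5 → ℤ) → over L f ≡ tot (λ t → multiplicity L t * f t)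
over-multiplicity [] f = refl
over-multiplicity (i ∷ L) f = trans (cong₂ _+_ (sym (tot-indicator i f)) (over-multiplicity L f))
  (trans (tot-+ (λ t → indicator i t * f t) (λ t → multiplicity L t * f t))
    (tot-cong (λ t → sym (ℤₚ.*-distribʳ-+ (f t) (indicator i t) (multiplicity L t)))))

covers-sum : ∀ L (f : Fin 5 → ℤ) → covers L ≡ true → over L f ≡ tot f
covers-sum L f h = trans (over-multiplicity L f) (tot-cong (λ t →
  trans (cong (_* f t) (isOne-sound _ (allᶠ-elim h t))) (ℤₚ.*-identityˡ (f t))))

totalV₃ : (Fin 5 → V₃) → V₃
totalV₃ A = A #0 ⊞₃ (A #1 ⊞₃ (A #2 ⊞₃ (A #3 ⊞₃ A #4)))
totalV₂ : (Fin 5 → V₂) → V₂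
totalV₂ A = A #0 ⊞₂ (A #1 ⊞₂ (A #2 ⊞₂ (A #3 ⊞₂ A #4)))

parallel : (Fin 5 → V₃) → Fin 5 → Fin 4 → Fin 5 → Fin 4 → Bool
parallel A i j k l = not (i ==ᶠ k) ∧ not (i ==ᶠ inject₁ l) ∧ (A i ⊞₃ A (inject₁ j) ≟ᵇ₃ A k ⊞₃ A (inject₁ l))

-- The second alternative is impossible for a configuration: the two sums lie in S, so they would be
-- equal and span a parallelogram in P. One index of each sum ranges over `Fin 4` because that
-- summand has to come from Q.
special-or-parallel : (Fin 5 → V₃) → Bool
special-or-parallel A = (anyᶠ λ s → totalV₃ A ⊞₃ A s ≟ᵇ₃ 0₃) ∨
  (anyᶠ λ i → anyᶠ λ j → anyᶠ λ k → anyᶠ λ l → parallel A i j k l)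

-- The four vertices other than `α`, split into two pairs that each contain a point of Q, so that
-- both pair sums lie in S.
others : Fin 5 → Fin 5 → Fin 4 → Fin 5 → Fin 4 → Bool
others α w x y z = not (w ==ᶠ α) ∧ not (inject₁ x ==ᶠ α) ∧ not (y ==ᶠ α) ∧ not (inject₁ z ==ᶠ α) ∧
  covers (w ∷ inject₁ x ∷ y ∷ inject₁ z ∷ α ∷ [])

rest : Fin 4 → Fin 5 → Fin 4 → Fin 5 → Fin 4 → Bool
rest α s i j k = not (s ==ᶠ inject₁ i) ∧ not (s ==ᶠ j) ∧ not (s ==ᶠ inject₁ k) ∧
  covers (inject₁ i ∷ j ∷ inject₁ k ∷ s ∷ inject₁ α ∷ [])

split : Fin 4 → Fin 4 → Fin 4 → Fin 4 → Bool
split i j k l = not (inject₁ i ==ᶠ inject₁ k) ∧ not (inject₁ i ==ᶠ inject₁ l) ∧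
  covers (inject₁ i ∷ inject₁ j ∷ inject₁ k ∷ inject₁ l ∷ #4 ∷ [])

opaque
  unfolding _≟ᵇ₂_ _⊞₂_

  specials : (allV₃ λ u → allV₃ λ v → normal₃ u v ∧ not (noCap (tab₃ u v)) ⇒ special-or-parallel (tab₃ u v)) ≡ true
  specials = refl

  -- All of F₂³ sums to zero, so the five residues have the same sum as the three missing ones. That
  -- sum is the fourth point of the plane through the missing three, hence one of the five.
  apexes : (allV₂ λ u → allV₂ λ v → normal₂ u v ∧ not (repeats₂ (tab₂ u v)) ⇒
    anyᶠ λ α → totalV₂ (tab₂ u v) ≟ᵇ₂ tab₂ u v α) ≡ true
  apexes = refl

  -- The first four residues sum to zero and so form an affine plane. Their mutual sums fill its
  -- direction space, and their sums with the fifth residue, which is off the plane, fill the other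
  -- coset.
  cosets : (allV₂ λ u → allV₂ λ v → (normal₂ u v ∧ not (repeats₂ (tab₂ u v))) ∧ (totalV₂ (tab₂ u v) ≟ᵇ₂ tab₂ u v #4) ⇒
    allV₂ λ w → anyᶠ λ i → anyᶠ λ j → tab₂ u v i ⊞₂ tab₂ u v (inject₁ {4} j) ≟ᵇ₂ w) ≡ true
  cosets = refl

  others-exist : (allᶠ λ α → anyᶠ λ w → anyᶠ λ x → anyᶠ λ y → anyᶠ λ z → others α w x y z) ≡ true
  others-exist = refl

  rest-exist : (allᶠ λ α → allᶠ λ s → (inject₁ α ==ᶠ s) ∨ anyᶠ λ i → anyᶠ λ j → anyᶠ λ k → rest α s i j k) ≡ true
  rest-exist = refl

  split-exist : (allᶠ λ i → allᶠ λ j → (i ==ᶠ j) ∨ anyᶠ λ k → anyᶠ λ l → split i j k l) ≡ true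
  split-exist = refl

  bipyramid-exist : (allᶠ λ (s : Fin 4) → anyᶠ λ (i : Fin 4) → anyᶠ λ (j : Fin 4) → anyᶠ λ (k : Fin 4) →
    covers (inject₁ i ∷ inject₁ j ∷ inject₁ k ∷ inject₁ s ∷ #4 ∷ [])) ≡ true
  bipyramid-exist = refl

last-or-inject : (α : Fin 5) → (∃[ a ] α ≡ inject₁ {4} a) ⊎ α ≡ #4
last-or-inject #0 = inj₁ (#0 , refl)
last-or-inject #1 = inj₁ (#1 , refl)
last-or-inject #2 = inj₁ (#2 , refl)
last-or-inject #3 = inj₁ (#3 , refl)
last-or-inject #4 = inj₂ refl

inject≢4 : ∀ (j : Fin 4) → ¬ #4 ≡ inject₁ j
inject≢4 #0 ()
inject≢4 #1 ()
inject≢4 #2 ()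
inject≢4 #3 ()

-- p 4 is the apex and p s the opposite vertex of the bipyramid P, and Q omits the apex.
Shape : (Fin 5 → Pt) → Set
Shape p = ∃[ i ] ∃[ j ] ∃[ k ] ∃[ s ] (covers (inject₁ i ∷ inject₁ j ∷ inject₁ k ∷ inject₁ s ∷ #4 ∷ []) ≡ true ×
  (p (inject₁ i) +ᵖ p (inject₁ j) +ᵖ p (inject₁ k)) ≈ᶻ (p (inject₁ s) +ᵖ p #4 +ᵖ p #4))

module Quad {p} (cfg : Config p (λ j → p (inject₁ j))) where
  open Config cfg
  open Modular cfg
  open Coordinates cfg

  P : Pt
  P t = tot (λ i → p i t)

  special : ∃[ s ] (P +ᵖ p s) ≡ 0ᵖ [mod + 3 ]
  special = [ (λ h → any-case h λ s h → s , from-label s (≟ᵇ₃-sound h))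
            , (λ h → any-case h λ i h → any-case h λ j h → any-case h λ k h →
                any-case h λ l h → ∧-case {not (i ==ᶠ k)} h λ i≢k h → ∧-case {not (i ==ᶠ inject₁ l)} h λ i≢l h →
                ⊥-elim (no-parallel i j k l (≢-elim i≢k) (≢-elim i≢l) (≟ᵇ₃-sound h))) ]′
            (∨-elim (⇒-elim (allV₃-elim (allV₃-elim specials u₃) v₃) guard₃))
    where
    A₃ = tab₃ u₃ v₃
    from-label : ∀ s → totalV₃ A₃ ⊞₃ A₃ s ≡ 0₃ → (P +ᵖ p s) ≡ 0ᵖ [mod + 3 ]
    from-label s e = unbase (R₃.Label.lab-inj ℓ₃ {y = 0ᵖ} (trans (lab₃-+ Dtot (d s)) (trans (cong₂ _⊞₃_ tot-lab (sym (A-lab s)))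
        (trans e (sym (lab₃-0 (λ _ → refl)))))))
      where
      Dtot : Pt
      Dtot = d #0 +ᵖ (d #1 +ᵖ (d #2 +ᵖ (d #3 +ᵖ d #4)))
      tot-lab : lab₃ Dtot ≡ totalV₃ A₃
      tot-lab = trans (lab₃-+ (d #0) _) (cong₂ _⊞₃_ (sym (A-lab #0)) (trans (lab₃-+ (d #1) _) (cong₂ _⊞₃_ (sym (A-lab #1))
        (trans (lab₃-+ (d #2) _) (cong₂ _⊞₃_ (sym (A-lab #2)) (trans (lab₃-+ (d #3) _) (cong₂ _⊞₃_ (sym (A-lab #3)) (sym (A-lab #4)))))))))
      unbase : (Dtot +ᵖ d s) ≡ 0ᵖ [mod + 3 ] → (P +ᵖ p s) ≡ 0ᵖ [mod + 3 ]
      unbase (k by f) = (+ 2 *ᵖ p #0 +ᵖ k) by λ t → linear₁ (+ 1) (f t) (ring (p #0 t) (p #1 t) (p #2 t) (p #3 t) (p #4 t) (p s t) (k t))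
        where
        ring : ∀ a b c d e s k → (a + (b + (c + (d + e))) + s) - (+ 0 + + 3 * (+ 2 * a + k)) ≡
          + 1 * (((a - a) + ((b - a) + ((c - a) + ((d - a) + (e - a)))) + (s - a)) - (+ 0 + + 3 * k))
        ring = solve-∀
    no-parallel : ∀ i j k l → ¬ i ≡ k → ¬ i ≡ inject₁ l → ¬ A₃ i ⊞₃ A₃ (inject₁ j) ≡ A₃ k ⊞₃ A₃ (inject₁ l)
    no-parallel i j k l i≢k i≢l e = p-para {i} {inject₁ j} {k} {inject₁ l} i≢k i≢l
      (mod3 (S-sum i j) (S-sum k l) (unbase (R₃.Label.lab-inj ℓ₃ (trans (lab₃-+ (d i) (d (inject₁ j)))
        (trans (sym (cong₂ _⊞₃_ (A-lab i) (A-lab (inject₁ j)))) (trans e (trans (cong₂ _⊞₃_ (A-lab k) (A-lab (inject₁ l)))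
          (sym (lab₃-+ (d k) (d (inject₁ l)))))))))))
      where
      unbase : (d i +ᵖ d (inject₁ j)) ≡ (d k +ᵖ d (inject₁ l)) [mod + 3 ] → (p i +ᵖ p (inject₁ j)) ≡ (p k +ᵖ p (inject₁ l)) [mod + 3 ]
      unbase (m by f) = m by λ t → linear₁ (+ 1) (f t) (ring (p #0 t) (p i t) (p (inject₁ j) t) (p k t) (p (inject₁ l) t) (m t))
        where
        ring : ∀ a i j k l m → (i + j) - ((k + l) + + 3 * m) ≡
          + 1 * (((i - a) + (j - a)) - (((k - a) + (l - a)) + + 3 * m))
        ring = solve-∀

  A′ : Fin 5 → V₂
  A′ = tab₂ u₂ v₂

  apex : ∃[ α ] totalV₂ A′ ≡ A′ α
  apex = any-case (⇒-elim (allV₂-elim (allV₂-elim apexes u₂) v₂) guard₂) λ α h → α , ≟ᵇ₂-sound h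

  apex-parity : ∀ α → totalV₂ A′ ≡ A′ α → P ≡ p α [mod + 2 ]
  apex-parity α e = unbase (R₂.Label.lab-inj ℓ₂ (trans tot-lab (trans e (A′-lab α))))
    where
    Dtot : Pt
    Dtot = d #0 +ᵖ (d #1 +ᵖ (d #2 +ᵖ (d #3 +ᵖ d #4)))
    tot-lab : lab₂ Dtot ≡ totalV₂ A′
    tot-lab = trans (lab₂-+ (d #0) _) (cong₂ _⊞₂_ (sym (A′-lab #0)) (trans (lab₂-+ (d #1) _) (cong₂ _⊞₂_ (sym (A′-lab #1))
      (trans (lab₂-+ (d #2) _) (cong₂ _⊞₂_ (sym (A′-lab #2)) (trans (lab₂-+ (d #3) _) (cong₂ _⊞₂_ (sym (A′-lab #3)) (sym (A′-lab #4)))))))))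
    unbase : Dtot ≡ d α [mod + 2 ] → P ≡ p α [mod + 2 ]
    unbase (k by f) = (+ 2 *ᵖ p #0 +ᵖ k) by λ t → linear₁ (+ 1) (f t) (ring (p #0 t) (p #1 t) (p #2 t) (p #3 t) (p #4 t) (p α t) (k t))
      where
      ring : ∀ a b c d e s k → (a + (b + (c + (d + e)))) - (s + + 2 * (+ 2 * a + k)) ≡
        + 1 * (((a - a) + ((b - a) + ((c - a) + ((d - a) + (e - a))))) - ((s - a) + + 2 * k))
      ring = solve-∀

  record Others (α : Fin 5) : Set where
    field
      w y : Fin 5
      x z : Fin 4
      w≢ : ¬ w ≡ α
      x≢ : ¬ inject₁ x ≡ α
      y≢ : ¬ y ≡ α
      z≢ : ¬ inject₁ z ≡ α
      sum : ((p w +ᵖ p (inject₁ x)) +ᵖ (p y +ᵖ p (inject₁ z)) +ᵖ p α) ≈ᶻ P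

  others-of : ∀ α → Others α
  others-of α =
    any-case (allᶠ-elim others-exist α) λ w h → any-case h λ x h → any-case h λ y h →
        any-case h λ z h → ∧-case {not (w ==ᶠ α)} h λ a h → ∧-case {not (inject₁ x ==ᶠ α)} h λ b h →
        ∧-case {not (y ==ᶠ α)} h λ c h → ∧-case {not (inject₁ z ==ᶠ α)} h λ d h →
        record { w = w ; x = x ; y = y ; z = z ; w≢ = ≢-elim a ; x≢ = ≢-elim b ; y≢ = ≢-elim c ; z≢ = ≢-elim d
              ; sum = λ t → trans (ring (p w t) (p (inject₁ x) t) (p y t) (p (inject₁ z) t) (p α t))
                        (covers-sum (w ∷ inject₁ x ∷ y ∷ inject₁ z ∷ α ∷ []) (λ i → p i t) h) }
    where
    ring : ∀ a b c d e → ((a + b) + (c + d)) + e ≡ a + (b + (c + (d + (e + + 0))))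
    ring = solve-∀

  module _ {α} (o : Others α) where
    open Others o

    X Y : Pt
    X = p w +ᵖ p (inject₁ x)
    Y = p y +ᵖ p (inject₁ z)

    X≡Y : P ≡ p α [mod + 2 ] → X ≡ Y [mod + 2 ]
    X≡Y (k by e) = (k -ᵖ Y) by λ t → linear₂ (+ 1) (+ 1) (sum t) (e t) (ring (X t) (Y t) (p α t) (P t) (k t))
      where
      ring : ∀ x y a P k → x - (y + + 2 * (k - y)) ≡ + 1 * ((x + y + a) - P) + + 1 * (P - (a + + 2 * k))
      ring = solve-∀

    not-centre : ¬ (X +ᵖ Y) ≈ᶻ (+ 4 *ᵖ p α)
    not-centre e = vertex (SP-p α) ((1 , p w) ∷ (1 , p (inject₁ x)) ∷ (1 , p y) ∷ (1 , p (inject₁ z)) ∷ []) 3 refl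
      (λ t → trans (ring (p w t) (p (inject₁ x) t) (p y t) (p (inject₁ z) t)) (e t))
      ((SP-p w , (λ f → w≢ (p-inj f))) ∷ (SP-p (inject₁ x) , (λ f → x≢ (p-inj f))) ∷ (SP-p y , (λ f → y≢ (p-inj f)))
        ∷ (SP-p (inject₁ z) , (λ f → z≢ (p-inj f))) ∷ [])
      where
      ring : ∀ a b c d → + 1 * a + (+ 1 * b + (+ 1 * c + (+ 1 * d + + 0))) ≡ (a + b) + (c + d)
      ring = solve-∀

    -- Here `p #4` is already one of the four vertices in `X + Y`, so the mean counts it twice.
    not-centre₅ : ¬ #4 ≡ α → ¬ (X +ᵖ Y +ᵖ p #4) ≈ᶻ (+ 5 *ᵖ p α)
    not-centre₅ 4≢α e = vertex (SP-p α) ((1 , p w) ∷ (1 , p (inject₁ x)) ∷ (1 , p y) ∷ (1 , p (inject₁ z)) ∷ (1 , p #4) ∷ []) 4 refl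
      (λ t → trans (ring (p w t) (p (inject₁ x) t) (p y t) (p (inject₁ z) t) (p #4 t)) (e t))
      ((SP-p w , (λ f → w≢ (p-inj f))) ∷ (SP-p (inject₁ x) , (λ f → x≢ (p-inj f))) ∷ (SP-p y , (λ f → y≢ (p-inj f)))
        ∷ (SP-p (inject₁ z) , (λ f → z≢ (p-inj f))) ∷ (SP-p #4 , (λ f → 4≢α (p-inj f))) ∷ [])
      where
      ring : ∀ a b c d e → + 1 * a + (+ 1 * b + (+ 1 * c + (+ 1 * d + (+ 1 * e + + 0)))) ≡ (a + b) + (c + d) + e
      ring = solve-∀

    -- `X` and `Y` have equal parity because `X + Y = P - p α` is even. Modulo 3 their sum with
    -- `p s + p α` is `P + p s`, which vanishes, so `p s + p α` is identified as their midpoint.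
    opposite : ∀ s → P ≡ p α [mod + 2 ] → (P +ᵖ p s) ≡ 0ᵖ [mod + 3 ] → S (p s +ᵖ p α) →
      (X +ᵖ Y) ≈ᶻ ((p s +ᵖ p α) +ᵖ (p s +ᵖ p α))
    opposite s par (k by e) hT = midpoint (S-sum w x) (S-sum y z) hT (X≡Y par)
      (k by λ t → linear₂ (+ 1) (+ 1) (sum t) (e t) (ring (X t) (Y t) (p s t) (p α t) (P t) (k t)))
      where
      ring : ∀ x y s a P k → (x + y + (s + a)) - (+ 0 + + 3 * k) ≡
        + 1 * ((x + y + a) - P) + + 1 * ((P + s) - (+ 0 + + 3 * k))
      ring = solve-∀

    total : ∀ s → (X +ᵖ Y) ≈ᶻ ((p s +ᵖ p α) +ᵖ (p s +ᵖ p α)) → P ≈ᶻ (+ 2 *ᵖ p s +ᵖ + 3 *ᵖ p α)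
    total s e t = linear₂ (- + 1) (+ 1) (sum t) (e t) (ring (X t) (Y t) (p s t) (p α t) (P t))
      where
      ring : ∀ x y s a P → P - (+ 2 * s + + 3 * a) ≡ (- + 1) * ((x + y + a) - P) + + 1 * ((x + y) - ((s + a) + (s + a)))
      ring = solve-∀

  private
    pick-rest : ∀ α s → ¬ inject₁ α ≡ s → ∃[ i ] ∃[ j ] ∃[ k ] rest α s i j k ≡ true
    pick-rest α s α≢s = [ (λ h → ⊥-elim (α≢s (==ᶠ-sound h)))
      , (λ h → any-case h λ i h → any-case h λ j h → any-case h λ k h → i , j , k , h) ]′
      (∨-elim {inject₁ α ==ᶠ s} (allᶠ-elim (allᶠ-elim rest-exist α) s))

  -- If Q contained the apex p α, the segments from 2 p α to 2 p i and from p j + p k to p s + p i would be parallel.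
  apex-omitted : ∀ α s → ¬ inject₁ α ≡ s → ¬ P ≈ᶻ (+ 2 *ᵖ p s +ᵖ + 3 *ᵖ p (inject₁ α))
  apex-omitted α s α≢s e with pick-rest α s α≢s
  ... | i , j , k , h =
    ∧-case {not (s ==ᶠ inject₁ i)} h λ s≢i h → ∧-case {not (s ==ᶠ j)} h λ s≢j h → ∧-case {not (s ==ᶠ inject₁ k)} h λ s≢k h →
    conclude i j k (≢-elim s≢i) (≢-elim s≢j) (≢-elim s≢k)
         (covers-sum (inject₁ i ∷ j ∷ inject₁ k ∷ s ∷ inject₁ α ∷ [])) h
    where
    conclude : ∀ i j k → ¬ s ≡ inject₁ i → ¬ s ≡ j → ¬ s ≡ inject₁ k →
      (∀ f → covers (inject₁ i ∷ j ∷ inject₁ k ∷ s ∷ inject₁ α ∷ []) ≡ true →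
        over (inject₁ i ∷ j ∷ inject₁ k ∷ s ∷ inject₁ α ∷ []) f ≡ tot f) →
      covers (inject₁ i ∷ j ∷ inject₁ k ∷ s ∷ inject₁ α ∷ []) ≡ true → ⊥
    conclude i j k s≢i s≢j s≢k sums h =
      [ p-para {s} {inject₁ i} {j} {inject₁ k} s≢j s≢k
      , (λ f → s≢i (p-inj (λ t → cancelʳ (p (inject₁ i) t) (p s t) (p (inject₁ i) t) (f t)))) ]′
      (mod2 (S-sum s i) (S-sum j k) (S-sum (inject₁ i) i) (S-sum (inject₁ α) α)
        ((p (inject₁ i) -ᵖ p (inject₁ α)) by λ t → identity (p (inject₁ i) t) (p j t) (p (inject₁ k) t) (p s t) (p (inject₁ α) t) (P t) (sums (λ n → p n t) h) (e t))
        (λ t → identity′ (p (inject₁ i) t) (p j t) (p (inject₁ k) t) (p s t) (p (inject₁ α) t) (P t) (sums (λ n → p n t) h) (e t)))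
      where
      ring : ∀ i j k s a P → (s + i) - ((j + k) + + 2 * (i - a)) ≡
        (- + 1) * ((i + (j + (k + (s + (a + + 0))))) - P) + (- + 1) * (P - (+ 2 * s + + 3 * a))
      ring = solve-∀
      identity : ∀ i j k s a P → i + (j + (k + (s + (a + + 0)))) ≡ P → P ≡ + 2 * s + + 3 * a →
        s + i ≡ (j + k) + + 2 * (i - a)
      identity i j k s a P f g = linear₂ (- + 1) (- + 1) f g (ring i j k s a P)
      ring′ : ∀ i j k s a P → ((s + i) + (a + a)) - ((i + i) + (j + k)) ≡
        (- + 1) * ((i + (j + (k + (s + (a + + 0))))) - P) + (- + 1) * (P - (+ 2 * s + + 3 * a))
      ring′ = solve-∀
      identity′ : ∀ i j k s a P → i + (j + (k + (s + (a + + 0)))) ≡ P → P ≡ + 2 * s + + 3 * a →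
        (s + i) + (a + a) ≡ (i + i) + (j + k)
      identity′ i j k s a P f g = linear₂ (- + 1) (- + 1) f g (ring′ i j k s a P)

  -- If `s` is the apex itself, the midpoint found by `opposite` makes it the centroid of the other
  -- four vertices; if not, Q would contain the apex of the bipyramid.
  no-inner-apex : ∀ α s → P ≡ p (inject₁ α) [mod + 2 ] → ¬ (P +ᵖ p s) ≡ 0ᵖ [mod + 3 ]
  no-inner-apex α s par z = go (inject₁ α Fin.≟ s)
    where
    o = others-of (inject₁ α)
    eq = opposite o s par z (S-sum s α)
    go : Dec (inject₁ α ≡ s) → ⊥
    go (yes refl) = not-centre o (λ t → trans (eq t) (ring (p s t)))
      where
      ring : ∀ a → (a + a) + (a + a) ≡ + 4 * a
      ring = solve-∀
    go (no α≢s) = apex-omitted α s α≢s (total o s eq)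

  -- Both the parity and the residues modulo 3 single out the vertex p 4: the half sum M of the other
  -- vertices is then congruent modulo 2 to one of the sums, and each possibility is absurd.
  module Same (par : P ≡ p #4 [mod + 2 ]) (z : (P +ᵖ p #4) ≡ 0ᵖ [mod + 3 ]) (total≡ : totalV₂ A′ ≡ A′ #4) where

    o = others-of #4
    half : X o ≡ Y o [mod + 2 ]
    half = X≡Y o par

    M : Pt
    M = Y o +ᵖ _≡_[mod_].quotient half

    2M : ∀ t → M t + M t + p #4 t ≡ P t
    2M t = linear₂ (+ 1) (- + 1) (Others.sum o t) (_≡_[mod_].difference half t)
      (ring (X o t) (Y o t) (_≡_[mod_].quotient half t) (p #4 t) (P t))
      where
      ring : ∀ x y k e P → ((y + k) + (y + k) + e) - P ≡ + 1 * ((x + y + e) - P) + (- + 1) * (x - (y + + 2 * k))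
      ring = solve-∀

    M∈S : S M
    M∈S = S-mean ((1 , X o) ∷ (1 , Y o) ∷ []) M 1 refl
      (λ t → linear₁ (+ 1) (_≡_[mod_].difference half t) (ring (X o t) (Y o t) (_≡_[mod_].quotient half t)))
      (S-sum (Others.w o) (Others.x o) ∷ S-sum (Others.y o) (Others.z o) ∷ [])
      where
      ring : ∀ x y k → (+ 1 * x + (+ 1 * y + + 0)) - (+ 2 * (y + k)) ≡ + 1 * (x - (y + + 2 * k))
      ring = solve-∀

    coset : ∃[ i ] ∃[ j ] (p i +ᵖ p (inject₁ j)) ≡ M [mod + 2 ]
    coset = any-case covered λ i h → any-case h λ j h → i , j , sums i j (≟ᵇ₂-sound h)
      where
      M′ : Pt
      M′ = M -ᵖ + 2 *ᵖ p #0
      covered : (anyᶠ λ i → anyᶠ λ j → A′ i ⊞₂ A′ (inject₁ j) ≟ᵇ₂ lab₂ M′) ≡ true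
      covered = allV₂-elim (⇒-elim (allV₂-elim (allV₂-elim cosets u₂) v₂) (∧-intro guard₂ (≟ᵇ₂-refl total≡))) (lab₂ M′)
      sums : ∀ i j → A′ i ⊞₂ A′ (inject₁ j) ≡ lab₂ M′ → (p i +ᵖ p (inject₁ j)) ≡ M [mod + 2 ]
      sums i j e = unbase (R₂.Label.lab-inj ℓ₂ (trans (lab₂-+ (d i) (d (inject₁ j))) (trans (sym (cong₂ _⊞₂_ (A′-lab i) (A′-lab (inject₁ j)))) e)))
        where
        unbase : (d i +ᵖ d (inject₁ j)) ≡ M′ [mod + 2 ] → (p i +ᵖ p (inject₁ j)) ≡ M [mod + 2 ]
        unbase (k by f) = k by λ t → linear₁ (+ 1) (f t) (ring (p i t) (p (inject₁ j) t) (p #0 t) (M t) (k t))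
          where
          ring : ∀ i j a m k → (i + j) - (m + + 2 * k) ≡ + 1 * (((i - a) + (j - a)) - ((m - + 2 * a) + + 2 * k))
          ring = solve-∀

    private
      e : Pt
      e = p #4
      k : Pt
      k = _≡_[mod_].quotient z

      -- From `2 M + e = P` and `P + e ≡ 0` one gets `M ≡ - e` modulo 3. So `x`, `M`, `y` sum to
      -- zero modulo 3 as soon as `x + y ≡ e`, and `y` is the midpoint of `x` and `M`.
      centred : ∀ {x a} → S x → x ≡ M [mod + 2 ] → ∀ {y} → S y →
        (∀ t → x t + y t ≡ e t + + 3 * a t) → (x +ᵖ M) ≈ᶻ (y +ᵖ y)
      centred {x} {a} hx par′ {y} hy f = midpoint hx M∈S hy par′ ((a +ᵖ M +ᵖ e -ᵖ k) by λ t →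
          identity (x t) (y t) (a t) (M t) (e t) (P t) (k t) (f t) (2M t) (_≡_[mod_].difference z t))
        where
        ring : ∀ a m e P k → (e + + 3 * a + m) - (+ 0 + + 3 * (a + m + e - k)) ≡
          (- + 1) * ((m + m + e) - P) + (- + 1) * ((P + e) - (+ 0 + + 3 * k))
        ring = solve-∀
        comm : ∀ x m y → x + m + y ≡ x + y + m
        comm = solve-∀
        identity : ∀ x y a m e P k → x + y ≡ e + + 3 * a → m + m + e ≡ P → P + e ≡ + 0 + + 3 * k →
          x + m + y ≡ + 0 + + 3 * (a + m + e - k)
        identity x y a m e P k f g h = trans (comm x m y) (trans (cong (_+ m) f) (linear₂ (- + 1) (- + 1) g h (ring a m e P k)))

      -- The midpoint of `e + a` and `M` is `2 a`, whence `P = 6 a - e`. Then `a` is the mean of the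
      -- other four vertices with `e` counted twice.
      with-last : ∀ j → ¬ (e +ᵖ p (inject₁ j)) ≡ M [mod + 2 ]
      with-last j par′ = not-centre₅ o′ (inject≢4 j) (λ t → identity (X o′ t) (Y o′ t) (e t) (a t) (M t) (P t) (Others.sum o′ t) (2M t) (mid t))
        where
        a : Pt
        a = p (inject₁ j)
        o′ = others-of (inject₁ j)
        ring₀ : ∀ e a → (e + a) + (a + a) ≡ e + + 3 * a
        ring₀ = solve-∀
        mid : ((e +ᵖ a) +ᵖ M) ≈ᶻ ((a +ᵖ a) +ᵖ (a +ᵖ a))
        mid = centred {e +ᵖ a} {a} (S-sum #4 j) par′ {a +ᵖ a} (S-sum (inject₁ j) j) (λ t → ring₀ (e t) (a t))
        ring₁ : ∀ e a m P → P - (+ 6 * a - e) ≡ (- + 1) * ((m + m + e) - P) + + 2 * (((e + a) + m) - ((a + a) + (a + a)))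
        ring₁ = solve-∀
        ring₂ : ∀ x y e a P → (x + y + e) - + 5 * a ≡ + 1 * ((x + y + a) - P) + + 1 * (P - (+ 6 * a - e))
        ring₂ = solve-∀
        identity : ∀ x y e a m P → x + y + a ≡ P → m + m + e ≡ P → (e + a) + m ≡ (a + a) + (a + a) → x + y + e ≡ + 5 * a
        identity x y e a m P f g h = linear₂ {a′ = P} {b′ = + 6 * a - e} (+ 1) (+ 1) f (linear₂ (- + 1) (+ 2) g h (ring₁ e a m P)) (ring₂ x y e a P)

      -- The midpoint of `2 a` and `M` is `e + a`, whence `M = 2 e` and `P = 5 e`: the vertex `e` is
      -- the centroid of the other four.
      doubled : ∀ j → ¬ (p (inject₁ j) +ᵖ p (inject₁ j)) ≡ M [mod + 2 ]
      doubled j par′ = not-centre o (λ t → identity (X o t) (Y o t) (e t) (a t) (M t) (P t) (Others.sum o t) (2M t) (mid t))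
        where
        a : Pt
        a = p (inject₁ j)
        ring₀ : ∀ e a → (a + a) + (e + a) ≡ e + + 3 * a
        ring₀ = solve-∀
        mid : ((a +ᵖ a) +ᵖ M) ≈ᶻ ((e +ᵖ a) +ᵖ (e +ᵖ a))
        mid = centred {a +ᵖ a} {a} (S-sum (inject₁ j) j) par′ {e +ᵖ a} (S-sum #4 j) (λ t → ring₀ (e t) (a t))
        ring₁ : ∀ e a m P → P - (+ 5 * e) ≡ (- + 1) * ((m + m + e) - P) + + 2 * (((a + a) + m) - ((e + a) + (e + a)))
        ring₁ = solve-∀
        ring₂ : ∀ x y e P → (x + y) - + 4 * e ≡ + 1 * ((x + y + e) - P) + + 1 * (P - (+ 5 * e))
        ring₂ = solve-∀
        identity : ∀ x y e a m P → x + y + e ≡ P → m + m + e ≡ P → (a + a) + m ≡ (e + a) + (e + a) → x + y ≡ + 4 * e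
        identity x y e a m P f g h = linear₂ {a′ = P} {b′ = + 5 * e} (+ 1) (+ 1) f (linear₂ (- + 1) (+ 2) g h (ring₁ e a m P)) (ring₂ x y e P)

      -- Let `k`, `l` be the remaining two indices below 4. Then `M` is the midpoint of the two pair
      -- sums, so the segments joining it to them share an even difference vector. They must
      -- degenerate, and equal pair sums are a parallelogram in P.
      mixed : ∀ i j → ¬ i ≡ j → ¬ (p (inject₁ i) +ᵖ p (inject₁ j)) ≡ M [mod + 2 ]
      mixed i j i≢j par′ =
        let (k , l , h) = pick
            (i≢k , h) = ∧-elim {not (inject₁ i ==ᶠ inject₁ k)} h ; (i≢l , h) = ∧-elim {not (inject₁ i ==ᶠ inject₁ l)} h
        in conclude k l (≢-elim i≢k) (≢-elim i≢l) (λ t → covers-sum (inject₁ i ∷ inject₁ j ∷ inject₁ k ∷ inject₁ l ∷ #4 ∷ []) (λ n → p n t) h)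
        where
        pick : ∃[ k ] ∃[ l ] split i j k l ≡ true
        pick = [ (λ h → ⊥-elim (i≢j (==ᶠ-sound h))) , (λ h → any-case h λ k h → any-case h λ l h → k , l , h) ]′
          (∨-elim {i ==ᶠ j} (allᶠ-elim (allᶠ-elim split-exist i) j))
        conclude : ∀ k l → ¬ inject₁ i ≡ inject₁ k → ¬ inject₁ i ≡ inject₁ l →
          (∀ t → over (inject₁ i ∷ inject₁ j ∷ inject₁ k ∷ inject₁ l ∷ #4 ∷ []) (λ n → p n t) ≡ P t) → ⊥
        conclude k l i≢k i≢l sums = [ finish , finish ]′ (mod2 (S-sum (inject₁ i) j) M∈S M∈S (S-sum (inject₁ k) l) par′ balance)
          where
          ring : ∀ i j k l e m P → ((i + j) + (k + l)) - (m + m) ≡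
            + 1 * ((i + (j + (k + (l + (e + + 0))))) - P) + (- + 1) * ((m + m + e) - P)
          ring = solve-∀
          identity : ∀ i j k l e m P → i + (j + (k + (l + (e + + 0)))) ≡ P → m + m + e ≡ P → (i + j) + (k + l) ≡ m + m
          identity i j k l e m P f g = linear₂ (+ 1) (- + 1) f g (ring i j k l e m P)
          balance : ((p (inject₁ i) +ᵖ p (inject₁ j)) +ᵖ (p (inject₁ k) +ᵖ p (inject₁ l))) ≈ᶻ (M +ᵖ M)
          balance t = identity (p (inject₁ i) t) (p (inject₁ j) t) (p (inject₁ k) t) (p (inject₁ l) t) (e t) (M t) (P t) (sums t) (2M t)
          finish : ¬ (p (inject₁ i) +ᵖ p (inject₁ j)) ≈ᶻ M
          finish f = p-para {inject₁ i} {inject₁ j} {inject₁ k} {inject₁ l} i≢k i≢l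
            (λ t → identity′ (p (inject₁ i) t + p (inject₁ j) t) (p (inject₁ k) t + p (inject₁ l) t) (M t) (balance t) (f t))
            where
            ring′ : ∀ x y m → x - y ≡ (- + 1) * ((x + y) - (m + m)) + + 2 * (x - m)
            ring′ = solve-∀
            identity′ : ∀ x y m → x + y ≡ m + m → x ≡ m → x ≡ y
            identity′ x y m f g = linear₂ (- + 1) (+ 2) f g (ring′ x y m)

    absurd : ⊥
    absurd = let (i , j , par′) = coset in go i j par′ (last-or-inject i)
      where
      go′ : ∀ i j → (p (inject₁ i) +ᵖ p (inject₁ j)) ≡ M [mod + 2 ] → Dec (i ≡ j) → ⊥
      go′ i .i par′ (yes refl) = doubled i par′
      go′ i j par′ (no i≢j) = mixed i j i≢j par′
      go : ∀ i j → (p i +ᵖ p (inject₁ j)) ≡ M [mod + 2 ] → (∃[ a ] i ≡ inject₁ {4} a) ⊎ i ≡ #4 → ⊥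
      go _ j par′ (inj₁ (i , refl)) = go′ i j par′ (i Fin.≟ j)
      go _ j par′ (inj₂ refl) = with-last j par′

  shape : Shape p
  shape = choose (proj₁ apex) (proj₁ special) (proj₂ apex) (proj₂ special) (last-or-inject (proj₁ apex)) (last-or-inject (proj₁ special))
    where
    choose : ∀ α s → totalV₂ A′ ≡ A′ α → (P +ᵖ p s) ≡ 0ᵖ [mod + 3 ] →
      (∃[ a ] α ≡ inject₁ {4} a) ⊎ α ≡ #4 → (∃[ a ] s ≡ inject₁ {4} a) ⊎ s ≡ #4 → Shape p
    choose _ s e z (inj₁ (a , refl)) _ = ⊥-elim (no-inner-apex a s (apex-parity (inject₁ a) e) z)
    choose _ _ e z (inj₂ refl) (inj₂ refl) = ⊥-elim (Same.absurd (apex-parity #4 e) z e)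
    choose _ _ e z (inj₂ refl) (inj₁ (s , refl)) =
      any-case (allᶠ-elim bipyramid-exist s) λ i h → any-case h λ j h → any-case h λ k h →
      i , j , k , s , h , λ t → identity (p (inject₁ i) t) (p (inject₁ j) t) (p (inject₁ k) t) (p (inject₁ s) t) (p #4 t) (P t)
           (covers-sum (inject₁ i ∷ inject₁ j ∷ inject₁ k ∷ inject₁ s ∷ #4 ∷ []) (λ n → p n t) h)
           (total o (inject₁ s) (opposite o (inject₁ s) (apex-parity #4 e) z (S-resp (λ t → ℤₚ.+-comm (p #4 t) (p (inject₁ s) t)) (S-sum #4 s))) t)
      where
      o = others-of #4
      ring : ∀ i j k s e P → (i + j + k) - (s + e + e) ≡
        + 1 * ((i + (j + (k + (s + (e + + 0))))) - P) + + 1 * (P - (+ 2 * s + + 3 * e))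
      ring = solve-∀
      identity : ∀ i j k s e P → i + (j + (k + (s + (e + + 0)))) ≡ P → P ≡ + 2 * s + + 3 * e → i + j + k ≡ s + e + e
      identity i j k s e P f g = linear₂ (+ 1) (+ 1) f g (ring i j k s e P)

-- The lattice generated by the edges at the apex

module R₃ = Residue residues₃

-- Coordinates of the sums of a vertex of E and a vertex of S₂; they lie in {0, 1, 2}³, which is identified with F₃³.
isSum : V₃ → Bool
isSum (vec 𝟏 𝟎 𝟎) = true
isSum (vec 𝟎 𝟏 𝟎) = true
isSum (vec 𝟎 𝟎 𝟏) = true
isSum (vec 𝟏 𝟏 𝟏) = true
isSum (vec 𝟐 𝟎 𝟎) = true
isSum (vec 𝟎 𝟐 𝟎) = true
isSum (vec 𝟎 𝟎 𝟐) = true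
isSum (vec 𝟏 𝟏 𝟎) = true
isSum (vec 𝟏 𝟎 𝟏) = true
isSum (vec 𝟎 𝟏 𝟏) = true
isSum (vec 𝟐 𝟏 𝟏) = true
isSum (vec 𝟏 𝟐 𝟏) = true
isSum (vec 𝟏 𝟏 𝟐) = true
isSum (vec 𝟐 𝟐 𝟐) = true
isSum _ = false

unit co-unit : Fin 3 → V₃
unit zero = vec 𝟏 𝟎 𝟎
unit (suc zero) = vec 𝟎 𝟏 𝟎
unit (suc (suc zero)) = vec 𝟎 𝟎 𝟏
co-unit zero = vec 𝟎 𝟏 𝟏
co-unit (suc zero) = vec 𝟏 𝟎 𝟏
co-unit (suc (suc zero)) = vec 𝟏 𝟏 𝟎

1₃ : V₃
1₃ = vec 𝟏 𝟏 𝟏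

opaque
  unfolding _⊞₂_ _≟ᵇ₂_

  -- `f` and `g` are the residues of a point and of its reflection in the cube, lying in the corners
  -- `k` and `l`. The six terms are the translates that these two corners put into S.
  corners-clash : (allV₃ λ f → allV₃ λ g → (f ⊞₃ g ≟ᵇ₃ 1₃) ⇒ allᶠ λ (k : Fin 3) → allᶠ λ (l : Fin 3) → (k ==ᶠ l) ∨
    isSum (f ⊞₃ 0₃) ∨ isSum (f ⊞₃ unit k) ∨ isSum (f ⊞₃ co-unit l) ∨
    isSum (g ⊞₃ 0₃) ∨ isSum (g ⊞₃ unit l) ∨ isSum (g ⊞₃ co-unit k)) ≡ true
  corners-clash = refl

det : Pt → Pt → Pt → ℤ
det u v w = u #0 * (v #1 * w #2 - v #2 * w #1) - u #1 * (v #0 * w #2 - v #2 * w #0)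
  + u #2 * (v #0 * w #1 - v #1 * w #0)

module Lattice (b₁ b₂ b₃ : Pt) where

  L : ℤ → ℤ → ℤ → Pt
  L x y z t = x * b₁ t + y * b₂ t + z * b₃ t

  Lᵛ : V₃ → Pt
  Lᵛ c = L (rep₃ (coord c #0)) (rep₃ (coord c #1)) (rep₃ (coord c #2))

  Member : Pt → Set
  Member z = ∃[ x ] ∃[ y ] ∃[ w ] z ≈ᶻ L x y w

  cramer : ∀ z → (det b₁ b₂ b₃ *ᵖ z) ≈ᶻ L (det z b₂ b₃) (det b₁ z b₃) (det b₁ b₂ z)
  cramer z #0 = ring (b₁ #0) (b₁ #1) (b₁ #2) (b₂ #0) (b₂ #1) (b₂ #2) (b₃ #0) (b₃ #1) (b₃ #2) (z #0) (z #1) (z #2)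
    where
    ring : ∀ a b c d e f g h i x y z →
      (a * (e * i - f * h) - b * (d * i - f * g) + c * (d * h - e * g)) * x ≡
      (x * (e * i - f * h) - y * (d * i - f * g) + z * (d * h - e * g)) * a +
      (a * (y * i - z * h) - b * (x * i - z * g) + c * (x * h - y * g)) * d +
      (a * (e * z - f * y) - b * (d * z - f * x) + c * (d * y - e * x)) * g
    ring = solve-∀
  cramer z #1 = ring (b₁ #0) (b₁ #1) (b₁ #2) (b₂ #0) (b₂ #1) (b₂ #2) (b₃ #0) (b₃ #1) (b₃ #2) (z #0) (z #1) (z #2)
    where
    ring : ∀ a b c d e f g h i x y z →
      (a * (e * i - f * h) - b * (d * i - f * g) + c * (d * h - e * g)) * y ≡
      (x * (e * i - f * h) - y * (d * i - f * g) + z * (d * h - e * g)) * b +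
      (a * (y * i - z * h) - b * (x * i - z * g) + c * (x * h - y * g)) * e +
      (a * (e * z - f * y) - b * (d * z - f * x) + c * (d * y - e * x)) * h
    ring = solve-∀
  cramer z #2 = ring (b₁ #0) (b₁ #1) (b₁ #2) (b₂ #0) (b₂ #1) (b₂ #2) (b₃ #0) (b₃ #1) (b₃ #2) (z #0) (z #1) (z #2)
    where
    ring : ∀ a b c d e f g h i x y z →
      (a * (e * i - f * h) - b * (d * i - f * g) + c * (d * h - e * g)) * z ≡
      (x * (e * i - f * h) - y * (d * i - f * g) + z * (d * h - e * g)) * c +
      (a * (y * i - z * h) - b * (x * i - z * g) + c * (x * h - y * g)) * f +
      (a * (e * z - f * y) - b * (d * z - f * x) + c * (d * y - e * x)) * i
    ring = solve-∀

  module Independent (indep : ∀ x y w → L x y w ≡ 0ᵖ [mod + 3 ] → x ≡ + 0 [modℤ + 3 ] × y ≡ + 0 [modℤ + 3 ] × w ≡ + 0 [modℤ + 3 ]) where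

    -- Otherwise Cramer's rule gives a vanishing combination for every `z`, so `det z b₂ b₃ ≡ 0`.
    -- For unit vectors `z` these are the 2 by 2 minors of `b₂`, `b₃`, and they say that `b₃ s`
    -- times `b₂` is `b₂ s` times `b₃`. Independence then makes every coordinate `b₂ s` vanish,
    -- which it also forbids.
    det≢0 : ¬ det b₁ b₂ b₃ ≡ + 0 [modℤ + 3 ]
    det≢0 (m by e) = 1≢0 (proj₁ (proj₂ (indep (+ 0) (+ 1) (+ 0) b₂≡0)))
      where
      1≢0 : ¬ + 1 ≡ + 0 [modℤ + 3 ]
      1≢0 (k by f) = absurd (small-multiple 3 (+ 1) (+ 0) k (s≤s (s≤s z≤n)) f)
        where
        absurd : ¬ (+ 1) ≡ (+ 0)
        absurd ()
      minor : ∀ z → det z b₂ b₃ ≡ + 0 [modℤ + 3 ]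
      minor z = proj₁ (indep (det z b₂ b₃) (det b₁ z b₃) (det b₁ b₂ z) ((m *ᵖ z) by λ t → trans (sym (cramer z t)) (trans (cong (_* z t) e) (ring m (z t)))))
        where
        ring : ∀ m z → (+ 0 + + 3 * m) * z ≡ + 0 + + 3 * (m * z)
        ring = solve-∀
      negate : ∀ {a} → a ≡ + 0 [modℤ + 3 ] → (- a) ≡ + 0 [modℤ + 3 ]
      negate {a} h = c-trans (c-refl (ring a)) (c-trans (c-* (- + 1) h) (c-refl refl))
        where
        ring : ∀ a → - a ≡ (- + 1) * a
        ring = solve-∀
      cross : ∀ s t → (b₃ s * b₂ t - b₂ s * b₃ t) ≡ + 0 [modℤ + 3 ]
      cross #0 #0 = c-refl (ring (b₃ #0) (b₂ #0))
        where
        ring : ∀ x y → x * y - y * x ≡ + 0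
        ring = solve-∀
      cross #1 #1 = c-refl (ring (b₃ #1) (b₂ #1))
        where
        ring : ∀ x y → x * y - y * x ≡ + 0
        ring = solve-∀
      cross #2 #2 = c-refl (ring (b₃ #2) (b₂ #2))
        where
        ring : ∀ x y → x * y - y * x ≡ + 0
        ring = solve-∀
      cross #0 #1 = c-trans (c-refl (ring (b₂ #0) (b₂ #1) (b₂ #2) (b₃ #0) (b₃ #1) (b₃ #2))) (negate (minor (δ #2)))
        where
        ring : ∀ d e f g h i → g * e - d * h ≡ - (+ 0 * (e * i - f * h) - + 0 * (d * i - f * g) + + 1 * (d * h - e * g))
        ring = solve-∀
      cross #1 #0 = c-trans (c-refl (ring (b₂ #0) (b₂ #1) (b₂ #2) (b₃ #0) (b₃ #1) (b₃ #2))) (minor (δ #2))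
        where
        ring : ∀ d e f g h i → h * d - e * g ≡ (+ 0 * (e * i - f * h) - + 0 * (d * i - f * g) + + 1 * (d * h - e * g))
        ring = solve-∀
      cross #0 #2 = c-trans (c-refl (ring (b₂ #0) (b₂ #1) (b₂ #2) (b₃ #0) (b₃ #1) (b₃ #2))) (minor (δ #1))
        where
        ring : ∀ d e f g h i → g * f - d * i ≡ (+ 0 * (e * i - f * h) - + 1 * (d * i - f * g) + + 0 * (d * h - e * g))
        ring = solve-∀
      cross #2 #0 = c-trans (c-refl (ring (b₂ #0) (b₂ #1) (b₂ #2) (b₃ #0) (b₃ #1) (b₃ #2))) (negate (minor (δ #1)))
        where
        ring : ∀ d e f g h i → i * d - f * g ≡ - (+ 0 * (e * i - f * h) - + 1 * (d * i - f * g) + + 0 * (d * h - e * g))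
        ring = solve-∀
      cross #1 #2 = c-trans (c-refl (ring (b₂ #0) (b₂ #1) (b₂ #2) (b₃ #0) (b₃ #1) (b₃ #2))) (negate (minor (δ #0)))
        where
        ring : ∀ d e f g h i → h * f - e * i ≡ - (+ 1 * (e * i - f * h) - + 0 * (d * i - f * g) + + 0 * (d * h - e * g))
        ring = solve-∀
      cross #2 #1 = c-trans (c-refl (ring (b₂ #0) (b₂ #1) (b₂ #2) (b₃ #0) (b₃ #1) (b₃ #2))) (minor (δ #0))
        where
        ring : ∀ d e f g h i → i * e - f * h ≡ (+ 1 * (e * i - f * h) - + 0 * (d * i - f * g) + + 0 * (d * h - e * g))
        ring = solve-∀
      b₂≡0 : L (+ 0) (+ 1) (+ 0) ≡ 0ᵖ [mod + 3 ]
      b₂≡0 = assemble λ s → c-trans (c-refl (one (b₁ s) (b₂ s) (b₃ s)))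
          (c-trans (c-refl (sym (ℤₚ.neg-involutive (b₂ s)))) (negate (proj₂ (proj₂ (indep (+ 0) (b₃ s) (- b₂ s)
            (assemble λ t → c-trans (c-refl (two (b₁ t) (b₃ s) (b₂ t) (b₂ s) (b₃ t))) (cross s t)))))))
        where
        one : ∀ x y z → + 0 * x + + 1 * y + + 0 * z ≡ y
        one = solve-∀
        two : ∀ x a y b z → + 0 * x + a * y + (- b) * z ≡ a * y - b * z
        two = solve-∀

    -- The witness `suc N` is the absolute value of the determinant, with the coordinates from
    -- Cramer's rule.
    denominator : ∃[ N ] ((∀ z → ∃[ x ] ∃[ y ] ∃[ w ] (+ suc N *ᵖ z) ≈ᶻ L x y w) × ¬ + suc N ≡ + 0 [modℤ + 3 ])
    denominator = go (det b₁ b₂ b₃) refl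
      where
      go : ∀ D → det b₁ b₂ b₃ ≡ D → ∃[ N ] ((∀ z → ∃[ x ] ∃[ y ] ∃[ w ] (+ suc N *ᵖ z) ≈ᶻ L x y w) × ¬ + suc N ≡ + 0 [modℤ + 3 ])
      go (+ zero) e = ⊥-elim (det≢0 (c-refl e))
      go (+ suc N) e = N , (λ z → det z b₂ b₃ , det b₁ z b₃ , det b₁ b₂ z , λ t → trans (cong (_* z t) (sym e)) (cramer z t)) , λ h → det≢0 (c-trans (c-refl e) h)
      go -[1+ N ] e = N , (λ z → - det z b₂ b₃ , - det b₁ z b₃ , - det b₁ b₂ z , λ t →
          trans (neg (+ suc N) (z t)) (trans (cong (λ D → - (D * z t)) (sym e)) (trans (cong -_ (cramer z t))
            (ring (det z b₂ b₃) (det b₁ z b₃) (det b₁ b₂ z) (b₁ t) (b₂ t) (b₃ t))))) ,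
        λ h → det≢0 (c-trans (c-refl e) (c-trans (c-refl (sym (ℤₚ.*-identityˡ _))) (c-trans (c-refl (flip (+ suc N))) (c-trans (c-* (- + 1) h) (c-refl refl)))))
        where
        neg : ∀ n z → n * z ≡ - ((- n) * z)
        neg = solve-∀
        flip : ∀ n → + 1 * (- n) ≡ (- + 1) * n
        flip = solve-∀
        ring : ∀ x y z a b c → - (x * a + y * b + z * c) ≡ (- x) * a + (- y) * b + (- z) * c
        ring = solve-∀

  L-+ : ∀ x y w x′ y′ w′ → (L x y w +ᵖ L x′ y′ w′) ≈ᶻ L (x + x′) (y + y′) (w + w′)
  L-+ x y w x′ y′ w′ t = ring x y w x′ y′ w′ (b₁ t) (b₂ t) (b₃ t)
    where
    ring : ∀ x y w x′ y′ w′ a b c → (x * a + y * b + w * c) + (x′ * a + y′ * b + w′ * c) ≡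
      (x + x′) * a + (y + y′) * b + (w + w′) * c
    ring = solve-∀

  L-≡ : ∀ {x y w x′ y′ w′} → x ≡ x′ [modℤ + 3 ] → y ≡ y′ [modℤ + 3 ] → w ≡ w′ [modℤ + 3 ] → L x y w ≡ L x′ y′ w′ [mod + 3 ]
  L-≡ {x} {y} {w} {x′} {y′} {w′} (k by e) (l by f) (m by g) = L k l m by λ t →
    trans (cong₂ _+_ (cong₂ _+_ (cong (_* b₁ t) e) (cong (_* b₂ t) f)) (cong (_* b₃ t) g))
      (ring x′ y′ w′ k l m (b₁ t) (b₂ t) (b₃ t))
    where
    ring : ∀ x y w k l m a b c → (x + + 3 * k) * a + (y + + 3 * l) * b + (w + + 3 * m) * c ≡
      (x * a + y * b + w * c) + + 3 * (k * a + l * b + m * c)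
    ring = solve-∀

  residue-add : ∀ c λ′ → (Lᵛ c +ᵖ Lᵛ λ′) ≡ Lᵛ (c ⊞₃ λ′) [mod + 3 ]
  residue-add (vec a b c) (vec x y z) rewrite ⊞₃-zip (vec a b c) (vec x y z) =
    lift (L-+ (rep₃ a) (rep₃ b) (rep₃ c) (rep₃ x) (rep₃ y) (rep₃ z)) (L-≡ (hom a x) (hom b y) (hom c z))
    where
    open Residues residues₃ using (hom)
    lift : ∀ {x y z} → x ≈ᶻ y → y ≡ z [mod + 3 ] → x ≡ z [mod + 3 ]
    lift e (k by f) = k by λ t → trans (e t) (f t)

module Translates (r b₁ b₂ b₃ : Pt) (S : Pt → Set)
  (mod3 : ∀ {x y} → S x → S y → x ≡ y [mod + 3 ] → x ≈ᶻ y)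
  (sums : ∀ c → isSum c ≡ true → S (r +ᵖ r +ᵖ Lattice.Lᵛ b₁ b₂ b₃ c))
  (indep : ∀ x y w → Lattice.L b₁ b₂ b₃ x y w ≡ 0ᵖ [mod + 3 ] → x ≡ + 0 [modℤ + 3 ] × y ≡ + 0 [modℤ + 3 ] × w ≡ + 0 [modℤ + 3 ])
  where
  open Lattice b₁ b₂ b₃
  open Independent indep

  2r : Pt
  2r = r +ᵖ r

  -- The denominator `D` satisfies `D * D ≡ 1` modulo 3, so `z` is congruent to `D` times the
  -- combination `D z`.
  residue-of : ∀ z → ∃[ f ] z ≡ Lᵛ f [mod + 3 ]
  residue-of z = go (denominator)
    where
    open Residues residues₃ using (rep)
    go : (∃[ N ] ((∀ z → ∃[ x ] ∃[ y ] ∃[ w ] (+ suc N *ᵖ z) ≈ᶻ L x y w) × ¬ + suc N ≡ + 0 [modℤ + 3 ])) → ∃[ f ] z ≡ Lᵛ f [mod + 3 ]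
    go (N , coords , N≢0) = invert (R₃.zero? (+ suc N))
      where
      D = + suc N
      x = proj₁ (coords z)
      y = proj₁ (proj₂ (coords z))
      w = proj₁ (proj₂ (proj₂ (coords z)))
      e = proj₂ (proj₂ (proj₂ (coords z)))
      fx = rep (D * x)
      fy = rep (D * y)
      fw = rep (D * w)
      invert : (D ≡ + 0 [modℤ + 3 ]) ⊎ (D * D ≡ + 1 [modℤ + 3 ]) → ∃[ f ] z ≡ Lᵛ f [mod + 3 ]
      invert (inj₁ h) = ⊥-elim (N≢0 h)
      invert (inj₂ (k by h)) = vec (proj₁ fx) (proj₁ fy) (proj₁ fw) ,
        R₃.p-trans {y = L (D * x) (D * y) (D * w)}
          ((- k *ᵖ z) by λ t → linear₂ (- (z t)) D h (e t) (ring D k (z t) x y w (b₁ t) (b₂ t) (b₃ t)))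
          (L-≡ (proj₂ fx) (proj₂ fy) (proj₂ fw))
        where
        ring : ∀ D k z x y w a b c → z - (((D * x) * a + (D * y) * b + (D * w) * c) + + 3 * ((- k) * z)) ≡
          (- z) * (D * D - (+ 1 + + 3 * k)) + D * (D * z - (x * a + y * b + w * c))
        ring = solve-∀

  -- The translate of `z` and a vertex sum have the same residue, so they are equal, and `z` is a
  -- difference of two lattice combinations.
  meets-sum : ∀ {z f} λ′ → z ≡ Lᵛ f [mod + 3 ] → S (2r +ᵖ z +ᵖ Lᵛ λ′) → isSum (f ⊞₃ λ′) ≡ true → Member z
  meets-sum {z} {f} λ′ (k by e) h t∈ = rep₃ (coord c #0) - rep₃ (coord λ′ #0) , rep₃ (coord c #1) - rep₃ (coord λ′ #1) , rep₃ (coord c #2) - rep₃ (coord λ′ #2) , λ t →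
      linear₁ (+ 1) (mod3 h (sums (f ⊞₃ λ′) t∈) (combine (residue-add f λ′)) t)
        (ring (r t) (z t) (rep₃ (coord c #0)) (rep₃ (coord c #1)) (rep₃ (coord c #2))
          (rep₃ (coord λ′ #0)) (rep₃ (coord λ′ #1)) (rep₃ (coord λ′ #2)) (b₁ t) (b₂ t) (b₃ t))
    where
    c = f ⊞₃ λ′
    combine : (Lᵛ f +ᵖ Lᵛ λ′) ≡ Lᵛ c [mod + 3 ] → (2r +ᵖ z +ᵖ Lᵛ λ′) ≡ (2r +ᵖ Lᵛ c) [mod + 3 ]
    combine (l by g) = (k +ᵖ l) by λ t → linear₂ (+ 1) (+ 1) (e t) (g t) (ring₀ (2r t) (z t) (Lᵛ λ′ t) (Lᵛ f t) (Lᵛ c t) (k t) (l t))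
      where
      ring₀ : ∀ r z m f c k l → (r + z + m) - ((r + c) + + 3 * (k + l)) ≡
        + 1 * (z - (f + + 3 * k)) + + 1 * ((f + m) - (c + + 3 * l))
      ring₀ = solve-∀
    ring : ∀ r z x y w x′ y′ w′ a b c → z - ((x - x′) * a + (y - y′) * b + (w - w′) * c) ≡
      + 1 * ((r + r + z + (x′ * a + y′ * b + w′ * c)) - (r + r + (x * a + y * b + w * c)))
    ring = solve-∀

permute₀ permute₁ : V₃ → V₃
permute₀ (vec a b c) = vec c a b
permute₁ (vec a b c) = vec a c b

opaque
  unfolding _≟ᵇ₂_
  -- This symmetry reduces all three corners of the cube to one by reordering the basis.
  isSum-permute : (allV₃ λ c → isSum c ⇒ isSum (permute₀ c) ∧ isSum (permute₁ c)) ≡ true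
  isSum-permute = refl

-- The point with coordinates x / D lies in the tetrahedron cut off the cube at e₁ + e₂ by the plane x₁ + x₂ = 1 + x₃.
module Corner (r b₁ b₂ b₃ : Pt) (S : Pt → Set)
  (S-resp  : ∀ {x y} → x ≈ᶻ y → S x → S y)
  (S-mean  : ∀ L z N → Σw L ≡ suc N → Σp L ≈ᶻ (+ suc N *ᵖ z) → All (λ nx → S (proj₂ nx)) L → S z)
  (sums : ∀ c → isSum c ≡ true → S (r +ᵖ r +ᵖ Lattice.Lᵛ b₁ b₂ b₃ c))
  {N x₁ x₂ x₃ m₁ m₂ n : ℕ} (e₁ : x₁ ℕ.+ m₁ ≡ suc N) (e₂ : x₂ ℕ.+ m₂ ≡ suc N) (e₃ : x₁ ℕ.+ x₂ ≡ suc N ℕ.+ x₃ ℕ.+ n)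
  (z : Pt) (ez : ∀ t → + suc N * z t ≡ + x₁ * b₁ t + + x₂ * b₂ t + + x₃ * b₃ t)
  where

  private
    weights : + n + (+ x₃ + (+ m₂ + (+ m₁ + + 0))) ≡ + suc N
    weights = linear₃ (+ 1) (+ 1) (- + 1) (cong +_ e₁) (cong +_ e₂) (cong +_ e₃) (ring (+ x₁) (+ x₂) (+ x₃) (+ m₁) (+ m₂) (+ n) (+ suc N))
      where
      ring : ∀ x y w m l n D → (n + (w + (l + (m + + 0)))) - D ≡
        + 1 * ((x + m) - D) + + 1 * ((y + l) - D) + (- + 1) * ((x + y) - (D + w + n))
      ring = solve-∀

    -- The barycentric coordinates of `z` in the corner tetrahedron are `n`, `x₃`, `m₂`, `m₁` over
    -- `suc N`; `n` measures the distance from the cutting plane.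
    corner⁺ : ∀ o → S (o +ᵖ b₁ +ᵖ b₂) → S (o +ᵖ b₁ +ᵖ b₂ +ᵖ b₃) → S (o +ᵖ b₁) → S (o +ᵖ b₂) → S (o +ᵖ z)
    corner⁺ o h₁ h₂ h₃ h₄ = S-mean ((n , (o +ᵖ b₁ +ᵖ b₂)) ∷ (x₃ , (o +ᵖ b₁ +ᵖ b₂ +ᵖ b₃)) ∷ (m₂ , (o +ᵖ b₁)) ∷ (m₁ , (o +ᵖ b₂)) ∷ [])
      (o +ᵖ z) N (ℤₚ.+-injective weights)
      (λ t → linear₄ (o t + b₁ t + b₂ t) (- b₁ t) (- b₂ t) (- + 1) weights (cong +_ e₁) (cong +_ e₂) (ez t)
        (ring (+ x₁) (+ x₂) (+ x₃) (+ m₁) (+ m₂) (+ n) (+ suc N) (o t) (b₁ t) (b₂ t) (b₃ t) (z t)))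
      (h₁ ∷ h₂ ∷ h₃ ∷ h₄ ∷ [])
      where
      ring : ∀ x y w m l n D o a b c z →
        (n * (o + a + b) + (w * (o + a + b + c) + (l * (o + a) + (m * (o + b) + + 0)))) - D * (o + z) ≡
        (o + a + b) * ((n + (w + (l + (m + + 0)))) - D) + (- a) * ((x + m) - D)
          + (- b) * ((y + l) - D) + (- + 1) * (D * z - (x * a + y * b + w * c))
      ring = solve-∀

    -- The same weights on the tetrahedron reflected through the centre of the cube.
    corner⁻ : ∀ o → S (o +ᵖ b₃) → S o → S (o +ᵖ b₂ +ᵖ b₃) → S (o +ᵖ b₁ +ᵖ b₃) → S (o +ᵖ (b₁ +ᵖ b₂ +ᵖ b₃ -ᵖ z))
    corner⁻ o h₁ h₂ h₃ h₄ = S-mean ((n , (o +ᵖ b₃)) ∷ (x₃ , o) ∷ (m₂ , (o +ᵖ b₂ +ᵖ b₃)) ∷ (m₁ , (o +ᵖ b₁ +ᵖ b₃)) ∷ [])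
      (o +ᵖ (b₁ +ᵖ b₂ +ᵖ b₃ -ᵖ z)) N (ℤₚ.+-injective weights)
      (λ t → linear₄ (o t + b₃ t) (b₁ t) (b₂ t) (+ 1) weights (cong +_ e₁) (cong +_ e₂) (ez t)
        (ring (+ x₁) (+ x₂) (+ x₃) (+ m₁) (+ m₂) (+ n) (+ suc N) (o t) (b₁ t) (b₂ t) (b₃ t) (z t)))
      (h₁ ∷ h₂ ∷ h₃ ∷ h₄ ∷ [])
      where
      ring : ∀ x y w m l n D o a b c z →
        (n * (o + c) + (w * o + (l * (o + b + c) + (m * (o + a + c) + + 0)))) - D * (o + (a + b + c - z)) ≡
        (o + c) * ((n + (w + (l + (m + + 0)))) - D) + a * ((x + m) - D)
          + b * ((y + l) - D) + (+ 1) * (D * z - (x * a + y * b + w * c))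
      ring = solve-∀

    o : Pt
    o = r +ᵖ r

    fact : ∀ c {x} → isSum c ≡ true → (∀ t → o t + Lattice.Lᵛ b₁ b₂ b₃ c t ≡ x t) → S x
    fact c h f = S-resp f (sums c h)

  member₀ : S (o +ᵖ z)
  member₀ = corner⁺ o (fact (vec 𝟏 𝟏 𝟎) refl λ t → ring₁ (o t) (b₁ t) (b₂ t) (b₃ t)) (fact (vec 𝟏 𝟏 𝟏) refl λ t → ring₂ (o t) (b₁ t) (b₂ t) (b₃ t))
    (fact (vec 𝟏 𝟎 𝟎) refl λ t → ring₃ (o t) (b₁ t) (b₂ t) (b₃ t)) (fact (vec 𝟎 𝟏 𝟎) refl λ t → ring₄ (o t) (b₁ t) (b₂ t) (b₃ t))
    where
    ring₁ : ∀ o a b c → o + (+ 1 * a + + 1 * b + + 0 * c) ≡ o + a + b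
    ring₁ = solve-∀
    ring₂ : ∀ o a b c → o + (+ 1 * a + + 1 * b + + 1 * c) ≡ o + a + b + c
    ring₂ = solve-∀
    ring₃ : ∀ o a b c → o + (+ 1 * a + + 0 * b + + 0 * c) ≡ o + a
    ring₃ = solve-∀
    ring₄ : ∀ o a b c → o + (+ 0 * a + + 1 * b + + 0 * c) ≡ o + b
    ring₄ = solve-∀

  member₁ : S (o +ᵖ b₃ +ᵖ z)
  member₁ = corner⁺ (o +ᵖ b₃) (fact (vec 𝟏 𝟏 𝟏) refl λ t → ring₁ (o t) (b₁ t) (b₂ t) (b₃ t)) (fact (vec 𝟏 𝟏 𝟐) refl λ t → ring₂ (o t) (b₁ t) (b₂ t) (b₃ t))
    (fact (vec 𝟏 𝟎 𝟏) refl λ t → ring₃ (o t) (b₁ t) (b₂ t) (b₃ t)) (fact (vec 𝟎 𝟏 𝟏) refl λ t → ring₄ (o t) (b₁ t) (b₂ t) (b₃ t))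
    where
    ring₁ : ∀ o a b c → o + (+ 1 * a + + 1 * b + + 1 * c) ≡ o + c + a + b
    ring₁ = solve-∀
    ring₂ : ∀ o a b c → o + (+ 1 * a + + 1 * b + + 2 * c) ≡ o + c + a + b + c
    ring₂ = solve-∀
    ring₃ : ∀ o a b c → o + (+ 1 * a + + 0 * b + + 1 * c) ≡ o + c + a
    ring₃ = solve-∀
    ring₄ : ∀ o a b c → o + (+ 0 * a + + 1 * b + + 1 * c) ≡ o + c + b
    ring₄ = solve-∀

  member₂ : S (o +ᵖ b₁ +ᵖ b₂ +ᵖ (b₁ +ᵖ b₂ +ᵖ b₃ -ᵖ z))
  member₂ = corner⁻ (o +ᵖ b₁ +ᵖ b₂) (fact (vec 𝟏 𝟏 𝟏) refl λ t → ring₁ (o t) (b₁ t) (b₂ t) (b₃ t)) (fact (vec 𝟏 𝟏 𝟎) refl λ t → ring₂ (o t) (b₁ t) (b₂ t) (b₃ t))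
    (fact (vec 𝟏 𝟐 𝟏) refl λ t → ring₃ (o t) (b₁ t) (b₂ t) (b₃ t)) (fact (vec 𝟐 𝟏 𝟏) refl λ t → ring₄ (o t) (b₁ t) (b₂ t) (b₃ t))
    where
    ring₁ : ∀ o a b c → o + (+ 1 * a + + 1 * b + + 1 * c) ≡ o + a + b + c
    ring₁ = solve-∀
    ring₂ : ∀ o a b c → o + (+ 1 * a + + 1 * b + + 0 * c) ≡ o + a + b
    ring₂ = solve-∀
    ring₃ : ∀ o a b c → o + (+ 1 * a + + 2 * b + + 1 * c) ≡ o + a + b + b + c
    ring₃ = solve-∀
    ring₄ : ∀ o a b c → o + (+ 2 * a + + 1 * b + + 1 * c) ≡ o + a + b + a + c
    ring₄ = solve-∀

pairSum : (Fin 3 → ℕ) → Fin 3 → ℕ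
pairSum x zero = x #1 ℕ.+ x #2
pairSum x (suc zero) = x #0 ℕ.+ x #2
pairSum x (suc (suc zero)) = x #0 ℕ.+ x #1

-- Every lattice point is an integral combination of b₁, b₂, b₃, where P has the vertices
-- r, r + b₁, r + b₂, r + b₃, r + b₁ + b₂ + b₃ and Q is a translate of the last four.
module Generation (r b₁ b₂ b₃ : Pt) (S SP : Pt → Set)
  (S-resp  : ∀ {x y} → x ≈ᶻ y → S x → S y)
  (S-mean  : ∀ L z N → Σw L ≡ suc N → Σp L ≈ᶻ (+ suc N *ᵖ z) → All (λ nx → S (proj₂ nx)) L → S z)
  (SP-mean : ∀ L z N → Σw L ≡ suc N → Σp L ≈ᶻ (+ suc N *ᵖ z) → All (λ nx → SP (proj₂ nx)) L → SP z)
  (mod3 : ∀ {x y} → S x → S y → x ≡ y [mod + 3 ] → x ≈ᶻ y)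
  (sums : ∀ c → isSum c ≡ true → S (r +ᵖ r +ᵖ Lattice.Lᵛ b₁ b₂ b₃ c))
  (SP₀ : SP r) (SP₁ : SP (r +ᵖ b₁)) (SP₂ : SP (r +ᵖ b₂)) (SP₃ : SP (r +ᵖ b₃)) (SP₄ : SP (r +ᵖ b₁ +ᵖ b₂ +ᵖ b₃))
  (SP⇒ : ∀ {z} → SP (r +ᵖ z) → Lattice.Member b₁ b₂ b₃ z)
  (indep : ∀ x y w → Lattice.L b₁ b₂ b₃ x y w ≡ 0ᵖ [mod + 3 ] → x ≡ + 0 [modℤ + 3 ] × y ≡ + 0 [modℤ + 3 ] × w ≡ + 0 [modℤ + 3 ])
  where
  open Lattice b₁ b₂ b₃
  open Independent indep
  open Translates r b₁ b₂ b₃ S mod3 sums indep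

  -- A point of the cube with coordinates `x / suc N`. Carrying the complement `m` turns the upper
  -- bounds into equations, and reflection just exchanges `x` and `m`.
  record Coset (N : ℕ) (z : Pt) (x m : Fin 3 → ℕ) : Set where
    field
      complement : ∀ i → x i ℕ.+ m i ≡ suc N
      coords     : ∀ t → + suc N * z t ≡ + x #0 * b₁ t + + x #1 * b₂ t + + x #2 * b₃ t

  s : Pt
  s = b₁ +ᵖ b₂ +ᵖ b₃

  opposite : ∀ {N z x m} → Coset N z x m → Coset N (s -ᵖ z) m x
  opposite {N} {z} {x} {m} c = record
    { complement = λ i → trans (ℕₚ.+-comm (m i) (x i)) (complement i)
    ; coords = λ t → linear₄ (- b₁ t) (- b₂ t) (- b₃ t) (- + 1) (cong +_ (complement #0)) (cong +_ (complement #1)) (cong +_ (complement #2)) (coords t)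
        (ring (+ suc N) (+ x #0) (+ x #1) (+ x #2) (+ m #0) (+ m #1) (+ m #2) (b₁ t) (b₂ t) (b₃ t) (z t)) }
    where
    open Coset c
    ring : ∀ D x y w m l k a b c z → D * (a + b + c - z) - (m * a + l * b + k * c) ≡
      (- a) * ((x + m) - D) + (- b) * ((y + l) - D) + (- c) * ((w + k) - D)
        + (- + 1) * (D * z - (x * a + y * b + w * c))
    ring = solve-∀

  -- The two sides of the plane that cuts off corner `k`, both including the plane, with the slack
  -- as witness.
  Excess Flat : ℕ → (Fin 3 → ℕ) → Fin 3 → Set
  Excess N x k = ∃[ n ] pairSum x k ≡ suc N ℕ.+ x k ℕ.+ n
  Flat N x k = ∃[ c ] suc N ℕ.+ x k ≡ pairSum x k ℕ.+ c

  excess-or-flat : ∀ N x k → Excess N x k ⊎ Flat N x k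
  excess-or-flat N x k = [ (λ h → inj₁ (pairSum x k ℕ.∸ (suc N ℕ.+ x k) , sym (ℕₚ.m+[n∸m]≡n h)))
                         , (λ h → inj₂ (suc N ℕ.+ x k ℕ.∸ pairSum x k , sym (ℕₚ.m+[n∸m]≡n h))) ]′ (ℕₚ.≤-total (suc N ℕ.+ x k) (pairSum x k))

  -- The cube without its three corners is the bipyramid. The triangle on `b₁`, `b₂`, `b₃` divides
  -- it into two tetrahedra, according to whether the coordinate sum is at most or at least 1.
  flat-in-P : ∀ {N z x m} → Coset N z x m → (∀ k → Flat N x k) → SP (r +ᵖ z)
  flat-in-P {N} {z} {x} {m} c flat = [ low , high ]′ (ℕₚ.≤-total (x #0 ℕ.+ x #1 ℕ.+ x #2) (suc N))
    where
    open Coset c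
    low : x #0 ℕ.+ x #1 ℕ.+ x #2 ℕ.≤ suc N → SP (r +ᵖ z)
    low h = SP-mean ((x #0 , (r +ᵖ b₁)) ∷ (x #1 , (r +ᵖ b₂)) ∷ (x #2 , (r +ᵖ b₃)) ∷ (l , r) ∷ []) (r +ᵖ z) N (ℤₚ.+-injective weights)
      (λ t → linear₂ (r t) (- + 1) weights (coords t) (ring (+ suc N) (+ x #0) (+ x #1) (+ x #2) (+ l) (r t) (b₁ t) (b₂ t) (b₃ t) (z t)))
      (SP₁ ∷ SP₂ ∷ SP₃ ∷ SP₀ ∷ [])
      where
      l = suc N ℕ.∸ (x #0 ℕ.+ x #1 ℕ.+ x #2)
      weights : + x #0 + (+ x #1 + (+ x #2 + (+ l + + 0))) ≡ + suc N
      weights = linear₁ (+ 1) (cong +_ (ℕₚ.m+[n∸m]≡n h)) (ring′ (+ x #0) (+ x #1) (+ x #2) (+ l) (+ suc N))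
        where
        ring′ : ∀ x y w l D → (x + (y + (w + (l + + 0)))) - D ≡ + 1 * ((x + y + w + l) - D)
        ring′ = solve-∀
      ring : ∀ D x y w l r a b c z → (x * (r + a) + (y * (r + b) + (w * (r + c) + (l * r + + 0)))) - D * (r + z) ≡
        r * ((x + (y + (w + (l + + 0)))) - D) + (- + 1) * (D * z - (x * a + y * b + w * c))
      ring = solve-∀
    high : suc N ℕ.≤ x #0 ℕ.+ x #1 ℕ.+ x #2 → SP (r +ᵖ z)
    -- The upper tetrahedron has twice the volume of the lower one. The barycentric coordinates are
    -- taken over `2 (suc N)`, the successor of `N + suc N`, and the weights are the slacks of the
    -- three planes.
    high h = SP-mean ((f #0 , (r +ᵖ b₁)) ∷ (f #1 , (r +ᵖ b₂)) ∷ (f #2 , (r +ᵖ b₃)) ∷ (l , (r +ᵖ b₁ +ᵖ b₂ +ᵖ b₃)) ∷ []) (r +ᵖ z) (N ℕ.+ suc N)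
        (ℤₚ.+-injective weights)
        (λ t → combine t)
      (SP₁ ∷ SP₂ ∷ SP₃ ∷ SP₄ ∷ [])
      where
      l = x #0 ℕ.+ x #1 ℕ.+ x #2 ℕ.∸ suc N
      f : Fin 3 → ℕ
      f k = proj₁ (flat k)
      D X Y W F₀ F₁′ F₂′ ℓ : ℤ
      D = + suc N
      X = + x #0
      Y = + x #1
      W = + x #2
      F₀ = + f #0
      F₁′ = + f #1
      F₂′ = + f #2
      ℓ = + l
      eℓ : D + ℓ ≡ X + Y + W
      eℓ = cong +_ (ℕₚ.m+[n∸m]≡n h)
      weights : F₀ + (F₁′ + (F₂′ + (ℓ + + 0))) ≡ D + D
      weights = linear₄ (- + 1) (- + 1) (- + 1) (+ 1) (cong +_ (proj₂ (flat #0))) (cong +_ (proj₂ (flat #1))) (cong +_ (proj₂ (flat #2))) eℓ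
        (ring′ X Y W D F₀ F₁′ F₂′ ℓ)
        where
        ring′ : ∀ x y w D f g h l → (f + (g + (h + (l + + 0)))) - (D + D) ≡
          (- + 1) * ((D + x) - (y + w + f)) + (- + 1) * ((D + y) - (x + w + g))
            + (- + 1) * ((D + w) - (x + y + h)) + + 1 * ((D + l) - (x + y + w))
        ring′ = solve-∀
      c₀ : F₀ + ℓ ≡ X + X
      c₀ = linear₂ (- + 1) (+ 1) (cong +_ (proj₂ (flat #0))) eℓ (ring′ X Y W D F₀ ℓ)
        where
        ring′ : ∀ x y w D f l → (f + l) - (x + x) ≡ (- + 1) * ((D + x) - (y + w + f)) + + 1 * ((D + l) - (x + y + w))
        ring′ = solve-∀
      c₁ : F₁′ + ℓ ≡ Y + Y
      c₁ = linear₂ (- + 1) (+ 1) (cong +_ (proj₂ (flat #1))) eℓ (ring′ X Y W D F₁′ ℓ)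
        where
        ring′ : ∀ x y w D g l → (g + l) - (y + y) ≡ (- + 1) * ((D + y) - (x + w + g)) + + 1 * ((D + l) - (x + y + w))
        ring′ = solve-∀
      c₂ : F₂′ + ℓ ≡ W + W
      c₂ = linear₂ (- + 1) (+ 1) (cong +_ (proj₂ (flat #2))) eℓ (ring′ X Y W D F₂′ ℓ)
        where
        ring′ : ∀ x y w D h l → (h + l) - (w + w) ≡ (- + 1) * ((D + w) - (x + y + h)) + + 1 * ((D + l) - (x + y + w))
        ring′ = solve-∀
      combine : ∀ t → F₀ * (r t + b₁ t) + (F₁′ * (r t + b₂ t) + (F₂′ * (r t + b₃ t) + (ℓ * (r t + b₁ t + b₂ t + b₃ t) + + 0)))
        ≡ (D + D) * (r t + z t)
      combine t = linear₂ {a = r t * (F₀ + (F₁′ + (F₂′ + (ℓ + + 0)))) + (b₁ t * (F₀ + ℓ) + (b₂ t * (F₁′ + ℓ) + b₃ t * (F₂′ + ℓ)))}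
          {b = r t * (D + D) + (b₁ t * (X + X) + (b₂ t * (Y + Y) + b₃ t * (W + W)))}
          (+ 1) (- + 2)
          (cong₂ _+_ (cong (r t *_) weights) (cong₂ _+_ (cong (b₁ t *_) c₀) (cong₂ _+_ (cong (b₂ t *_) c₁) (cong (b₃ t *_) c₂))))
          (coords t) (ring X Y W D F₀ F₁′ F₂′ ℓ (r t) (b₁ t) (b₂ t) (b₃ t) (z t))
        where
        ring : ∀ x y w D f g h l r a b c z →
          (f * (r + a) + (g * (r + b) + (h * (r + c) + (l * (r + a + b + c) + + 0)))) - (D + D) * (r + z) ≡
          + 1 * ((r * (f + (g + (h + (l + + 0)))) + (a * (f + l) + (b * (g + l) + c * (h + l))))
            - (r * (D + D) + (a * (x + x) + (b * (y + y) + c * (w + w)))))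
          + (- + 2) * (D * z - (x * a + y * b + w * c))
        ring = solve-∀

  private
    o : Pt
    o = r +ᵖ r

    isSum₀ : ∀ c → isSum c ≡ true → isSum (permute₀ c) ≡ true
    isSum₀ c h = proj₁ (∧-elim (⇒-elim (allV₃-elim isSum-permute c) h))
    isSum₁ : ∀ c → isSum c ≡ true → isSum (permute₁ c) ≡ true
    isSum₁ c h = proj₂ (∧-elim {isSum (permute₀ c)} (⇒-elim (allV₃-elim isSum-permute c) h))

    sums₀ : ∀ c → isSum c ≡ true → S (o +ᵖ Lattice.Lᵛ b₂ b₃ b₁ c)
    sums₀ c@(vec x y w) h = S-resp (λ t → cong (_+_ (o t)) (ring (rep₃ x) (rep₃ y) (rep₃ w) (b₁ t) (b₂ t) (b₃ t))) (sums (permute₀ c) (isSum₀ c h))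
      where
      ring : ∀ x y w a b c → w * a + x * b + y * c ≡ x * b + y * c + w * a
      ring = solve-∀
    sums₁ : ∀ c → isSum c ≡ true → S (o +ᵖ Lattice.Lᵛ b₁ b₃ b₂ c)
    sums₁ c@(vec x y w) h = S-resp (λ t → cong (_+_ (o t)) (ring (rep₃ x) (rep₃ y) (rep₃ w) (b₁ t) (b₂ t) (b₃ t))) (sums (permute₁ c) (isSum₁ c h))
      where
      ring : ∀ x y w a b c → x * a + w * b + y * c ≡ x * a + y * c + w * b
      ring = solve-∀

  corner-members : ∀ {N z x m} → Coset N z x m → ∀ k → Excess N x k →
    S (o +ᵖ z +ᵖ Lᵛ 0₃) × S (o +ᵖ z +ᵖ Lᵛ (unit k)) × S (o +ᵖ (s -ᵖ z) +ᵖ Lᵛ (co-unit k))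
  corner-members {N} {z} {x} {m} c #2 (n , e) =
    S-resp (λ t → ring₀ (o t) (z t) (b₁ t) (b₂ t) (b₃ t)) K.member₀ ,
    S-resp (λ t → ring₁ (o t) (z t) (b₁ t) (b₂ t) (b₃ t)) K.member₁ ,
    S-resp (λ t → ring₂ (o t) (z t) (b₁ t) (b₂ t) (b₃ t)) K.member₂
    where
    module K = Corner r b₁ b₂ b₃ S S-resp S-mean sums {N} {x #0} {x #1} {x #2} {m #0} {m #1} {n} (Coset.complement c #0) (Coset.complement c #1) e z (Coset.coords c)
    ring₀ : ∀ o z a b c → o + z ≡ o + z + (+ 0 * a + + 0 * b + + 0 * c)
    ring₀ = solve-∀
    ring₁ : ∀ o z a b c → o + c + z ≡ o + z + (+ 0 * a + + 0 * b + + 1 * c)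
    ring₁ = solve-∀
    ring₂ : ∀ o z a b c → o + a + b + (a + b + c - z) ≡ o + (a + b + c - z) + (+ 1 * a + + 1 * b + + 0 * c)
    ring₂ = solve-∀
  corner-members {N} {z} {x} {m} c #1 (n , e) =
    S-resp (λ t → ring₀ (o t) (z t) (b₁ t) (b₂ t) (b₃ t)) K.member₀ ,
    S-resp (λ t → ring₁ (o t) (z t) (b₁ t) (b₂ t) (b₃ t)) K.member₁ ,
    S-resp (λ t → ring₂ (o t) (z t) (b₁ t) (b₂ t) (b₃ t)) K.member₂
    where
    reorder : ∀ x y w a b c → x * a + y * b + w * c ≡ x * a + w * c + y * b
    reorder = solve-∀
    module K = Corner r b₁ b₃ b₂ S S-resp S-mean sums₁ {N} {x #0} {x #2} {x #1} {m #0} {m #2} {n} (Coset.complement c #0) (Coset.complement c #2) e z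
      (λ t → trans (Coset.coords c t) (reorder (+ x #0) (+ x #1) (+ x #2) (b₁ t) (b₂ t) (b₃ t)))
    ring₀ : ∀ o z a b c → o + z ≡ o + z + (+ 0 * a + + 0 * b + + 0 * c)
    ring₀ = solve-∀
    ring₁ : ∀ o z a b c → o + b + z ≡ o + z + (+ 0 * a + + 1 * b + + 0 * c)
    ring₁ = solve-∀
    ring₂ : ∀ o z a b c → o + a + c + (a + c + b - z) ≡ o + (a + b + c - z) + (+ 1 * a + + 0 * b + + 1 * c)
    ring₂ = solve-∀
  corner-members {N} {z} {x} {m} c #0 (n , e) =
    S-resp (λ t → ring₀ (o t) (z t) (b₁ t) (b₂ t) (b₃ t)) K.member₀ ,
    S-resp (λ t → ring₁ (o t) (z t) (b₁ t) (b₂ t) (b₃ t)) K.member₁ ,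
    S-resp (λ t → ring₂ (o t) (z t) (b₁ t) (b₂ t) (b₃ t)) K.member₂
    where
    reorder : ∀ x y w a b c → x * a + y * b + w * c ≡ y * b + w * c + x * a
    reorder = solve-∀
    module K = Corner r b₂ b₃ b₁ S S-resp S-mean sums₀ {N} {x #1} {x #2} {x #0} {m #1} {m #2} {n} (Coset.complement c #1) (Coset.complement c #2) e z
      (λ t → trans (Coset.coords c t) (reorder (+ x #0) (+ x #1) (+ x #2) (b₁ t) (b₂ t) (b₃ t)))
    ring₀ : ∀ o z a b c → o + z ≡ o + z + (+ 0 * a + + 0 * b + + 0 * c)
    ring₀ = solve-∀
    ring₁ : ∀ o z a b c → o + a + z ≡ o + z + (+ 1 * a + + 0 * b + + 0 * c)
    ring₁ = solve-∀
    ring₂ : ∀ o z a b c → o + b + c + (b + c + a - z) ≡ o + (a + b + c - z) + (+ 0 * a + + 1 * b + + 1 * c)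
    ring₂ = solve-∀

  -- Write `D` for `suc N`. The pair sums of `x` and `m` add up to `2 D`, whereas the two excesses
  -- would make them at least `2 D + x k + m k = 3 D`.
  excess-distinct : ∀ {N z x m} → Coset N z x m → ∀ k → Excess N x k → ¬ Excess N m k
  excess-distinct {N} {z} {x} {m} c k (n , e) (n′ , e′) = positive (ℤₚ.+-injective (linear₄ (- + 1) (- + 1) (- + 1) (+ 1)
      (cong +_ e) (cong +_ e′) (cong +_ (complement k)) (cong +_ (pairs k)) (ring (+ pairSum x k) (+ pairSum m k) (+ suc N) (+ x k) (+ m k) (+ n) (+ n′))))
    where
    open Coset c
    pairs : ∀ k → pairSum x k ℕ.+ pairSum m k ≡ suc N ℕ.+ suc N
    pairs zero = ℤₚ.+-injective (linear₂ (+ 1) (+ 1) (cong +_ (complement #1)) (cong +_ (complement #2)) (ring′ (+ x #1) (+ x #2) (+ m #1) (+ m #2) (+ suc N)))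
      where
      ring′ : ∀ x y m l D → ((x + y) + (m + l)) - (D + D) ≡ + 1 * ((x + m) - D) + + 1 * ((y + l) - D)
      ring′ = solve-∀
    pairs (suc zero) = ℤₚ.+-injective (linear₂ (+ 1) (+ 1) (cong +_ (complement #0)) (cong +_ (complement #2)) (ring′ (+ x #0) (+ x #2) (+ m #0) (+ m #2) (+ suc N)))
      where
      ring′ : ∀ x y m l D → ((x + y) + (m + l)) - (D + D) ≡ + 1 * ((x + m) - D) + + 1 * ((y + l) - D)
      ring′ = solve-∀
    pairs (suc (suc zero)) = ℤₚ.+-injective (linear₂ (+ 1) (+ 1) (cong +_ (complement #0)) (cong +_ (complement #1)) (ring′ (+ x #0) (+ x #1) (+ m #0) (+ m #1) (+ suc N)))
      where
      ring′ : ∀ x y m l D → ((x + y) + (m + l)) - (D + D) ≡ + 1 * ((x + m) - D) + + 1 * ((y + l) - D)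
      ring′ = solve-∀
    ring : ∀ p q D x m n n′ → (D + n + n′) - + 0 ≡ (- + 1) * (p - (D + x + n)) + (- + 1) * (q - (D + m + n′))
      + (- + 1) * ((x + m) - D) + + 1 * ((p + q) - (D + D))
    ring = solve-∀
    positive : ¬ suc N ℕ.+ n ℕ.+ n′ ≡ 0
    positive ()

  from-opposite : ∀ {z} → Member (s -ᵖ z) → Member z
  from-opposite {z} (x , y , w , e) = + 1 - x , + 1 - y , + 1 - w , λ t →
      linear₁ (- + 1) (e t) (ring x y w (b₁ t) (b₂ t) (b₃ t) (z t))
    where
    ring : ∀ x y w a b c z → z - ((+ 1 - x) * a + (+ 1 - y) * b + (+ 1 - w) * c) ≡
      (- + 1) * ((a + b + c - z) - (x * a + y * b + w * c))
    ring = solve-∀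

  Lᵛ-injective : ∀ c c′ → Lᵛ c ≡ Lᵛ c′ [mod + 3 ] → c ≡ c′
  Lᵛ-injective (vec x y w) (vec x′ y′ w′) (k by e) = finish (indep (rep₃ x - rep₃ x′) (rep₃ y - rep₃ y′) (rep₃ w - rep₃ w′)
      (k by λ t → linear₁ (+ 1) (e t) (ring (rep₃ x) (rep₃ y) (rep₃ w) (rep₃ x′) (rep₃ y′) (rep₃ w′) (b₁ t) (b₂ t) (b₃ t) (k t))))
    where
    open Residues residues₃ using (uniq)
    ring : ∀ x y w x′ y′ w′ a b c k → ((x - x′) * a + (y - y′) * b + (w - w′) * c) - (+ 0 + + 3 * k) ≡
      + 1 * ((x * a + y * b + w * c) - ((x′ * a + y′ * b + w′ * c) + + 3 * k))
    ring = solve-∀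
    same : ∀ a b → (rep₃ a - rep₃ b) ≡ + 0 [modℤ + 3 ] → a ≡ b
    same a b (k by f) = uniq a b (k by linear₁ (+ 1) f (ring′ (rep₃ a) (rep₃ b) k))
      where
      ring′ : ∀ a b k → a - (b + + 3 * k) ≡ + 1 * ((a - b) - (+ 0 + + 3 * k))
      ring′ = solve-∀
    finish : _ → vec x y w ≡ vec x′ y′ w′
    finish (f , g , h) with same x x′ f | same y y′ g | same w w′ h
    ... | refl | refl | refl = refl

  -- The residues of `z` and `s - z` add up to that of `s`, which is `1₃`; this is the hypothesis of
  -- the finite check, whose six outcomes each place `z` or `s - z` in the lattice.
  clash : ∀ {N z x m} → Coset N z x m → ∀ k l → ¬ k ≡ l → Excess N x k → Excess N m l → Member z
  clash {N} {z} c k l k≢l ek el = go (residue-of z) (residue-of (s -ᵖ z)) (corner-members c k ek) (corner-members (opposite c) l el)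
    where
    go : (∃[ f ] z ≡ Lᵛ f [mod + 3 ]) → (∃[ g ] (s -ᵖ z) ≡ Lᵛ g [mod + 3 ]) →
      S (o +ᵖ z +ᵖ Lᵛ 0₃) × S (o +ᵖ z +ᵖ Lᵛ (unit k)) × S (o +ᵖ (s -ᵖ z) +ᵖ Lᵛ (co-unit k)) →
      S (o +ᵖ (s -ᵖ z) +ᵖ Lᵛ 0₃) × S (o +ᵖ (s -ᵖ z) +ᵖ Lᵛ (unit l)) × S (o +ᵖ (s -ᵖ (s -ᵖ z)) +ᵖ Lᵛ (co-unit l)) → Member z
    go (f , zf) (g , zg) (h₀ , h₁ , h₂) (g₀ , g₁ , g₂) = finish
        (allᶠ-elim (allᶠ-elim (⇒-elim (allV₃-elim (allV₃-elim corners-clash f) g) (≟ᵇ₃-refl (total zf zg))) k) l)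
      where
      total : z ≡ Lᵛ f [mod + 3 ] → (s -ᵖ z) ≡ Lᵛ g [mod + 3 ] → f ⊞₃ g ≡ 1₃
      total (a by e) (b by e′) = sym (Lᵛ-injective 1₃ (f ⊞₃ g) (chain (residue-add f g)))
        where
        chain : (Lᵛ f +ᵖ Lᵛ g) ≡ Lᵛ (f ⊞₃ g) [mod + 3 ] → Lᵛ 1₃ ≡ Lᵛ (f ⊞₃ g) [mod + 3 ]
        chain (d by e″) = (a +ᵖ b +ᵖ d) by λ t → linear₃ (+ 1) (+ 1) (+ 1) (e t) (e′ t) (e″ t)
          (ring (b₁ t) (b₂ t) (b₃ t) (z t) (Lᵛ f t) (Lᵛ g t) (Lᵛ (f ⊞₃ g) t) (a t) (b t) (d t))
          where
          ring : ∀ x y w z f g h a b d → (+ 1 * x + + 1 * y + + 1 * w) - (h + + 3 * (a + b + d)) ≡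
            + 1 * (z - (f + + 3 * a)) + + 1 * ((x + y + w - z) - (g + + 3 * b)) + + 1 * ((f + g) - (h + + 3 * d))
          ring = solve-∀
      twice : ∀ t → o t + (s t - (s t - z t)) + Lᵛ (co-unit l) t ≡ o t + z t + Lᵛ (co-unit l) t
      twice t = ring (o t) (s t) (z t) (Lᵛ (co-unit l) t)
        where
        ring : ∀ o s z u → o + (s - (s - z)) + u ≡ o + z + u
        ring = solve-∀
      either : ∀ {a b} {X : Set} → (a ≡ true → X) → (b ≡ true → X) → a ∨ b ≡ true → X
      either {a} f g h = [ f , g ]′ (∨-elim {a} h)
      finish : ((k ==ᶠ l) ∨ isSum (f ⊞₃ 0₃) ∨ isSum (f ⊞₃ unit k) ∨ isSum (f ⊞₃ co-unit l) ∨
        isSum (g ⊞₃ 0₃) ∨ isSum (g ⊞₃ unit l) ∨ isSum (g ⊞₃ co-unit k)) ≡ true → Member z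
      finish = either (λ h → ⊥-elim (k≢l (==ᶠ-sound h)))
        (either (meets-sum {z} {f} 0₃ zf h₀) (either (meets-sum {z} {f} (unit k) zf h₁) (either (meets-sum {z} {f} (co-unit l) zf (S-resp twice g₂))
        (either (λ h → from-opposite (meets-sum {s -ᵖ z} {g} 0₃ zg g₀ h)) (either (λ h → from-opposite (meets-sum {s -ᵖ z} {g} (unit l) zg g₁ h))
          (λ h → from-opposite (meets-sum {s -ᵖ z} {g} (co-unit k) zg h₂ h)))))))

  any-excess : ∀ N x → (∃[ k ] Excess N x k) ⊎ (∀ k → Flat N x k)
  any-excess N x with excess-or-flat N x #0 | excess-or-flat N x #1 | excess-or-flat N x #2
  ... | inj₁ e | _ | _ = inj₁ (#0 , e)
  ... | inj₂ _ | inj₁ e | _ = inj₁ (#1 , e)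
  ... | inj₂ _ | inj₂ _ | inj₁ e = inj₁ (#2 , e)
  ... | inj₂ a | inj₂ b | inj₂ c = inj₂ λ { #0 → a ; #1 → b ; #2 → c }

  coset-member : ∀ {N z x m} → Coset N z x m → Member z
  coset-member {N} {z} {x} {m} c = [ (λ { (k , ek) → [ (λ { (l , el) → clash c k l (distinct ek el) ek el })
      , (λ flat → from-opposite (SP⇒ (flat-in-P (opposite c) flat))) ]′ (any-excess N m) })
    , (λ flat → SP⇒ (flat-in-P c flat)) ]′ (any-excess N x)
    where
    distinct : ∀ {k l} → Excess N x k → Excess N m l → ¬ k ≡ l
    distinct {k} ek el refl = excess-distinct c k ek el

  generates : ∀ z → Member z
  generates z = go denominator
    where
    go : (∃[ N ] ((∀ z → ∃[ x ] ∃[ y ] ∃[ w ] (+ suc N *ᵖ z) ≈ᶻ L x y w) × ¬ + suc N ≡ + 0 [modℤ + 3 ])) → Member z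
    go (N , coords , _) = let (x , y , w , e) = coords z in reduce x y w e
      where
      D = suc N
      reduce : ∀ x y w → (+ suc N *ᵖ z) ≈ᶻ L x y w → Member z
      -- Division with remainder by `D` moves `z` by a lattice vector into the half-open cube.
      reduce x y w e = lift (coset-member {N} {z′} {digit} {λ i → D ℕ.∸ digit i} (record
          { complement = λ i → ℕₚ.m+[n∸m]≡n (ℕₚ.<⇒≤ (digit< i)) ; coords = λ t → linear₄ (+ 1) (b₁ t) (b₂ t) (b₃ t) (e t)
             (division x) (division y) (division w)
             (ring (+ D) (z t) x y w (+ (x ℤD.%ℕ D)) (+ (y ℤD.%ℕ D)) (+ (w ℤD.%ℕ D)) (x ℤD./ℕ D) (y ℤD./ℕ D) (w ℤD./ℕ D) (b₁ t) (b₂ t) (b₃ t)) }))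
        where
        division : ∀ a → a ≡ + (a ℤD.%ℕ D) + (a ℤD./ℕ D) * + D
        division a = ℤD.a≡a%ℕn+[a/ℕn]*n a D
        z′ : Pt
        z′ = z -ᵖ L (x ℤD./ℕ D) (y ℤD./ℕ D) (w ℤD./ℕ D)
        digit : Fin 3 → ℕ
        digit #0 = x ℤD.%ℕ D
        digit #1 = y ℤD.%ℕ D
        digit #2 = w ℤD.%ℕ D
        digit< : ∀ i → digit i ℕ.< D
        digit< #0 = ℤD.n%ℕd<d x D
        digit< #1 = ℤD.n%ℕd<d y D
        digit< #2 = ℤD.n%ℕd<d w D
        ring : ∀ D z x y w x′ y′ w′ p q s a b c → D * (z - (p * a + q * b + s * c)) - (x′ * a + y′ * b + w′ * c) ≡
          + 1 * (D * z - (x * a + y * b + w * c)) + a * (x - (x′ + p * D)) + b * (y - (y′ + q * D)) + c * (w - (w′ + s * D))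
        ring = solve-∀
        lift : Member z′ → Member z
        lift (p , q , s , f) = p + x ℤD./ℕ D , q + y ℤD./ℕ D , s + w ℤD./ℕ D , λ t →
          linear₁ (+ 1) (f t) (ring′ (z t) p q s (x ℤD./ℕ D) (y ℤD./ℕ D) (w ℤD./ℕ D) (b₁ t) (b₂ t) (b₃ t))
          where
          ring′ : ∀ z p q s x y w a b c → z - ((p + x) * a + (q + y) * b + (s + w) * c) ≡
            + 1 * ((z - (x * a + y * b + w * c)) - (p * a + q * b + s * c))
          ring′ = solve-∀

-- Independence modulo 3 of the edges at the apex

infixr 7 _·₃_
_·₃_ : F₃ → V₃ → V₃
𝟎 ·₃ x = 0₃
𝟏 ·₃ x = x
𝟐 ·₃ x = x ⊞₃ x

-- The combination of the differences from `A #4`; the coefficient `- (a + b + c)` is written as its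
-- double, since `- 1` is 2 in F₃.
combination : (Fin 5 → V₃) → Fin 4 → Fin 4 → Fin 4 → V₃ → V₃
combination A i j k (vec a b c) =
  a ·₃ A (inject₁ i) ⊞₃ b ·₃ A (inject₁ j) ⊞₃ c ·₃ A (inject₁ k) ⊞₃ ((a +₃ (b +₃ c)) +₃ (a +₃ (b +₃ c))) ·₃ A #4

bipyramidal : (Fin 5 → V₃) → Fin 4 → Fin 4 → Fin 4 → Fin 4 → Bool
bipyramidal A i j k s = A (inject₁ i) ⊞₃ A (inject₁ j) ⊞₃ A (inject₁ k) ≟ᵇ₃ A (inject₁ s) ⊞₃ A #4 ⊞₃ A #4

opaque
  unfolding _⊞₂_ _≟ᵇ₂_

  -- A dependence would put all five residues into one affine plane over F₃, where a set without
  -- three collinear points has at most four elements.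
  independence : (allᶠ λ i → allᶠ λ j → allᶠ λ k → allᶠ λ s → covers (inject₁ i ∷ inject₁ j ∷ inject₁ k ∷ inject₁ s ∷ #4 ∷ []) ⇒
    allV₃ λ u → allV₃ λ v → bipyramidal (tab₃ u v) i j k s ⇒ normal₃ u v ∧ not (noCap (tab₃ u v)) ⇒
    allV₃ λ c → (combination (tab₃ u v) i j k c ≟ᵇ₃ 0₃) ⇒ (c ≟ᵇ₃ 0₃)) ≡ true
  independence = refl

multiplicity⇒∈ : ∀ L t → ¬ multiplicity L t ≡ + 0 → t ∈ L
multiplicity⇒∈ [] t h = ⊥-elim (h refl)
multiplicity⇒∈ (i ∷ L) t h = go (i ==ᶠ t) refl
  where
  go : ∀ b → (i ==ᶠ t) ≡ b → t ∈ (i ∷ L)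
  go true e = here (sym (==ᶠ-sound e))
  go false e = there (multiplicity⇒∈ L t (λ f → h (trans (cong (λ b → (if b then + 1 else + 0) + multiplicity L t) e)
    (trans (ℤₚ.+-identityˡ _) f))))

covers⇒∈ : ∀ L → covers L ≡ true → ∀ t → t ∈ L
covers⇒∈ L h t = multiplicity⇒∈ L t (λ e → 1≢0 (trans (sym (isOne-sound _ (allᶠ-elim h t))) e))
  where
  1≢0 : ¬ (+ 1) ≡ (+ 0)
  1≢0 ()

module Basis {p : Fin 5 → Pt} (cfg : Config p (λ j → p (inject₁ j))) (i j k s : Fin 4)
  (covering : covers (inject₁ i ∷ inject₁ j ∷ inject₁ k ∷ inject₁ s ∷ #4 ∷ []) ≡ true)
  (shape : (p (inject₁ i) +ᵖ p (inject₁ j) +ᵖ p (inject₁ k)) ≈ᶻ (p (inject₁ s) +ᵖ p #4 +ᵖ p #4))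
  where
  open Config cfg
  open Modular cfg using (d)
  open Coordinates cfg hiding (module R₂; module R₃)

  r pᵢ pⱼ pₖ pₛ b₁ b₂ b₃ : Pt
  r = p #4
  pᵢ = p (inject₁ i)
  pⱼ = p (inject₁ j)
  pₖ = p (inject₁ k)
  pₛ = p (inject₁ s)
  b₁ = pᵢ -ᵖ r
  b₂ = pⱼ -ᵖ r
  b₃ = pₖ -ᵖ r

  open Lattice b₁ b₂ b₃

  opposite-vertex : pₛ ≈ᶻ (r +ᵖ b₁ +ᵖ b₂ +ᵖ b₃)
  opposite-vertex t = linear₁ (- + 1) (shape t) (ring (r t) (pᵢ t) (pⱼ t) (pₖ t) (pₛ t))
    where
    ring : ∀ r x y w s → s - (r + (x - r) + (y - r) + (w - r)) ≡ (- + 1) * ((x + y + w) - (s + r + r))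
    ring = solve-∀

  lab₃-* : ∀ c x → lab₃ (rep₃ c *ᵖ x) ≡ c ·₃ lab₃ x
  lab₃-* 𝟎 x = lab₃-0 (λ t → refl)
  lab₃-* 𝟏 x = R₃.Label.lab-≈ ℓ₃ (λ t → ℤₚ.*-identityˡ (x t))
  lab₃-* 𝟐 x = trans (R₃.Label.lab-≈ ℓ₃ (λ t → ring (x t))) (lab₃-+ x x)
    where
    ring : ∀ x → + 2 * x ≡ x + x
    ring = solve-∀

  private
    A = tab₃ u₃ v₃

    bipyramidal-true : bipyramidal A i j k s ≡ true
    bipyramidal-true = ≟ᵇ₃-refl (trans
      (trans (cong₂ _⊞₃_ (trans (cong₂ _⊞₃_ (A-lab (inject₁ i)) (A-lab (inject₁ j))) (sym (lab₃-+ _ _))) (A-lab (inject₁ k))) (sym (lab₃-+ _ _)))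
      (trans (R₃.Label.lab-≈ ℓ₃ {d (inject₁ i) +ᵖ d (inject₁ j) +ᵖ d (inject₁ k)} {d (inject₁ s) +ᵖ d #4 +ᵖ d #4}
          (λ t → linear₁ (+ 1) (shape t) (ring (r t) (pᵢ t) (pⱼ t) (pₖ t) (pₛ t) (p #0 t))))
        (trans (lab₃-+ _ _) (cong₂ _⊞₃_ (trans (lab₃-+ _ _) (cong₂ _⊞₃_ (sym (A-lab (inject₁ s))) (sym (A-lab #4)))) (sym (A-lab #4))))))
      where
      ring : ∀ r x y w s o → ((x - o) + (y - o) + (w - o)) - ((s - o) + (r - o) + (r - o)) ≡
        + 1 * ((x + y + w) - (s + r + r))
      ring = solve-∀

    combination-lab : ∀ a b c → combination A i j k (vec a b c) ≡
      lab₃ (rep₃ a *ᵖ d (inject₁ i) +ᵖ rep₃ b *ᵖ d (inject₁ j) +ᵖ rep₃ c *ᵖ d (inject₁ k) +ᵖ rep₃ ((a +₃ (b +₃ c)) +₃ (a +₃ (b +₃ c))) *ᵖ d #4)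
    combination-lab a b c = sym (trans (lab₃-+ _ _) (cong₂ _⊞₃_ (trans (lab₃-+ _ _) (cong₂ _⊞₃_ (trans (lab₃-+ _ _)
      (cong₂ _⊞₃_ (term a (inject₁ i)) (term b (inject₁ j)))) (term c (inject₁ k)))) (term ((a +₃ (b +₃ c)) +₃ (a +₃ (b +₃ c))) #4)))
      where
      term : ∀ c n → lab₃ (rep₃ c *ᵖ d n) ≡ c ·₃ A n
      term c n = trans (lab₃-* c (d n)) (cong (c ·₃_) (sym (A-lab n)))

    coefficients : ∀ a b c → rep₃ a + (rep₃ b + rep₃ c) + rep₃ ((a +₃ (b +₃ c)) +₃ (a +₃ (b +₃ c))) ≡ + 0 [modℤ + 3 ]
    coefficients a b c = c-trans (c-+ total (c-sym (hom σ σ))) (rep₃ σ by ring (rep₃ σ))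
      where
      open Residues residues₃ using (hom)
      σ = a +₃ (b +₃ c)
      total : rep₃ a + (rep₃ b + rep₃ c) ≡ rep₃ σ [modℤ + 3 ]
      total = c-trans (c-+ {a = rep₃ a} (c-refl refl) (hom b c)) (hom a (b +₃ c))
      ring : ∀ s → s + (s + s) ≡ + 0 + + 3 * s
      ring = solve-∀

    kernel : ∀ a b c → L (rep₃ a) (rep₃ b) (rep₃ c) ≡ 0ᵖ [mod + 3 ] → vec a b c ≡ 0₃
    kernel a b c (m by e) = ≟ᵇ₃-sound (⇒-elim (allV₃-elim (⇒-elim (⇒-elim (allV₃-elim (allV₃-elim (⇒-elim
        (allᶠ-elim (allᶠ-elim (allᶠ-elim (allᶠ-elim independence i) j) k) s) covering) u₃) v₃) bipyramidal-true) guard₃) (vec a b c))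
        (≟ᵇ₃-refl (trans (combination-lab a b c) (vanishes (coefficients a b c)))))
      where
      ρ = rep₃ ((a +₃ (b +₃ c)) +₃ (a +₃ (b +₃ c)))
      vanishes : rep₃ a + (rep₃ b + rep₃ c) + ρ ≡ + 0 [modℤ + 3 ] →
        lab₃ (rep₃ a *ᵖ d (inject₁ i) +ᵖ rep₃ b *ᵖ d (inject₁ j) +ᵖ rep₃ c *ᵖ d (inject₁ k) +ᵖ ρ *ᵖ d #4) ≡ 0₃
      vanishes (l by f) = trans (R₃.Label.lab-mod ℓ₃ {y = 0ᵖ} ((m +ᵖ l *ᵖ d #4) by λ t → linear₂ (+ 1) (d #4 t) (e t) f
          (ring (rep₃ a) (rep₃ b) (rep₃ c) ρ (r t) (pᵢ t) (pⱼ t) (pₖ t) (p #0 t) (m t) l))) (R₃.Label.lab-0 ℓ₃)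
        where
        ring : ∀ a b c q r x y w o m l →
          (a * (x - o) + b * (y - o) + c * (w - o) + q * (r - o)) - (+ 0 + + 3 * (m + l * (r - o))) ≡
          + 1 * ((a * (x - r) + b * (y - r) + c * (w - r)) - (+ 0 + + 3 * m))
          + (r - o) * ((a + (b + c) + q) - (+ 0 + + 3 * l))
        ring = solve-∀

  indep : ∀ x y w → L x y w ≡ 0ᵖ [mod + 3 ] → x ≡ + 0 [modℤ + 3 ] × y ≡ + 0 [modℤ + 3 ] × w ≡ + 0 [modℤ + 3 ]
  indep x y w h = conclude (rep x) (rep y) (rep w)
    where
    open Residues residues₃ using (rep)
    conclude : (∃[ a ] x ≡ rep₃ a [modℤ + 3 ]) → (∃[ b ] y ≡ rep₃ b [modℤ + 3 ]) → (∃[ c ] w ≡ rep₃ c [modℤ + 3 ]) →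
      x ≡ + 0 [modℤ + 3 ] × y ≡ + 0 [modℤ + 3 ] × w ≡ + 0 [modℤ + 3 ]
    conclude (a , ea) (b , eb) (c , ec) = finish ea eb ec (kernel a b c (R₃.p-trans (L-≡ (c-sym ea) (c-sym eb) (c-sym ec)) h))
      where
      finish : ∀ {a b c} → x ≡ rep₃ a [modℤ + 3 ] → y ≡ rep₃ b [modℤ + 3 ] → w ≡ rep₃ c [modℤ + 3 ] → vec a b c ≡ 0₃ →
        x ≡ + 0 [modℤ + 3 ] × y ≡ + 0 [modℤ + 3 ] × w ≡ + 0 [modℤ + 3 ]
      finish ea eb ec refl = ea , eb , ec

  private
    SP-resp : ∀ {x y} → x ≈ᶻ y → SP x → SP y
    SP-resp {x} {y} e h = SP-mean ((1 , x) ∷ []) y 0 refl (λ t → trans (ring (x t)) (cong (+ 1 *_) (e t))) (h ∷ [])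
      where
      ring : ∀ x → + 1 * x + + 0 ≡ + 1 * x
      ring = solve-∀

    back : ∀ (x : Pt) t → x t ≡ r t + (x t - r t)
    back x t = ring (x t) (r t)
      where
      ring : ∀ x r → x ≡ r + (x - r)
      ring = solve-∀

    sum-at : ∀ m n c → (∀ t → p m t + p (inject₁ n) t ≡ r t + r t + Lᵛ c t) → S (r +ᵖ r +ᵖ Lᵛ c)
    sum-at m n c e = S-resp e (S-sum m n)

  -- Relative to `r` the vertices are 0, `b₁`, `b₂`, `b₃` and their sum. The relation `shape` enters
  -- only through `pₛ`, so its coefficient is minus the number of times `pₛ` occurs.
  sums : ∀ c → isSum c ≡ true → S (r +ᵖ r +ᵖ Lᵛ c)
  sums (vec 𝟎 𝟎 𝟎) ()
  sums c@(vec 𝟎 𝟎 𝟏) _ = sum-at #4 k c λ t → linear₁ (+ 0) (shape t) (ring (r t) (pᵢ t) (pⱼ t) (pₖ t) (pₛ t))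
    where
    ring : ∀ r x y w s → (r + w) - (r + r + (+ 0 * (x - r) + + 0 * (y - r) + + 1 * (w - r))) ≡ (+ 0) * ((x + y + w) - (s + r + r))
    ring = solve-∀
  sums c@(vec 𝟎 𝟎 𝟐) _ = sum-at (inject₁ k) k c λ t → linear₁ (+ 0) (shape t) (ring (r t) (pᵢ t) (pⱼ t) (pₖ t) (pₛ t))
    where
    ring : ∀ r x y w s → (w + w) - (r + r + (+ 0 * (x - r) + + 0 * (y - r) + + 2 * (w - r))) ≡ (+ 0) * ((x + y + w) - (s + r + r))
    ring = solve-∀
  sums c@(vec 𝟎 𝟏 𝟎) _ = sum-at #4 j c λ t → linear₁ (+ 0) (shape t) (ring (r t) (pᵢ t) (pⱼ t) (pₖ t) (pₛ t))
    where
    ring : ∀ r x y w s → (r + y) - (r + r + (+ 0 * (x - r) + + 1 * (y - r) + + 0 * (w - r))) ≡ (+ 0) * ((x + y + w) - (s + r + r))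
    ring = solve-∀
  sums c@(vec 𝟎 𝟏 𝟏) _ = sum-at (inject₁ j) k c λ t → linear₁ (+ 0) (shape t) (ring (r t) (pᵢ t) (pⱼ t) (pₖ t) (pₛ t))
    where
    ring : ∀ r x y w s → (y + w) - (r + r + (+ 0 * (x - r) + + 1 * (y - r) + + 1 * (w - r))) ≡ (+ 0) * ((x + y + w) - (s + r + r))
    ring = solve-∀
  sums (vec 𝟎 𝟏 𝟐) ()
  sums c@(vec 𝟎 𝟐 𝟎) _ = sum-at (inject₁ j) j c λ t → linear₁ (+ 0) (shape t) (ring (r t) (pᵢ t) (pⱼ t) (pₖ t) (pₛ t))
    where
    ring : ∀ r x y w s → (y + y) - (r + r + (+ 0 * (x - r) + + 2 * (y - r) + + 0 * (w - r))) ≡ (+ 0) * ((x + y + w) - (s + r + r))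
    ring = solve-∀
  sums (vec 𝟎 𝟐 𝟏) ()
  sums (vec 𝟎 𝟐 𝟐) ()
  sums c@(vec 𝟏 𝟎 𝟎) _ = sum-at #4 i c λ t → linear₁ (+ 0) (shape t) (ring (r t) (pᵢ t) (pⱼ t) (pₖ t) (pₛ t))
    where
    ring : ∀ r x y w s → (r + x) - (r + r + (+ 1 * (x - r) + + 0 * (y - r) + + 0 * (w - r))) ≡ (+ 0) * ((x + y + w) - (s + r + r))
    ring = solve-∀
  sums c@(vec 𝟏 𝟎 𝟏) _ = sum-at (inject₁ i) k c λ t → linear₁ (+ 0) (shape t) (ring (r t) (pᵢ t) (pⱼ t) (pₖ t) (pₛ t))
    where
    ring : ∀ r x y w s → (x + w) - (r + r + (+ 1 * (x - r) + + 0 * (y - r) + + 1 * (w - r))) ≡ (+ 0) * ((x + y + w) - (s + r + r))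
    ring = solve-∀
  sums (vec 𝟏 𝟎 𝟐) ()
  sums c@(vec 𝟏 𝟏 𝟎) _ = sum-at (inject₁ i) j c λ t → linear₁ (+ 0) (shape t) (ring (r t) (pᵢ t) (pⱼ t) (pₖ t) (pₛ t))
    where
    ring : ∀ r x y w s → (x + y) - (r + r + (+ 1 * (x - r) + + 1 * (y - r) + + 0 * (w - r))) ≡ (+ 0) * ((x + y + w) - (s + r + r))
    ring = solve-∀
  sums c@(vec 𝟏 𝟏 𝟏) _ = sum-at #4 s c λ t → linear₁ (- + 1) (shape t) (ring (r t) (pᵢ t) (pⱼ t) (pₖ t) (pₛ t))
    where
    ring : ∀ r x y w s → (r + s) - (r + r + (+ 1 * (x - r) + + 1 * (y - r) + + 1 * (w - r))) ≡ (- + 1) * ((x + y + w) - (s + r + r))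
    ring = solve-∀
  sums c@(vec 𝟏 𝟏 𝟐) _ = sum-at (inject₁ k) s c λ t → linear₁ (- + 1) (shape t) (ring (r t) (pᵢ t) (pⱼ t) (pₖ t) (pₛ t))
    where
    ring : ∀ r x y w s → (w + s) - (r + r + (+ 1 * (x - r) + + 1 * (y - r) + + 2 * (w - r))) ≡ (- + 1) * ((x + y + w) - (s + r + r))
    ring = solve-∀
  sums (vec 𝟏 𝟐 𝟎) ()
  sums c@(vec 𝟏 𝟐 𝟏) _ = sum-at (inject₁ j) s c λ t → linear₁ (- + 1) (shape t) (ring (r t) (pᵢ t) (pⱼ t) (pₖ t) (pₛ t))
    where
    ring : ∀ r x y w s → (y + s) - (r + r + (+ 1 * (x - r) + + 2 * (y - r) + + 1 * (w - r))) ≡ (- + 1) * ((x + y + w) - (s + r + r))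
    ring = solve-∀
  sums (vec 𝟏 𝟐 𝟐) ()
  sums c@(vec 𝟐 𝟎 𝟎) _ = sum-at (inject₁ i) i c λ t → linear₁ (+ 0) (shape t) (ring (r t) (pᵢ t) (pⱼ t) (pₖ t) (pₛ t))
    where
    ring : ∀ r x y w s → (x + x) - (r + r + (+ 2 * (x - r) + + 0 * (y - r) + + 0 * (w - r))) ≡ (+ 0) * ((x + y + w) - (s + r + r))
    ring = solve-∀
  sums (vec 𝟐 𝟎 𝟏) ()
  sums (vec 𝟐 𝟎 𝟐) ()
  sums (vec 𝟐 𝟏 𝟎) ()
  sums c@(vec 𝟐 𝟏 𝟏) _ = sum-at (inject₁ i) s c λ t → linear₁ (- + 1) (shape t) (ring (r t) (pᵢ t) (pⱼ t) (pₖ t) (pₛ t))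
    where
    ring : ∀ r x y w s → (x + s) - (r + r + (+ 2 * (x - r) + + 1 * (y - r) + + 1 * (w - r))) ≡ (- + 1) * ((x + y + w) - (s + r + r))
    ring = solve-∀
  sums (vec 𝟐 𝟏 𝟐) ()
  sums (vec 𝟐 𝟐 𝟎) ()
  sums (vec 𝟐 𝟐 𝟏) ()
  sums c@(vec 𝟐 𝟐 𝟐) _ = sum-at (inject₁ s) s c λ t → linear₁ (- + 2) (shape t) (ring (r t) (pᵢ t) (pⱼ t) (pₖ t) (pₛ t))
    where
    ring : ∀ r x y w s → (s + s) - (r + r + (+ 2 * (x - r) + + 2 * (y - r) + + 2 * (w - r))) ≡ (- + 2) * ((x + y + w) - (s + r + r))
    ring = solve-∀

  pᵢ-coordinates : pᵢ ≈ᶻ (r +ᵖ L (+ 1) (+ 0) (+ 0))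
  pᵢ-coordinates t = ring (r t) (pᵢ t) (pⱼ t) (pₖ t)
    where
    ring : ∀ r x y w → x ≡ r + (+ 1 * (x - r) + + 0 * (y - r) + + 0 * (w - r))
    ring = solve-∀

  pⱼ-coordinates : pⱼ ≈ᶻ (r +ᵖ L (+ 0) (+ 1) (+ 0))
  pⱼ-coordinates t = ring (r t) (pᵢ t) (pⱼ t) (pₖ t)
    where
    ring : ∀ r x y w → y ≡ r + (+ 0 * (x - r) + + 1 * (y - r) + + 0 * (w - r))
    ring = solve-∀

  pₖ-coordinates : pₖ ≈ᶻ (r +ᵖ L (+ 0) (+ 0) (+ 1))
  pₖ-coordinates t = ring (r t) (pᵢ t) (pⱼ t) (pₖ t)
    where
    ring : ∀ r x y w → w ≡ r + (+ 0 * (x - r) + + 0 * (y - r) + + 1 * (w - r))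
    ring = solve-∀

  pₛ-coordinates : pₛ ≈ᶻ (r +ᵖ L (+ 1) (+ 1) (+ 1))
  pₛ-coordinates t = trans (opposite-vertex t) (ring (r t) (b₁ t) (b₂ t) (b₃ t))
    where
    ring : ∀ r x y w → r + x + y + w ≡ r + (+ 1 * x + + 1 * y + + 1 * w)
    ring = solve-∀

  r-coordinates : r ≈ᶻ (r +ᵖ L (+ 0) (+ 0) (+ 0))
  r-coordinates t = ring (r t) (pᵢ t) (pⱼ t) (pₖ t)
    where
    ring : ∀ r x y w → r ≡ r + (+ 0 * (x - r) + + 0 * (y - r) + + 0 * (w - r))
    ring = solve-∀

  vertex-coordinates : All (λ n → ∃[ x ] ∃[ y ] ∃[ w ] p n ≈ᶻ (r +ᵖ L x y w)) (inject₁ i ∷ inject₁ j ∷ inject₁ k ∷ inject₁ s ∷ #4 ∷ [])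
  vertex-coordinates = (+ 1 , + 0 , + 0 , pᵢ-coordinates) ∷ (+ 0 , + 1 , + 0 , pⱼ-coordinates) ∷ (+ 0 , + 0 , + 1 , pₖ-coordinates) ∷
    (+ 1 , + 1 , + 1 , pₛ-coordinates) ∷ (+ 0 , + 0 , + 0 , r-coordinates) ∷ []

  private
    SP⇒Member : ∀ {z} → SP (r +ᵖ z) → Member z
    SP⇒Member {z} h = let (n , e) = SP⇒p h ; (x , y , w , f) = All.lookup vertex-coordinates (covers⇒∈ _ covering n)
      in x , y , w , λ t → cancelˡ (r t) (z t) (L x y w t) (trans (e t) (f t))

  open Generation r b₁ b₂ b₃ S SP S-resp S-mean SP-mean mod3 sums (SP-p #4)
    (SP-resp (back pᵢ) (SP-p (inject₁ i))) (SP-resp (back pⱼ) (SP-p (inject₁ j))) (SP-resp (back pₖ) (SP-p (inject₁ k)))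
    (SP-resp opposite-vertex (SP-p (inject₁ s))) SP⇒Member indep public using (generates)

-- The unimodular map

δ-sym : ∀ i j → δ i j ≡ δ j i
δ-sym #0 #0 = refl
δ-sym #0 #1 = refl
δ-sym #0 #2 = refl
δ-sym #1 #0 = refl
δ-sym #1 #1 = refl
δ-sym #1 #2 = refl
δ-sym #2 #0 = refl
δ-sym #2 #1 = refl
δ-sym #2 #2 = refl

triple : ℤ → ℤ → ℤ → Pt
triple x y w #0 = x
triple x y w #1 = y
triple x y w #2 = w

δ-combination : ∀ x y w i → x * δ i #0 + y * δ i #1 + w * δ i #2 ≡ triple x y w i
δ-combination x y w #0 = ring x y w
  where
  ring : ∀ x y w → x * + 1 + y * + 0 + w * + 0 ≡ x
  ring = solve-∀
δ-combination x y w #1 = ring x y w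
  where
  ring : ∀ x y w → x * + 0 + y * + 1 + w * + 0 ≡ y
  ring = solve-∀
δ-combination x y w #2 = ring x y w
  where
  ring : ∀ x y w → x * + 0 + y * + 0 + w * + 1 ≡ w
  ring = solve-∀

infixl 7 _▸_
_▸_ : Mat → Pt → Pt
(U ▸ z) i = U i #0 * z #0 + (U i #1 * z #1 + U i #2 * z #2)

module Inverse (b₁ b₂ b₃ : Pt) (generates : ∀ z → Lattice.Member b₁ b₂ b₃ z)
  (indep : ∀ x y w → Lattice.L b₁ b₂ b₃ x y w ≡ 0ᵖ [mod + 3 ] → x ≡ + 0 [modℤ + 3 ] × y ≡ + 0 [modℤ + 3 ] × w ≡ + 0 [modℤ + 3 ])
  where
  open Lattice b₁ b₂ b₃

  basis : Mat
  basis t #0 = b₁ t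
  basis t #1 = b₂ t
  basis t #2 = b₃ t

  -- Column `k` holds the coordinates of the `k`-th unit vector in the basis, so one of the two
  -- inverse laws holds by construction; the other rests on the injectivity of `L`.
  U : Mat
  U #0 k = proj₁ (generates (δ k))
  U #1 k = proj₁ (proj₂ (generates (δ k)))
  U #2 k = proj₁ (proj₂ (proj₂ (generates (δ k))))

  right-inverse : ∀ t k → (basis ·ᴹ U) t k ≡ δ t k
  right-inverse t k = trans (ring (b₁ t) (b₂ t) (b₃ t) (U #0 k) (U #1 k) (U #2 k))
    (trans (sym (proj₂ (proj₂ (proj₂ (generates (δ k)))) t)) (δ-sym k t))
    where
    ring : ∀ a b c x y w → a * x + (b * y + c * w) ≡ x * a + y * b + w * c
    ring = solve-∀

  private
    det≢0 : ¬ det b₁ b₂ b₃ ≡ + 0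
    det≢0 e = Independent.det≢0 indep (c-refl e)

    cancel-det : ∀ x → x * det b₁ b₂ b₃ ≡ + 0 → x ≡ + 0
    cancel-det x e = [ (λ f → f) , (λ f → ⊥-elim (det≢0 f)) ]′ (ℤₚ.i*j≡0⇒i≡0∨j≡0 x e)

    -- The multipliers are entries of the adjugate matrix. They leave a coordinate times the
    -- determinant, which is nonzero because it is nonzero modulo 3.
    injective : ∀ x y w → L x y w ≈ᶻ 0ᵖ → ∀ i → triple x y w i ≡ + 0
    injective x y w e i = cancel-det (triple x y w i) (go i)
      where
      go : ∀ i → triple x y w i * det b₁ b₂ b₃ ≡ + 0
      go #0 = linear₃ (b₂ #1 * b₃ #2 - b₂ #2 * b₃ #1) (b₂ #2 * b₃ #0 - b₂ #0 * b₃ #2) (b₂ #0 * b₃ #1 - b₂ #1 * b₃ #0)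
          (e #0) (e #1) (e #2) (ring x y w (b₁ #0) (b₁ #1) (b₁ #2) (b₂ #0) (b₂ #1) (b₂ #2) (b₃ #0) (b₃ #1) (b₃ #2))
        where
        ring : ∀ x y w a b c d e f g h i →
          x * (a * (e * i - f * h) - b * (d * i - f * g) + c * (d * h - e * g)) - + 0 ≡
          (e * i - f * h) * ((x * a + y * d + w * g) - + 0) +
          (f * g - d * i) * ((x * b + y * e + w * h) - + 0) +
          (d * h - e * g) * ((x * c + y * f + w * i) - + 0)
        ring = solve-∀
      go #1 = linear₃ (b₁ #2 * b₃ #1 - b₁ #1 * b₃ #2) (b₁ #0 * b₃ #2 - b₁ #2 * b₃ #0) (b₁ #1 * b₃ #0 - b₁ #0 * b₃ #1)
          (e #0) (e #1) (e #2) (ring x y w (b₁ #0) (b₁ #1) (b₁ #2) (b₂ #0) (b₂ #1) (b₂ #2) (b₃ #0) (b₃ #1) (b₃ #2))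
        where
        ring : ∀ x y w a b c d e f g h i →
          y * (a * (e * i - f * h) - b * (d * i - f * g) + c * (d * h - e * g)) - + 0 ≡
          (c * h - b * i) * ((x * a + y * d + w * g) - + 0) +
          (a * i - c * g) * ((x * b + y * e + w * h) - + 0) +
          (b * g - a * h) * ((x * c + y * f + w * i) - + 0)
        ring = solve-∀
      go #2 = linear₃ (b₁ #1 * b₂ #2 - b₁ #2 * b₂ #1) (b₁ #2 * b₂ #0 - b₁ #0 * b₂ #2) (b₁ #0 * b₂ #1 - b₁ #1 * b₂ #0)
          (e #0) (e #1) (e #2) (ring x y w (b₁ #0) (b₁ #1) (b₁ #2) (b₂ #0) (b₂ #1) (b₂ #2) (b₃ #0) (b₃ #1) (b₃ #2))
        where
        ring : ∀ x y w a b c d e f g h i →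
          w * (a * (e * i - f * h) - b * (d * i - f * g) + c * (d * h - e * g)) - + 0 ≡
          (b * f - c * e) * ((x * a + y * d + w * g) - + 0) +
          (c * d - a * f) * ((x * b + y * e + w * h) - + 0) +
          (a * e - b * d) * ((x * c + y * f + w * i) - + 0)
        ring = solve-∀

    column-δ : ∀ c → L (δ #0 c) (δ #1 c) (δ #2 c) ≈ᶻ λ t → basis t c
    column-δ #0 t = ring (b₁ t) (b₂ t) (b₃ t)
      where
      ring : ∀ a b c → + 1 * a + + 0 * b + + 0 * c ≡ a
      ring = solve-∀
    column-δ #1 t = ring (b₁ t) (b₂ t) (b₃ t)
      where
      ring : ∀ a b c → + 0 * a + + 1 * b + + 0 * c ≡ b
      ring = solve-∀
    column-δ #2 t = ring (b₁ t) (b₂ t) (b₃ t)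
      where
      ring : ∀ a b c → + 0 * a + + 0 * b + + 1 * c ≡ c
      ring = solve-∀

    triple-η : ∀ (x : Pt) t → triple (x #0) (x #1) (x #2) t ≡ x t
    triple-η x #0 = refl
    triple-η x #1 = refl
    triple-η x #2 = refl

  L-U : ∀ z → L ((U ▸ z) #0) ((U ▸ z) #1) ((U ▸ z) #2) ≈ᶻ z
  L-U z t = linear₄ (z #0) (z #1) (z #2) (+ 1) (right-inverse t #0) (right-inverse t #1) (right-inverse t #2)
      (trans (δ-combination (z #0) (z #1) (z #2) t) (triple-η z t))
      (ring (b₁ t) (b₂ t) (b₃ t) (z #0) (z #1) (z #2) (U #0 #0) (U #0 #1) (U #0 #2) (U #1 #0) (U #1 #1) (U #1 #2) (U #2 #0) (U #2 #1) (U #2 #2) (δ t #0) (δ t #1) (δ t #2) (z t))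
    where
    ring : ∀ a b c x y w u₀ u₁ u₂ v₀ v₁ v₂ w₀ w₁ w₂ d₀ d₁ d₂ z →
      ((u₀ * x + (u₁ * y + u₂ * w)) * a + (v₀ * x + (v₁ * y + v₂ * w)) * b + (w₀ * x + (w₁ * y + w₂ * w)) * c) - z ≡
      x * ((a * u₀ + (b * v₀ + c * w₀)) - d₀) + y * ((a * u₁ + (b * v₁ + c * w₁)) - d₁)
      + w * ((a * u₂ + (b * v₂ + c * w₂)) - d₂) + + 1 * ((x * d₀ + y * d₁ + w * d₂) - z)
    ring = solve-∀

  coordinates : ∀ {z} x y w → z ≈ᶻ L x y w → (U ▸ z) ≈ᶻ triple x y w
  coordinates {z} x y w e i = equal i (injective ((U ▸ z) #0 - x) ((U ▸ z) #1 - y) ((U ▸ z) #2 - w)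
      (λ t → linear₂ (+ 1) (+ 1) (L-U z t) (e t) (ring ((U ▸ z) #0) ((U ▸ z) #1) ((U ▸ z) #2) x y w (b₁ t) (b₂ t) (b₃ t) (z t))) i)
    where
    ring : ∀ u v q x y w a b c z → ((u - x) * a + (v - y) * b + (q - w) * c) - + 0 ≡
      + 1 * ((u * a + v * b + q * c) - z) + + 1 * (z - (x * a + y * b + w * c))
    ring = solve-∀
    equal : ∀ i → triple ((U ▸ z) #0 - x) ((U ▸ z) #1 - y) ((U ▸ z) #2 - w) i ≡ + 0 → (U ▸ z) i ≡ triple x y w i
    equal #0 = ℤₚ.i-j≡0⇒i≡j _ _
    equal #1 = ℤₚ.i-j≡0⇒i≡j _ _
    equal #2 = ℤₚ.i-j≡0⇒i≡j _ _

  unimodular : IsUnimodular U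
  unimodular = basis , (λ i c → trans (coordinates (δ #0 c) (δ #1 c) (δ #2 c) (λ t → sym (column-δ c t)) i) (triple-η (λ i → δ i c) i)) , right-inverse

-- The images of P and Q

open Perm using (to; from)

module Placement {p : Fin 5 → Pt} (cfg : Config p (λ j → p (inject₁ j))) (i j k s : Fin 4)
  (covering : covers (inject₁ i ∷ inject₁ j ∷ inject₁ k ∷ inject₁ s ∷ #4 ∷ []) ≡ true)
  (shape : (p (inject₁ i) +ᵖ p (inject₁ j) +ᵖ p (inject₁ k)) ≈ᶻ (p (inject₁ s) +ᵖ p #4 +ᵖ p #4))
  where
  open Basis cfg i j k s covering shape
  open Lattice b₁ b₂ b₃
  open Inverse b₁ b₂ b₃ generates indep public using (U; unimodular)
  open Inverse b₁ b₂ b₃ generates indep using (coordinates)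

  -- Together with `offset t` this sends `z` to `U ▸ (z - r - t)`: the apex goes to 0 and the edges
  -- at it to the unit vectors, with `t = 0` for P and the translation found for Q.
  origin : Pt
  origin i = - (U ▸ r) i

  offset : Pt → Pt
  offset t i = - (U ▸ t) i

  module Translate (t : Pt) where
    open Affine U origin (offset t) public

    placed : ∀ {z n} x y w → p n ≈ᶻ (r +ᵖ L x y w) → z ≈ᶻ (p n +ᵖ t) → image z ≈ᶻ triple x y w
    placed {z} {n} x y w e f m = trans (ring (U m #0) (U m #1) (U m #2) (z #0) (z #1) (z #2) (r #0) (r #1) (r #2) (t #0) (t #1) (t #2))
        (coordinates {z -ᵖ r -ᵖ t} x y w (λ q → linear₂ (+ 1) (+ 1) (f q) (e q) (ring′ (z q) (p n q) (r q) (t q) (L x y w q))) m)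
      where
      ring : ∀ u v w x y z a b c d e f →
        ((u * x + (v * y + w * z)) + - (u * a + (v * b + w * c))) + - (u * d + (v * e + w * f)) ≡
        u * (x - a - d) + (v * (y - b - e) + w * (z - c - f))
      ring = solve-∀
      ring′ : ∀ z p r t l → (z - r - t) - l ≡ + 1 * (z - (p + t)) + + 1 * (p - (r + l))
      ring′ = solve-∀

    place-r : ∀ {z} → z ≈ᶻ (r +ᵖ t) → image z ≈ᶻ e₀
    place-r {z} f m = trans (placed {z} {#4} (+ 0) (+ 0) (+ 0) r-coordinates f m) (same m)
      where
      same : triple (+ 0) (+ 0) (+ 0) ≈ᶻ e₀
      same #0 = refl
      same #1 = refl
      same #2 = refl
    place-i : ∀ {z} → z ≈ᶻ (pᵢ +ᵖ t) → image z ≈ᶻ e₁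
    place-i {z} f m = trans (placed {z} {inject₁ i} (+ 1) (+ 0) (+ 0) pᵢ-coordinates f m) (same m)
      where
      same : triple (+ 1) (+ 0) (+ 0) ≈ᶻ e₁
      same #0 = refl
      same #1 = refl
      same #2 = refl
    place-j : ∀ {z} → z ≈ᶻ (pⱼ +ᵖ t) → image z ≈ᶻ e₂
    place-j {z} f m = trans (placed {z} {inject₁ j} (+ 0) (+ 1) (+ 0) pⱼ-coordinates f m) (same m)
      where
      same : triple (+ 0) (+ 1) (+ 0) ≈ᶻ e₂
      same #0 = refl
      same #1 = refl
      same #2 = refl
    place-k : ∀ {z} → z ≈ᶻ (pₖ +ᵖ t) → image z ≈ᶻ e₃
    place-k {z} f m = trans (placed {z} {inject₁ k} (+ 0) (+ 0) (+ 1) pₖ-coordinates f m) (same m)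
      where
      same : triple (+ 0) (+ 0) (+ 1) ≈ᶻ e₃
      same #0 = refl
      same #1 = refl
      same #2 = refl
    place-s : ∀ {z} → z ≈ᶻ (pₛ +ᵖ t) → image z ≈ᶻ e₁₂₃
    place-s {z} f m = trans (placed {z} {inject₁ s} (+ 1) (+ 1) (+ 1) pₛ-coordinates f m) (same m)
      where
      same : triple (+ 1) (+ 1) (+ 1) ≈ᶻ e₁₂₃
      same #0 = refl
      same #1 = refl
      same #2 = refl

    in-S₂ : ∀ {z n} → ¬ #4 ≡ n → n ∈ (inject₁ i ∷ inject₁ j ∷ inject₁ k ∷ inject₁ s ∷ #4 ∷ []) → z ≈ᶻ (p n +ᵖ t) →
      image z ∈ᵖ (e₁ ∷ e₂ ∷ e₃ ∷ e₁₂₃ ∷ [])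
    in-S₂ _ (here refl) f = here (≈-sym (place-i f))
    in-S₂ _ (there (here refl)) f = there (here (≈-sym (place-j f)))
    in-S₂ _ (there (there (here refl))) f = there (there (here (≈-sym (place-k f))))
    in-S₂ _ (there (there (there (here refl)))) f = there (there (there (here (≈-sym (place-s f)))))
    in-S₂ n≢4 (there (there (there (there (here refl))))) f = ⊥-elim (n≢4 refl)

    in-E : ∀ {z} n → z ≈ᶻ (p n +ᵖ t) → image z ∈ᵖ (e₀ ∷ e₁ ∷ e₂ ∷ e₃ ∷ e₁₂₃ ∷ [])
    in-E {z} n f = go (#4 Fin.≟ n)
      where
      go : Dec (#4 ≡ n) → image z ∈ᵖ (e₀ ∷ e₁ ∷ e₂ ∷ e₃ ∷ e₁₂₃ ∷ [])
      go (yes refl) = here (≈-sym (place-r f))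
      go (no 4≢n) = there (in-S₂ 4≢n (covers⇒∈ _ covering n) f)

  image-E : ∀ G → (∀ n → conv G (embed (p n))) → (∀ z → conv G (embed z) → ∃[ n ] z ≈ᶻ p n) →
    ∀ x → E x ⇔ ImageTrans U origin (offset 0ᵖ) (conv G) x
  image-E G inG onG = hull-image G _ (λ z h → let (n , e) = onG z h in in-E n (≈-trans e (plus0 (p n)))) onto
    where
    open Translate 0ᵖ
    plus0 : ∀ z → z ≈ᶻ (z +ᵖ 0ᵖ)
    plus0 z t = sym (ℤₚ.+-identityʳ (z t))
    onto : ∀ w → w ∈ᵖ (e₀ ∷ e₁ ∷ e₂ ∷ e₃ ∷ e₁₂₃ ∷ []) → ∃[ z ] (conv G (embed z) × image z ≈ᶻ w)
    onto w (here e) = r , inG #4 , ≈-trans (place-r {r} (plus0 r)) e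
    onto w (there (here e)) = pᵢ , inG (inject₁ i) , ≈-trans (place-i {pᵢ} (plus0 pᵢ)) e
    onto w (there (there (here e))) = pⱼ , inG (inject₁ j) , ≈-trans (place-j {pⱼ} (plus0 pⱼ)) e
    onto w (there (there (there (here e)))) = pₖ , inG (inject₁ k) , ≈-trans (place-k {pₖ} (plus0 pₖ)) e
    onto w (there (there (there (there (here e))))) = pₛ , inG (inject₁ s) , ≈-trans (place-s {pₛ} (plus0 pₛ)) e

  image-S₂ : ∀ H t → (∀ n → conv H (embed (p (inject₁ n) +ᵖ t))) → (∀ z → conv H (embed z) → ∃[ n ] z ≈ᶻ (p (inject₁ {4} n) +ᵖ t)) →
    ∀ x → S₂ x ⇔ ImageTrans U origin (offset t) (conv H) x
  image-S₂ H t inH onH = hull-image H _ (λ z h → let (n , e) = onH z h in in-S₂ (inject≢4 n) (covers⇒∈ _ covering (inject₁ n)) e) onto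
    where
    open Translate t
    onto : ∀ w → w ∈ᵖ (e₁ ∷ e₂ ∷ e₃ ∷ e₁₂₃ ∷ []) → ∃[ z ] (conv H (embed z) × image z ≈ᶻ w)
    onto w (here e) = pᵢ +ᵖ t , inH i , ≈-trans (place-i {pᵢ +ᵖ t} (λ _ → refl)) e
    onto w (there (here e)) = pⱼ +ᵖ t , inH j , ≈-trans (place-j {pⱼ +ᵖ t} (λ _ → refl)) e
    onto w (there (there (here e))) = pₖ +ᵖ t , inH k , ≈-trans (place-k {pₖ +ᵖ t} (λ _ → refl)) e
    onto w (there (there (there (here e)))) = pₛ +ᵖ t , inH s , ≈-trans (place-s {pₛ +ᵖ t} (λ _ → refl)) e

theorem3p6 : (G H : List Pt)
  → EmptyPolytope G → LatticeCount (conv G) 5 → MinkowskiLength (conv G) 1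
  → LatticeCount (conv H) 4 → MinkowskiLength (conv H) 1
  → MinkowskiLength (conv G ⊕ conv H) 2
  → EquivalentPairs (conv G) (conv H) E S₂
theorem3p6 G H emptyG (a ∷ b ∷ c ∷ d ∷ e ∷ [] , distG , latG , refl) mlG (u ∷ v ∷ w ∷ x ∷ [] , distH , latH , refl) mlH mlGH =
  normalise (normal-form (config G H emptyG mlG mlH mlGH a b c d e distG latG u v w x distH latH))
  where
  p = lookup (a ∷ b ∷ c ∷ d ∷ e ∷ [])
  q = lookup (u ∷ v ∷ w ∷ x ∷ [])
  normalise : NormalForm p q → EquivalentPairs (conv G) (conv H) E S₂
  normalise (σ , τ , t , translate , cfg) = conclude (Quad.shape cfg)
    where
    p′ : Fin 5 → Pt
    p′ n = p (to σ n)
    inG : ∀ n → conv G (embed (p′ n))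
    inG n = Equivalence.from (latG (p′ n)) (lookup-∈ _ (to σ n))
    onG : ∀ z → conv G (embed z) → ∃[ n ] z ≈ᶻ p′ n
    onG z h = let (n , f) = index-of (Equivalence.to (latG z) h) in from σ n , λ m →
      trans (sym (f m)) (cong (λ n → p n m) (sym (Perm.to-from σ n)))
    inH : ∀ n → conv H (embed (p′ (inject₁ n) +ᵖ t))
    inH n = region-resp (conv-conic H) (λ m → cong ι (translate n m)) (Equivalence.from (latH (q (to τ n))) (lookup-∈ _ (to τ n)))
    onH : ∀ z → conv H (embed z) → ∃[ n ] z ≈ᶻ (p′ (inject₁ n) +ᵖ t)
    onH z h = let (n , f) = index-of (Equivalence.to (latH z) h) in from τ n , λ m →
      trans (sym (f m)) (trans (cong (λ n → q n m) (sym (Perm.to-from τ n))) (translate (from τ n) m))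
    conclude : Shape p′ → EquivalentPairs (conv G) (conv H) E S₂
    conclude (i , j , k , s , covering , shape) = U , unimodular , origin , offset 0ᵖ , offset t , image-E G inG onG , image-S₂ H t inH onH
      where open Placement cfg i j k s covering shape
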